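{- There exist universal constants $C>0$ and $c>0$ such that the following holds. For all integers $n,k\ge 1$, every function $f\colon\{0,1\}^n\to\{0,1\}$, every product distribution $\mu$ over $\{0,1\}^n$, every $\epsilon\ge 0$ and every $\delta$ with $0<\delta<n$, $$\mathsf{D}_\epsilon(f^k,\mu^k)\;\ge\; c\cdot\frac{k\delta}{\log(n/\delta)}\cdot\Big(\mathsf{D}_{\epsilon+\delta}(f,\mu)-C\cdot\log(n/\delta)\Big).$$
   Context: Inner products are over $\mathbb{F}_2$: $\langle a,x\rangle=\sum_i a_ix_i \bmod 2$. A deterministic parity decision tree $T$ on $\{0,1\}^N$ is a rooted binary tree in which every internal node is labelled by a vector $a\in\{0,1\}^N$ (the query $\langle a,x\rangle$) and has two children, one for each outcome in $\{0,1\}$, and every leaf is labelled by an output value; $T(x)$ is the label of the leaf reached on input $x$. The depth of $T$ is the maximum number of queries on a root-to-leaf path. For $g\colon\{0,1\}^N\to\{0,1\}^m$ and a probability distribution $\nu$ on $\{0,1\}^N$, $\mathsf{D}_\epsilon(g,\nu)$ is the least depth of a deterministic parity decision tree $T$ with $\Pr_{x\sim\nu}[T(x)\ne g(x)]\le\epsilon$. $f^k\colon(\{0,1\}^n)^k\to\{0,1\}^k$ is $f^k(x^1,\dots,x^k)=(f(x^1),\dots,f(x^k))$, and $\mu^k=\mu\times\cdots\times\mu$ ($k$ times). A distribution on $\{0,1\}^n$ is product if it is a product of $n$ independent Bernoulli distributions. -}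

module Defs where

open import Data.Bool using (Bool; true; false; _∧_; _xor_; if_then_else_)
import Data.Bool.Properties as Bool
import Data.Integer as ℤ
import Data.Integer.Properties as ℤ
open import Data.Nat as ℕ using (ℕ; zero; suc)
import Data.Nat.Properties as ℕ
open import Data.Product using (_×_; _,_; ∃; proj₁; proj₂)
open import Data.Rational as ℚ using (ℚ; 0ℚ; 1ℚ; ½)
import Data.Rational.Properties as ℚ
import Data.Rational.Unnormalised as ℚᵘ
import Data.Rational.Unnormalised.Properties as ℚᵘ
open import Data.Rational.Solver using (module +-*-Solver)
open import Data.Sum using (_⊎_; inj₁; inj₂)
open import Data.Vec using (Vec; []; _∷_; foldr; group; lookup; map; zipWith)
open import Data.Vec.Properties using (≡-dec)
open import Function using (_⇔_; _∘_)
open import Function.Bundles using (Equivalence)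
open import Relation.Binary.PropositionalEquality
  using (_≡_; refl; sym; trans; cong; cong₂; subst)
open import Relation.Nullary using (¬_; Dec; yes; no; does; contradiction)
open import Relation.Nullary.Decidable using (¬?)
open import Relation.Unary using (Decidable)

module Rational where
  fromℕℚ : ℕ → ℚ
  fromℕℚ n = ℤ.+ n ℚ./ 1

  *-mono-≤ : ∀ {a b c d} → 0ℚ ℚ.≤ a → 0ℚ ℚ.≤ d →
             a ℚ.≤ b → c ℚ.≤ d → a ℚ.* c ℚ.≤ b ℚ.* d
  *-mono-≤ {a} {b} {c} {d} 0≤a 0≤d a≤b c≤d = ℚ.≤-trans
    (ℚ.*-monoˡ-≤-nonNeg a {{ℚ.nonNegative 0≤a}} c≤d)
    (ℚ.*-monoʳ-≤-nonNeg d {{ℚ.nonNegative 0≤d}} a≤b)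

  *-pos : ∀ {a b} → 0ℚ ℚ.< a → 0ℚ ℚ.< b → 0ℚ ℚ.< a ℚ.* b
  *-pos {a} {b} 0<a 0<b = ℚ.positive⁻¹ (a ℚ.* b)
    {{ℚ.pos*pos⇒pos a {{ℚ.positive 0<a}} b {{ℚ.positive 0<b}}}}

  *-nonNeg : ∀ {a b} → 0ℚ ℚ.≤ a → 0ℚ ℚ.≤ b → 0ℚ ℚ.≤ a ℚ.* b
  *-nonNeg {a} {b} 0≤a 0≤b = ℚ.nonNegative⁻¹ (a ℚ.* b)
    {{ℚ.nonNeg*nonNeg⇒nonNeg a {{ℚ.nonNegative 0≤a}} b {{ℚ.nonNegative 0≤b}}}}

  0<1 : 0ℚ ℚ.< 1ℚ
  0<1 = ℚ.positive⁻¹ 1ℚ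

  half-pos : ∀ {a} → 0ℚ ℚ.< a → 0ℚ ℚ.< ½ ℚ.* a
  half-pos = *-pos (ℚ.positive⁻¹ ½)

  half+half : ∀ a → ½ ℚ.* a ℚ.+ ½ ℚ.* a ≡ a
  half+half a = trans (sym (ℚ.*-distribʳ-+ a ½ ½)) (ℚ.*-identityˡ a)

  +-cancelʳ-≤ : ∀ {a b} c → a ℚ.+ c ℚ.≤ b ℚ.+ c → a ℚ.≤ b
  +-cancelʳ-≤ {a} {b} c p = ℚ.≤-trans (ℚ.≤-reflexive (eq a))
    (ℚ.≤-trans (ℚ.+-monoˡ-≤ (ℚ.- c) p) (ℚ.≤-reflexive (sym (eq b))))
    where
    open +-*-Solver
    eq : ∀ x → x ≡ x ℚ.+ c ℚ.+ ℚ.- c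
    eq x = solve 2 (λ x c → x := x :+ c :+ :- c) refl x c

  x≤x+ : ∀ x {y} → 0ℚ ℚ.≤ y → x ℚ.≤ x ℚ.+ y
  x≤x+ x 0≤y = ℚ.≤-trans (ℚ.≤-reflexive (sym (ℚ.+-identityʳ x))) (ℚ.+-monoʳ-≤ x 0≤y)

  x<x+ : ∀ x {y} → 0ℚ ℚ.< y → x ℚ.< x ℚ.+ y
  x<x+ x 0<y = subst (ℚ._< x ℚ.+ _) (ℚ.+-identityʳ x) (ℚ.+-monoʳ-< x 0<y)

  a≤∣a∣ : ∀ a → a ℚ.≤ ℚ.∣ a ∣
  a≤∣a∣ a with ℚ.≤-total 0ℚ a
  ... | inj₁ 0≤a = ℚ.≤-reflexive (sym (ℚ.0≤p⇒∣p∣≡p 0≤a))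
  ... | inj₂ a≤0 = ℚ.≤-trans a≤0 (ℚ.0≤∣p∣ a)

  ∣-∣≤⇒≤+ : ∀ a b {e} → ℚ.∣ a ℚ.- b ∣ ℚ.≤ e → a ℚ.≤ b ℚ.+ e
  ∣-∣≤⇒≤+ a b {e} p = ℚ.≤-trans
    (ℚ.≤-reflexive (solve 2 (λ a b → a := b :+ (a :- b)) refl a b))
    (ℚ.+-monoʳ-≤ b (ℚ.≤-trans (a≤∣a∣ (a ℚ.- b)) p))
    where open +-*-Solver

  ∣-∣≤⇒∣∣≤+ : ∀ {a b e} → ℚ.∣ a ℚ.- b ∣ ℚ.≤ e → ℚ.∣ a ∣ ℚ.≤ ℚ.∣ b ∣ ℚ.+ e
  ∣-∣≤⇒∣∣≤+ {a} {b} {e} p = ℚ.≤-trans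
    (ℚ.≤-reflexive (cong ℚ.∣_∣ (solve 2 (λ a b → a := b :+ (a :- b)) refl a b)))
    (ℚ.≤-trans (ℚ.∣p+q∣≤∣p∣+∣q∣ b (a ℚ.- b)) (ℚ.+-monoʳ-≤ ℚ.∣ b ∣ p))
    where open +-*-Solver

  p≤∣↥p∣ : ∀ p → p ℚ.≤ fromℕℚ ℤ.∣ ℚ.↥ p ∣
  p≤∣↥p∣ p@(ℚ.mkℚ i d-1 _) = ℚ.toℚᵘ-cancel-≤
    (ℚᵘ.≤-trans (ℚᵘ.*≤* bound)
      (ℚᵘ.≤-reflexive (ℚᵘ.≃-sym (ℚ.toℚᵘ-fromℚᵘ (ℚᵘ.mkℚᵘ (ℤ.+ ℤ.∣ i ∣) 0)))))
    where
    bound′ : ∀ i → i ℤ.≤ ℤ.+ ℤ.∣ i ∣ ℤ.* ℤ.+ (suc d-1)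
    bound′ (ℤ.+ n)    = subst (ℤ._≤_ (ℤ.+ n)) (ℤ.pos-* n (suc d-1))
                          (ℤ.+≤+ (ℕ.m≤m*n n (suc d-1)))
    bound′ ℤ.-[1+ n ] = subst (ℤ._≤_ ℤ.-[1+ n ]) (ℤ.pos-* (suc n) (suc d-1)) ℤ.-≤+
    bound : i ℤ.* ℤ.+ 1 ℤ.≤ ℤ.+ ℤ.∣ i ∣ ℤ.* ℤ.+ (suc d-1)
    bound = ℤ.≤-trans (ℤ.≤-reflexive (ℤ.*-identityʳ i)) (bound′ i)

  -- Total, so that it can be applied termwise to a Cauchy sequence with a
  -- positive limit, which may still have some zero terms.

  recip : ℚ → ℚ
  recip q with q ℚ.≟ 0ℚ
  ... | yes _  = 0ℚ
  ... | no q≢0 = ℚ.1/_ q {{ℚ.≢-nonZero q≢0}}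

  recip-inverseʳ : ∀ {q} → 0ℚ ℚ.< q → q ℚ.* recip q ≡ 1ℚ
  recip-inverseʳ {q} 0<q with q ℚ.≟ 0ℚ
  ... | yes refl = contradiction 0<q (ℚ.<-irrefl refl)
  ... | no q≢0   = ℚ.*-inverseʳ q {{ℚ.≢-nonZero q≢0}}

  recip-pos : ∀ {q} → 0ℚ ℚ.< q → 0ℚ ℚ.< recip q
  recip-pos {q} 0<q = ℚ.*-cancelˡ-<-nonNeg q {{ℚ.nonNegative (ℚ.<⇒≤ 0<q)}}
    (subst (ℚ._< q ℚ.* recip q) (sym (ℚ.*-zeroʳ q))
      (subst (0ℚ ℚ.<_) (sym (recip-inverseʳ 0<q)) 0<1))

  recip-anti : ∀ {a b} → 0ℚ ℚ.< a → a ℚ.≤ b → recip b ℚ.≤ recip a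
  recip-anti {a} {b} 0<a a≤b = ℚ.≤-trans
    (ℚ.≤-reflexive (trans (sym (ℚ.*-identityˡ _)) (cong (ℚ._* recip b) (sym (recip-inverseʳ 0<a)))))
    (ℚ.≤-trans (*-mono-≤ {a ℚ.* recip a} {recip a ℚ.* b}
        (ℚ.<⇒≤ (*-pos 0<a 0<ra)) (ℚ.<⇒≤ 0<rb)
        (ℚ.≤-trans (ℚ.≤-reflexive (ℚ.*-comm a (recip a)))
          (ℚ.*-monoˡ-≤-nonNeg (recip a) {{ℚ.nonNegative (ℚ.<⇒≤ 0<ra)}} a≤b))
        ℚ.≤-refl)
      (ℚ.≤-reflexive (trans (ℚ.*-assoc (recip a) b (recip b))
        (trans (cong (recip a ℚ.*_) (recip-inverseʳ 0<b)) (ℚ.*-identityʳ _)))))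
    where
    0<b  = ℚ.<-≤-trans 0<a a≤b
    0<ra = recip-pos 0<a
    0<rb = recip-pos 0<b

  archimedean : ∀ {r} → 0ℚ ℚ.< r → ∃ λ q → 1ℚ ℚ.≤ fromℕℚ q ℚ.* r
  archimedean {r} 0<r = ℤ.∣ ℚ.↥ (recip r) ∣ , ℚ.≤-trans
    (ℚ.≤-reflexive (trans (sym (recip-inverseʳ 0<r)) (ℚ.*-comm r (recip r))))
    (ℚ.*-monoʳ-≤-nonNeg r {{ℚ.nonNegative (ℚ.<⇒≤ 0<r)}} (p≤∣↥p∣ (recip r)))

  fromℕℚ-suc : ∀ q → fromℕℚ (suc q) ≡ 1ℚ ℚ.+ fromℕℚ q
  fromℕℚ-suc q = ℚ.toℚᵘ-injective (ℚᵘ.≃-trans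
    (ℚ.toℚᵘ-fromℚᵘ (ℚᵘ.mkℚᵘ (ℤ.+ (suc q)) 0))
    (ℚᵘ.≃-trans (ℚᵘ.*≡* (cong (λ i → (ℤ.+ 1 ℤ.+ i) ℤ.* ℤ.+ 1) (sym (ℤ.*-identityʳ (ℤ.+ q)))))
      (ℚᵘ.≃-trans
        (ℚᵘ.+-congʳ ℚᵘ.1ℚᵘ (ℚᵘ.≃-sym (ℚ.toℚᵘ-fromℚᵘ (ℚᵘ.mkℚᵘ (ℤ.+ q) 0))))
        (ℚᵘ.≃-sym (ℚ.toℚᵘ-homo-+ 1ℚ (fromℕℚ q))))))

  fromℕℚ-nonNeg : ∀ q → 0ℚ ℚ.≤ fromℕℚ q
  fromℕℚ-nonNeg zero    = ℚ.≤-refl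
  fromℕℚ-nonNeg (suc q) = ℚ.≤-trans (fromℕℚ-nonNeg q)
    (ℚ.≤-trans (x≤x+ (fromℕℚ q) (ℚ.<⇒≤ 0<1))
      (ℚ.≤-reflexive (trans (ℚ.+-comm (fromℕℚ q) 1ℚ) (sym (fromℕℚ-suc q)))))

  fromℕℚ-pos : ∀ q → 0ℚ ℚ.< fromℕℚ (suc q)
  fromℕℚ-pos q = ℚ.<-≤-trans 0<1 (ℚ.≤-trans (x≤x+ 1ℚ (fromℕℚ-nonNeg q))
    (ℚ.≤-reflexive (sym (fromℕℚ-suc q))))

  opaque
    +-close : ∀ a b c d {η} → ℚ.∣ a ℚ.- c ∣ ℚ.≤ ½ ℚ.* η → ℚ.∣ b ℚ.- d ∣ ℚ.≤ ½ ℚ.* η →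
              ℚ.∣ (a ℚ.+ b) ℚ.- (c ℚ.+ d) ∣ ℚ.≤ η
    +-close a b c d {η} p q = begin
      ℚ.∣ (a ℚ.+ b) ℚ.- (c ℚ.+ d) ∣         ≡⟨ cong ℚ.∣_∣ (regroup a b c d) ⟩
      ℚ.∣ (a ℚ.- c) ℚ.+ (b ℚ.- d) ∣         ≤⟨ ℚ.∣p+q∣≤∣p∣+∣q∣ (a ℚ.- c) (b ℚ.- d) ⟩
      ℚ.∣ a ℚ.- c ∣ ℚ.+ ℚ.∣ b ℚ.- d ∣       ≤⟨ ℚ.+-mono-≤ p q ⟩
      ½ ℚ.* η ℚ.+ ½ ℚ.* η                   ≡⟨ half+half η ⟩
      η                                     ∎
      where
      open ℚ.≤-Reasoning
      open +-*-Solver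
      regroup : ∀ a b c d → (a ℚ.+ b) ℚ.- (c ℚ.+ d) ≡ (a ℚ.- c) ℚ.+ (b ℚ.- d)
      regroup = solve 4 (λ a b c d → (a :+ b) :- (c :+ d) := (a :- c) :+ (b :- d)) refl

    neg-close : ∀ a b {η} → ℚ.∣ a ℚ.- b ∣ ℚ.≤ η → ℚ.∣ ℚ.- a ℚ.- ℚ.- b ∣ ℚ.≤ η
    neg-close a b {η} p = begin
      ℚ.∣ ℚ.- a ℚ.- ℚ.- b ∣  ≡⟨ cong ℚ.∣_∣ (sym (ℚ.neg-distrib-+ a (ℚ.- b))) ⟩
      ℚ.∣ ℚ.- (a ℚ.- b) ∣    ≡⟨ ℚ.∣-p∣≡∣p∣ (a ℚ.- b) ⟩
      ℚ.∣ a ℚ.- b ∣          ≤⟨ p ⟩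
      η                      ∎
      where open ℚ.≤-Reasoning

    *-close : ∀ a b c d {A B η} → 0ℚ ℚ.< A → 0ℚ ℚ.< B → 0ℚ ℚ.< η →
              ℚ.∣ a ∣ ℚ.≤ A → ℚ.∣ d ∣ ℚ.≤ B →
              ℚ.∣ a ℚ.- c ∣ ℚ.≤ η ℚ.* recip (A ℚ.+ B) →
              ℚ.∣ b ℚ.- d ∣ ℚ.≤ η ℚ.* recip (A ℚ.+ B) →
              ℚ.∣ a ℚ.* b ℚ.- c ℚ.* d ∣ ℚ.≤ η
    *-close a b c d {A} {B} {η} 0<A 0<B 0<η a≤A d≤B ac bd = begin
      ℚ.∣ a ℚ.* b ℚ.- c ℚ.* d ∣
        ≡⟨ cong ℚ.∣_∣ (regroup a b c d) ⟩
      ℚ.∣ a ℚ.* (b ℚ.- d) ℚ.+ d ℚ.* (a ℚ.- c) ∣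
        ≤⟨ ℚ.∣p+q∣≤∣p∣+∣q∣ (a ℚ.* (b ℚ.- d)) (d ℚ.* (a ℚ.- c)) ⟩
      ℚ.∣ a ℚ.* (b ℚ.- d) ∣ ℚ.+ ℚ.∣ d ℚ.* (a ℚ.- c) ∣
        ≡⟨ cong₂ ℚ._+_ (ℚ.∣p*q∣≡∣p∣*∣q∣ a (b ℚ.- d)) (ℚ.∣p*q∣≡∣p∣*∣q∣ d (a ℚ.- c)) ⟩
      ℚ.∣ a ∣ ℚ.* ℚ.∣ b ℚ.- d ∣ ℚ.+ ℚ.∣ d ∣ ℚ.* ℚ.∣ a ℚ.- c ∣
        ≤⟨ ℚ.+-mono-≤ (*-mono-≤ (ℚ.0≤∣p∣ a) 0≤θ a≤A bd) (*-mono-≤ (ℚ.0≤∣p∣ d) 0≤θ d≤B ac) ⟩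
      A ℚ.* (η ℚ.* recip (A ℚ.+ B)) ℚ.+ B ℚ.* (η ℚ.* recip (A ℚ.+ B))
        ≡⟨ collect A B η (recip (A ℚ.+ B)) ⟩
      η ℚ.* ((A ℚ.+ B) ℚ.* recip (A ℚ.+ B))
        ≡⟨ cong (η ℚ.*_) (recip-inverseʳ 0<A+B) ⟩
      η ℚ.* 1ℚ
        ≡⟨ ℚ.*-identityʳ η ⟩
      η ∎
      where
      open ℚ.≤-Reasoning
      open +-*-Solver
      0<A+B : 0ℚ ℚ.< A ℚ.+ B
      0<A+B = ℚ.<-trans 0<A (x<x+ A 0<B)
      0≤θ : 0ℚ ℚ.≤ η ℚ.* recip (A ℚ.+ B)
      0≤θ = ℚ.<⇒≤ (*-pos 0<η (recip-pos 0<A+B))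
      regroup : ∀ a b c d → a ℚ.* b ℚ.- c ℚ.* d ≡ a ℚ.* (b ℚ.- d) ℚ.+ d ℚ.* (a ℚ.- c)
      regroup = solve 4 (λ a b c d → a :* b :- c :* d := a :* (b :- d) :+ d :* (a :- c)) refl
      collect : ∀ A B η r → A ℚ.* (η ℚ.* r) ℚ.+ B ℚ.* (η ℚ.* r) ≡ η ℚ.* ((A ℚ.+ B) ℚ.* r)
      collect = solve 4 (λ A B η r → A :* (η :* r) :+ B :* (η :* r) := η :* ((A :+ B) :* r)) refl

    recip-close : ∀ a b {s η} → 0ℚ ℚ.< s → 0ℚ ℚ.< η → s ℚ.≤ a → s ℚ.≤ b →
                  ℚ.∣ b ℚ.- a ∣ ℚ.≤ η ℚ.* (s ℚ.* s) →
                  ℚ.∣ recip a ℚ.- recip b ∣ ℚ.≤ η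
    recip-close a b {s} {η} 0<s 0<η s≤a s≤b ba = begin
      ℚ.∣ recip a ℚ.- recip b ∣
        ≡⟨ cong ℚ.∣_∣ (sym difference) ⟩
      ℚ.∣ (recip a ℚ.* recip b) ℚ.* (b ℚ.- a) ∣
        ≡⟨ ℚ.∣p*q∣≡∣p∣*∣q∣ (recip a ℚ.* recip b) (b ℚ.- a) ⟩
      ℚ.∣ recip a ℚ.* recip b ∣ ℚ.* ℚ.∣ b ℚ.- a ∣
        ≡⟨ cong (ℚ._* ℚ.∣ b ℚ.- a ∣) (ℚ.0≤p⇒∣p∣≡p (ℚ.<⇒≤ 0<rr)) ⟩
      (recip a ℚ.* recip b) ℚ.* ℚ.∣ b ℚ.- a ∣
        ≤⟨ *-mono-≤ (ℚ.<⇒≤ 0<rr) (ℚ.<⇒≤ (*-pos 0<η (*-pos 0<s 0<s)))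
             (*-mono-≤ (ℚ.<⇒≤ (recip-pos 0<a)) (ℚ.<⇒≤ (recip-pos 0<s))
               (recip-anti 0<s s≤a) (recip-anti 0<s s≤b)) ba ⟩
      (recip s ℚ.* recip s) ℚ.* (η ℚ.* (s ℚ.* s))
        ≡⟨ collect (recip s) η s ⟩
      η ℚ.* ((s ℚ.* recip s) ℚ.* (s ℚ.* recip s))
        ≡⟨ cong (λ u → η ℚ.* (u ℚ.* u)) (recip-inverseʳ 0<s) ⟩
      η ℚ.* 1ℚ
        ≡⟨ ℚ.*-identityʳ η ⟩
      η ∎
      where
      open ℚ.≤-Reasoning
      open +-*-Solver
      0<a : 0ℚ ℚ.< a
      0<a = ℚ.<-≤-trans 0<s s≤a
      0<b : 0ℚ ℚ.< b
      0<b = ℚ.<-≤-trans 0<s s≤b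
      0<rr : 0ℚ ℚ.< recip a ℚ.* recip b
      0<rr = *-pos (recip-pos 0<a) (recip-pos 0<b)
      collect : ∀ r η s → (r ℚ.* r) ℚ.* (η ℚ.* (s ℚ.* s)) ≡ η ℚ.* ((s ℚ.* r) ℚ.* (s ℚ.* r))
      collect = solve 3 (λ r η s → (r :* r) :* (η :* (s :* s)) := η :* ((s :* r) :* (s :* r))) refl
      expand : ∀ a b p q → (p ℚ.* q) ℚ.* (b ℚ.- a) ≡ p ℚ.* (b ℚ.* q) ℚ.- q ℚ.* (a ℚ.* p)
      expand = solve 4 (λ a b p q → (p :* q) :* (b :- a) := p :* (b :* q) :- q :* (a :* p)) refl
      difference : (recip a ℚ.* recip b) ℚ.* (b ℚ.- a) ≡ recip a ℚ.- recip b
      difference = trans (expand a b (recip a) (recip b))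
        (trans (cong₂ (λ u v → recip a ℚ.* u ℚ.- recip b ℚ.* v) (recip-inverseʳ 0<b) (recip-inverseʳ 0<a))
          (cong₂ ℚ._-_ (ℚ.*-identityʳ (recip a)) (ℚ.*-identityʳ (recip b))))

    gap-stable : ∀ u u′ v v′ η →
                 ℚ.∣ u′ ℚ.- u ∣ ℚ.≤ ½ ℚ.* (½ ℚ.* (½ ℚ.* η)) → u ℚ.+ ½ ℚ.* η ℚ.≤ v →
                 ℚ.∣ v ℚ.- v′ ∣ ℚ.≤ ½ ℚ.* (½ ℚ.* (½ ℚ.* η)) →
                 u′ ℚ.+ ½ ℚ.* (½ ℚ.* η) ℚ.≤ v′
    gap-stable u u′ v v′ η u′u gap vv′ = +-cancelʳ-≤ θ (begin
      u′ ℚ.+ ½ ℚ.* κ ℚ.+ θ       ≤⟨ ℚ.+-monoˡ-≤ θ (ℚ.+-monoˡ-≤ (½ ℚ.* κ) (∣-∣≤⇒≤+ u′ u u′u)) ⟩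
      (u ℚ.+ θ) ℚ.+ ½ ℚ.* κ ℚ.+ θ  ≡⟨ regroup u θ (½ ℚ.* κ) ⟩
      u ℚ.+ (½ ℚ.* κ ℚ.+ (θ ℚ.+ θ)) ≡⟨ cong (λ w → u ℚ.+ (½ ℚ.* κ ℚ.+ w)) (half+half (½ ℚ.* κ)) ⟩
      u ℚ.+ (½ ℚ.* κ ℚ.+ ½ ℚ.* κ)   ≡⟨ cong (u ℚ.+_) (half+half κ) ⟩
      u ℚ.+ κ                     ≤⟨ gap ⟩
      v                           ≤⟨ ∣-∣≤⇒≤+ v v′ vv′ ⟩
      v′ ℚ.+ θ                    ∎)
      where
      open ℚ.≤-Reasoning
      open +-*-Solver
      κ θ : ℚ
      κ = ½ ℚ.* η
      θ = ½ ℚ.* (½ ℚ.* κ)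
      regroup : ∀ u t w → (u ℚ.+ t) ℚ.+ w ℚ.+ t ≡ u ℚ.+ (w ℚ.+ (t ℚ.+ t))
      regroup = solve 3 (λ u t w → (u :+ t) :+ w :+ t := u :+ (w :+ (t :+ t))) refl

    gap-halve : ∀ u v w η → v ℚ.≤ u ℚ.+ ½ ℚ.* η → u ℚ.+ η ℚ.≤ w → v ℚ.+ ½ ℚ.* η ℚ.≤ w
    gap-halve u v w η v≤ gap = begin
      v ℚ.+ ½ ℚ.* η                  ≤⟨ ℚ.+-monoˡ-≤ (½ ℚ.* η) v≤ ⟩
      u ℚ.+ ½ ℚ.* η ℚ.+ ½ ℚ.* η      ≡⟨ ℚ.+-assoc u (½ ℚ.* η) (½ ℚ.* η) ⟩
      u ℚ.+ (½ ℚ.* η ℚ.+ ½ ℚ.* η)    ≡⟨ cong (u ℚ.+_) (half+half η) ⟩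
      u ℚ.+ η                        ≤⟨ gap ⟩
      w                              ∎
      where open ℚ.≤-Reasoning

    bernoulli-step : ∀ q {r x y} → 0ℚ ℚ.≤ r → 1ℚ ℚ.+ r ℚ.≤ x → 1ℚ ℚ.+ fromℕℚ q ℚ.* r ℚ.≤ y →
                     1ℚ ℚ.+ fromℕℚ (suc q) ℚ.* r ℚ.≤ x ℚ.* y
    bernoulli-step q {r} {x} {y} 0≤r 1+r≤x 1+qr≤y = begin
      1ℚ ℚ.+ fromℕℚ (suc q) ℚ.* r
        ≡⟨ cong (λ u → 1ℚ ℚ.+ u ℚ.* r) (fromℕℚ-suc q) ⟩
      1ℚ ℚ.+ (1ℚ ℚ.+ u) ℚ.* r
        ≤⟨ x≤x+ (1ℚ ℚ.+ (1ℚ ℚ.+ u) ℚ.* r) (*-nonNeg (fromℕℚ-nonNeg q) (*-nonNeg 0≤r 0≤r)) ⟩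
      1ℚ ℚ.+ (1ℚ ℚ.+ u) ℚ.* r ℚ.+ u ℚ.* (r ℚ.* r)
        ≡⟨ factor u r ⟩
      (1ℚ ℚ.+ r) ℚ.* (1ℚ ℚ.+ u ℚ.* r)
        ≤⟨ *-mono-≤ 0≤1+r (ℚ.≤-trans 0≤1+qr 1+qr≤y) 1+r≤x 1+qr≤y ⟩
      x ℚ.* y ∎
      where
      open ℚ.≤-Reasoning
      open +-*-Solver
      u : ℚ
      u = fromℕℚ q
      0≤1+r : 0ℚ ℚ.≤ 1ℚ ℚ.+ r
      0≤1+r = ℚ.≤-trans (ℚ.<⇒≤ 0<1) (x≤x+ 1ℚ 0≤r)
      0≤1+qr : 0ℚ ℚ.≤ 1ℚ ℚ.+ u ℚ.* r
      0≤1+qr = ℚ.≤-trans (ℚ.<⇒≤ 0<1) (x≤x+ 1ℚ (*-nonNeg (fromℕℚ-nonNeg q) 0≤r))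
      factor : ∀ u r → 1ℚ ℚ.+ (1ℚ ℚ.+ u) ℚ.* r ℚ.+ u ℚ.* (r ℚ.* r) ≡ (1ℚ ℚ.+ r) ℚ.* (1ℚ ℚ.+ u ℚ.* r)
      factor = solve 2 (λ u r → con 1ℚ :+ (con 1ℚ :+ u) :* r :+ u :* (r :* r)
                 := (con 1ℚ :+ r) :* (con 1ℚ :+ u :* r)) refl

    *-cancel-gap : ∀ r η x → 0ℚ ℚ.< r → 0ℚ ℚ.+ η ℚ.≤ r ℚ.* x → 0ℚ ℚ.+ η ℚ.* recip r ℚ.≤ x
    *-cancel-gap r η x 0<r η≤rx = ℚ.*-cancelˡ-≤-pos r {{ℚ.positive 0<r}} (begin
      r ℚ.* (0ℚ ℚ.+ η ℚ.* recip r)  ≡⟨ cong (r ℚ.*_) (ℚ.+-identityˡ (η ℚ.* recip r)) ⟩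
      r ℚ.* (η ℚ.* recip r)         ≡⟨ regroup r η (recip r) ⟩
      η ℚ.* (r ℚ.* recip r)         ≡⟨ cong (η ℚ.*_) (recip-inverseʳ 0<r) ⟩
      η ℚ.* 1ℚ                      ≡⟨ ℚ.*-identityʳ η ⟩
      η                             ≡⟨ sym (ℚ.+-identityˡ η) ⟩
      0ℚ ℚ.+ η                      ≤⟨ η≤rx ⟩
      r ℚ.* x                       ∎)
      where
      open ℚ.≤-Reasoning
      open +-*-Solver
      regroup : ∀ r η s → r ℚ.* (η ℚ.* s) ≡ η ℚ.* (r ℚ.* s)
      regroup = solve 3 (λ r η s → r :* (η :* s) := η :* (r :* s)) refl

    quotient-gap : ∀ m r d → 0ℚ ℚ.< d → 0ℚ ℚ.< r → d ℚ.+ r ℚ.≤ m →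
                   1ℚ ℚ.+ r ℚ.* recip m ℚ.≤ m ℚ.* recip d
    quotient-gap m r d 0<d 0<r d+r≤m = begin
      1ℚ ℚ.+ r ℚ.* recip m
        ≤⟨ ℚ.+-monoʳ-≤ 1ℚ (ℚ.*-monoˡ-≤-nonNeg r {{ℚ.nonNegative (ℚ.<⇒≤ 0<r)}}
             (recip-anti 0<d (ℚ.≤-trans (x≤x+ d (ℚ.<⇒≤ 0<r)) d+r≤m))) ⟩
      1ℚ ℚ.+ r ℚ.* recip d
        ≡⟨ cong (ℚ._+ r ℚ.* recip d) (sym (recip-inverseʳ 0<d)) ⟩
      d ℚ.* recip d ℚ.+ r ℚ.* recip d
        ≡⟨ sym (ℚ.*-distribʳ-+ (recip d) d r) ⟩
      (d ℚ.+ r) ℚ.* recip d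
        ≤⟨ ℚ.*-monoʳ-≤-nonNeg (recip d) {{ℚ.nonNegative (ℚ.<⇒≤ (recip-pos 0<d))}} d+r≤m ⟩
      m ℚ.* recip d ∎
      where open ℚ.≤-Reasoning

open Rational

EventuallyWithin : ℚ → (ℕ → ℚ) → Set
EventuallyWithin η s =
  ∃ λ N → ∀ m n → N ℕ.≤ m → N ℕ.≤ n → ℚ.∣ s m ℚ.- s n ∣ ℚ.≤ η

EventuallyBounded : (ℕ → ℚ) → Set
EventuallyBounded s = ∃ λ B → 0ℚ ℚ.< B × ∃ λ N → ∀ n → N ℕ.≤ n → ℚ.∣ s n ∣ ℚ.≤ B

IsCauchy : (ℕ → ℚ) → Set
IsCauchy s = ∀ η → 0ℚ ℚ.< η → EventuallyWithin η s

record ℝ : Set where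
  constructor mkℝ
  field
    seq    : ℕ → ℚ
    cauchy : IsCauchy seq

open ℝ public

infix  4 _<_ _≤_ _≃_
infixl 6 _+_ _-_
infixl 7 _*_ _/_[_]
infix  8 -_
infixr 8 _^_

_<_ : ℝ → ℝ → Set
x < y = ∃ λ η → 0ℚ ℚ.< η × ∃ λ N → ∀ n → N ℕ.≤ n → seq x n ℚ.+ η ℚ.≤ seq y n

-- Negative, hence stable under double negation.

_≤_ : ℝ → ℝ → Set
x ≤ y = ¬ (y < x)

_≃_ : ℝ → ℝ → Set
x ≃ y = x ≤ y × y ≤ x

fromℚ : ℚ → ℝ
fromℚ q = mkℝ (λ _ → q) λ η 0<η → 0 , λ _ _ _ _ →
  ℚ.≤-trans (ℚ.≤-reflexive (cong ℚ.∣_∣ (ℚ.+-inverseʳ q))) (ℚ.<⇒≤ 0<η)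

fromℕ : ℕ → ℝ
fromℕ n = fromℚ (ℤ.+ n ℚ./ 1)

0ℝ 1ℝ 2ℝ : ℝ
0ℝ = fromℕ 0
1ℝ = fromℕ 1
2ℝ = fromℕ 2

opaque
  +-cauchy : ∀ x y → IsCauchy (λ n → seq x n ℚ.+ seq y n)
  +-cauchy x y η 0<η with cauchy x (½ ℚ.* η) (half-pos 0<η) | cauchy y (½ ℚ.* η) (half-pos 0<η)
  ... | M , close-x | N , close-y = M ℕ.⊔ N , λ m n m≥ n≥ →
    +-close (seq x m) (seq y m) (seq x n) (seq y n)
      (close-x m n (ℕ.m⊔n≤o⇒m≤o M N m≥) (ℕ.m⊔n≤o⇒m≤o M N n≥))
      (close-y m n (ℕ.m⊔n≤o⇒n≤o M N m≥) (ℕ.m⊔n≤o⇒n≤o M N n≥))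

  neg-cauchy : ∀ x → IsCauchy (λ n → ℚ.- seq x n)
  neg-cauchy x η 0<η with cauchy x η 0<η
  ... | N , close = N , λ m n m≥ n≥ → neg-close (seq x m) (seq x n) (close m n m≥ n≥)

_+_ : ℝ → ℝ → ℝ
x + y = mkℝ (λ n → seq x n ℚ.+ seq y n) (+-cauchy x y)

-_ : ℝ → ℝ
- x = mkℝ (λ n → ℚ.- seq x n) (neg-cauchy x)

_-_ : ℝ → ℝ → ℝ
x - y = x + (- y)

eventually-bounded : ∀ x → EventuallyBounded (seq x)
eventually-bounded x with cauchy x 1ℚ 0<1
... | N , close = ℚ.∣ seq x N ∣ ℚ.+ 1ℚ ,
  ℚ.≤-<-trans (ℚ.0≤∣p∣ (seq x N)) (x<x+ ℚ.∣ seq x N ∣ 0<1) ,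
  N , λ n n≥ → ∣-∣≤⇒∣∣≤+ (close n N n≥ ℕ.≤-refl)

opaque
  *-cauchy : ∀ x y → IsCauchy (λ n → seq x n ℚ.* seq y n)
  *-cauchy x y η 0<η = from-bounds (eventually-bounded x) (eventually-bounded y)
    where
    from-bounds :
      EventuallyBounded (seq x) → EventuallyBounded (seq y) →
      EventuallyWithin η (λ n → seq x n ℚ.* seq y n)
    from-bounds (A , 0<A , N₁ , x≤A) (B , 0<B , N₂ , y≤B) =
      from-moduli (cauchy x θ 0<θ) (cauchy y θ 0<θ)
      where
      θ : ℚ
      θ = η ℚ.* recip (A ℚ.+ B)
      0<θ : 0ℚ ℚ.< θ
      0<θ = *-pos 0<η (recip-pos (ℚ.<-trans 0<A (x<x+ A 0<B)))
      from-moduli :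
        EventuallyWithin θ (seq x) → EventuallyWithin θ (seq y) →
        EventuallyWithin η (λ n → seq x n ℚ.* seq y n)
      from-moduli (N₃ , close-x) (N₄ , close-y) = N₁₂ ℕ.⊔ N₃₄ , λ m n m≥ n≥ →
        *-close (seq x m) (seq y m) (seq x n) (seq y n) 0<A 0<B 0<η
          (x≤A m (ℕ.m⊔n≤o⇒m≤o N₁ N₂ (ℕ.m⊔n≤o⇒m≤o N₁₂ N₃₄ m≥)))
          (y≤B n (ℕ.m⊔n≤o⇒n≤o N₁ N₂ (ℕ.m⊔n≤o⇒m≤o N₁₂ N₃₄ n≥)))
          (close-x m n (ℕ.m⊔n≤o⇒m≤o N₃ N₄ (ℕ.m⊔n≤o⇒n≤o N₁₂ N₃₄ m≥))
                       (ℕ.m⊔n≤o⇒m≤o N₃ N₄ (ℕ.m⊔n≤o⇒n≤o N₁₂ N₃₄ n≥)))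
          (close-y m n (ℕ.m⊔n≤o⇒n≤o N₃ N₄ (ℕ.m⊔n≤o⇒n≤o N₁₂ N₃₄ m≥))
                       (ℕ.m⊔n≤o⇒n≤o N₃ N₄ (ℕ.m⊔n≤o⇒n≤o N₁₂ N₃₄ n≥)))
        where
        N₁₂ N₃₄ : ℕ
        N₁₂ = N₁ ℕ.⊔ N₂
        N₃₄ = N₃ ℕ.⊔ N₄

_*_ : ℝ → ℝ → ℝ
x * y = mkℝ (λ n → seq x n ℚ.* seq y n) (*-cauchy x y)

opaque
  recip-cauchy : ∀ y → 0ℝ < y → IsCauchy (λ n → recip (seq y n))
  recip-cauchy y (s , 0<s , N₁ , y≥s) η 0<η =
    from-modulus (cauchy y (η ℚ.* (s ℚ.* s)) (*-pos 0<η (*-pos 0<s 0<s)))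
    where
    s≤ : ∀ n → N₁ ℕ.≤ n → s ℚ.≤ seq y n
    s≤ n n≥ = ℚ.≤-trans (ℚ.≤-reflexive (sym (ℚ.+-identityˡ s))) (y≥s n n≥)
    from-modulus : EventuallyWithin (η ℚ.* (s ℚ.* s)) (seq y) →
                   EventuallyWithin η (λ n → recip (seq y n))
    from-modulus (N₂ , close) = N₁ ℕ.⊔ N₂ , λ m n m≥ n≥ →
      recip-close (seq y m) (seq y n) 0<s 0<η
        (s≤ m (ℕ.m⊔n≤o⇒m≤o N₁ N₂ m≥)) (s≤ n (ℕ.m⊔n≤o⇒m≤o N₁ N₂ n≥))
        (close n m (ℕ.m⊔n≤o⇒n≤o N₁ N₂ n≥) (ℕ.m⊔n≤o⇒n≤o N₁ N₂ m≥))

inverse : (y : ℝ) → 0ℝ < y → ℝ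
inverse y 0<y = mkℝ (λ n → recip (seq y n)) (recip-cauchy y 0<y)

_/_[_] : (x y : ℝ) → 0ℝ < y → ℝ
x / y [ 0<y ] = x * inverse y 0<y

_^_ : ℝ → ℕ → ℝ
x ^ zero  = 1ℝ
x ^ suc q = x * x ^ q

-- L is the binary logarithm of x, for x ≥ 1: the rationals p / q ≥ 0 with
-- p / q ≤ L are exactly those with 2^(p/q) ≤ x. Such an L is unique. For q = 0 both
-- sides say p = 0.

IsLog₂ : (x L : ℝ) → Set
IsLog₂ x L = ∀ p q → 2ℝ ^ p ≤ x ^ q ⇔ fromℕ p ≤ fromℕ q * L

opaque
  cotransitive : ∀ x y → x < y → ∀ z → x < z ⊎ z < y
  cotransitive x y (η , 0<η , N₁ , gap) z =
    from-moduli (cauchy x θ 0<θ) (cauchy y θ 0<θ) (cauchy z θ 0<θ)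
    where
    θ : ℚ
    θ = ½ ℚ.* (½ ℚ.* (½ ℚ.* η))
    0<θ : 0ℚ ℚ.< θ
    0<θ = half-pos (half-pos (half-pos 0<η))
    from-moduli : EventuallyWithin θ (seq x) → EventuallyWithin θ (seq y) →
                  EventuallyWithin θ (seq z) → x < z ⊎ z < y
    from-moduli (N₂ , close-x) (N₃ , close-y) (N₄ , close-z) =
      compare ((seq x M ℚ.+ ½ ℚ.* η) ℚ.≤? seq z M)
      where
      M : ℕ
      M = (N₁ ℕ.⊔ N₂) ℕ.⊔ (N₃ ℕ.⊔ N₄)
      N₁≤M : N₁ ℕ.≤ M
      N₁≤M = ℕ.≤-trans (ℕ.m≤m⊔n N₁ N₂) (ℕ.m≤m⊔n (N₁ ℕ.⊔ N₂) (N₃ ℕ.⊔ N₄))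
      N₂≤M : N₂ ℕ.≤ M
      N₂≤M = ℕ.≤-trans (ℕ.m≤n⊔m N₁ N₂) (ℕ.m≤m⊔n (N₁ ℕ.⊔ N₂) (N₃ ℕ.⊔ N₄))
      N₃≤M : N₃ ℕ.≤ M
      N₃≤M = ℕ.≤-trans (ℕ.m≤m⊔n N₃ N₄) (ℕ.m≤n⊔m (N₁ ℕ.⊔ N₂) (N₃ ℕ.⊔ N₄))
      N₄≤M : N₄ ℕ.≤ M
      N₄≤M = ℕ.≤-trans (ℕ.m≤n⊔m N₃ N₄) (ℕ.m≤n⊔m (N₁ ℕ.⊔ N₂) (N₃ ℕ.⊔ N₄))
      compare : Dec (seq x M ℚ.+ ½ ℚ.* η ℚ.≤ seq z M) → x < z ⊎ z < y
      compare (yes x+½η≤z) = inj₁ (½ ℚ.* (½ ℚ.* η) , half-pos (half-pos 0<η) , M , λ n n≥ →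
        gap-stable (seq x M) (seq x n) (seq z M) (seq z n) η
          (close-x n M (ℕ.≤-trans N₂≤M n≥) N₂≤M) x+½η≤z
          (close-z M n N₄≤M (ℕ.≤-trans N₄≤M n≥)))
      compare (no x+½η≰z) = inj₂ (½ ℚ.* (½ ℚ.* η) , half-pos (half-pos 0<η) , M , λ n n≥ →
        gap-stable (seq z M) (seq z n) (seq y M) (seq y n) η
          (close-z n M (ℕ.≤-trans N₄≤M n≥) N₄≤M)
          (gap-halve (seq x M) (seq z M) (seq y M) η (ℚ.<⇒≤ (ℚ.≰⇒> x+½η≰z)) (gap M N₁≤M))
          (close-y M n N₃≤M (ℕ.≤-trans N₃≤M n≥)))

  bernoulli : ∀ x {r} → 0ℚ ℚ.≤ r → ∀ n → 1ℚ ℚ.+ r ℚ.≤ seq x n →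
              ∀ q → 1ℚ ℚ.+ fromℕℚ q ℚ.* r ℚ.≤ seq (x ^ q) n
  bernoulli x {r} 0≤r n 1+r≤x zero    = ℚ.≤-reflexive
    (trans (cong (1ℚ ℚ.+_) (ℚ.*-zeroˡ r)) (ℚ.+-identityʳ 1ℚ))
  bernoulli x {r} 0≤r n 1+r≤x (suc q) =
    bernoulli-step q 0≤r 1+r≤x (bernoulli x 0≤r n 1+r≤x q)

  *-cancel-pos : ∀ q L → 0ℝ < fromℕ q * L → 0ℝ < L
  *-cancel-pos zero L (η , 0<η , N , η≤0L) = contradiction
    (ℚ.<-≤-trans 0<η η≤0) (ℚ.<-irrefl refl)
    where
    η≤0 : η ℚ.≤ 0ℚ
    η≤0 = ℚ.≤-trans (ℚ.≤-reflexive (sym (ℚ.+-identityˡ η)))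
      (ℚ.≤-trans (η≤0L N ℕ.≤-refl) (ℚ.≤-reflexive (ℚ.*-zeroˡ (seq L N))))
  *-cancel-pos (suc q) L (η , 0<η , N , η≤qL) =
    η ℚ.* recip (fromℕℚ (suc q)) , *-pos 0<η (recip-pos (fromℕℚ-pos q)) , N ,
    λ n n≥ → *-cancel-gap (fromℕℚ (suc q)) η (seq L n) (fromℕℚ-pos q) (η≤qL n n≥)

  log₂-pos : ∀ x L → IsLog₂ x L → 1ℝ < x → 0ℝ < L
  log₂-pos x L isLog (r , 0<r , N , 1+r≤x) = from-power (archimedean 0<r)
    where
    from-power : (∃ λ q → 1ℚ ℚ.≤ fromℕℚ q ℚ.* r) → 0ℝ < L
    from-power (q , 1≤qr) =
      from-⊎ (cotransitive 0ℝ 1ℝ (1ℚ , 0<1 , 0 , λ _ _ → ℚ.≤-refl) (fromℕ q * L))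
      where
      2≤x^q : 2ℝ ^ 1 ≤ x ^ q
      2≤x^q (η , 0<η , M , x^q+η≤2) = ℚ.<-irrefl refl
        (ℚ.<-≤-trans (x<x+ (seq (x ^ q) (N ℕ.⊔ M)) 0<η)
          (ℚ.≤-trans (x^q+η≤2 (N ℕ.⊔ M) (ℕ.m≤n⊔m N M))
            (ℚ.≤-trans (ℚ.+-monoʳ-≤ 1ℚ 1≤qr)
              (bernoulli x (ℚ.<⇒≤ 0<r) (N ℕ.⊔ M) (1+r≤x (N ℕ.⊔ M) (ℕ.m≤m⊔n N M)) q))))
      from-⊎ : 0ℝ < fromℕ q * L ⊎ fromℕ q * L < 1ℝ → 0ℝ < L
      from-⊎ (inj₁ 0<qL) = *-cancel-pos q L 0<qL
      from-⊎ (inj₂ qL<1) = contradiction qL<1 (Equivalence.to (isLog 1 q) 2≤x^q)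

  1<n/δ : ∀ n δ (0<δ : 0ℝ < δ) → δ < fromℕ n → 1ℝ < fromℕ n / δ [ 0<δ ]
  1<n/δ n δ (s , 0<s , N₁ , s≤δ) (r , 0<r , N₂ , δ+r≤n) =
    r ℚ.* recip (fromℕℚ n) , *-pos 0<r (recip-pos 0<n) , N₁ ℕ.⊔ N₂ , λ i i≥ →
      quotient-gap (fromℕℚ n) r (seq δ i) (0<δᵢ i (ℕ.m⊔n≤o⇒m≤o N₁ N₂ i≥)) 0<r
        (δ+r≤n i (ℕ.m⊔n≤o⇒n≤o N₁ N₂ i≥))
    where
    0<δᵢ : ∀ i → N₁ ℕ.≤ i → 0ℚ ℚ.< seq δ i
    0<δᵢ i i≥ = ℚ.<-≤-trans 0<s
      (ℚ.≤-trans (ℚ.≤-reflexive (sym (ℚ.+-identityˡ s))) (s≤δ i i≥))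
    0<n : 0ℚ ℚ.< fromℕℚ n
    0<n = ℚ.<-≤-trans
      (ℚ.<-trans (0<δᵢ (N₁ ℕ.⊔ N₂) (ℕ.m≤m⊔n N₁ N₂)) (x<x+ (seq δ (N₁ ℕ.⊔ N₂)) 0<r))
      (δ+r≤n (N₁ ℕ.⊔ N₂) (ℕ.m≤n⊔m N₁ N₂))

⟨_,_⟩ : ∀ {N} → Vec Bool N → Vec Bool N → Bool
⟨ a , x ⟩ = foldr _ _xor_ false (zipWith _∧_ a x)

data ParityTree (N : ℕ) (A : Set) : Set where
  leaf : A → ParityTree N A
  node : (a : Vec Bool N) (T₀ T₁ : ParityTree N A) → ParityTree N A

eval : ∀ {N A} → ParityTree N A → Vec Bool N → A
eval (leaf v)       x = v
eval (node a T₀ T₁) x = if ⟨ a , x ⟩ then eval T₁ x else eval T₀ x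

depth : ∀ {N A} → ParityTree N A → ℕ
depth (leaf _)       = 0
depth (node _ T₀ T₁) = suc (depth T₀ ℕ.⊔ depth T₁)

-- Distributions on the Boolean cube are given by their probability mass
-- functions Vec Bool N → ℝ.

sumCube : ∀ N → (Vec Bool N → ℝ) → ℝ
sumCube zero    F = F []
sumCube (suc N) F = sumCube N (F ∘ (false ∷_)) + sumCube N (F ∘ (true ∷_))

∏ : ∀ {N} → Vec ℝ N → ℝ
∏ = foldr _ _*_ 1ℝ

IsProduct : ∀ {N} → (Vec Bool N → ℝ) → Set
IsProduct {N} μ = ∃ λ (p : Vec ℝ N) →
  (∀ i → 0ℝ ≤ lookup p i × lookup p i ≤ 1ℝ) ×
  (∀ x → μ x ≃ ∏ (zipWith (λ b q → if b then q else 1ℝ - q) x p))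

Pr : ∀ {N} → (Vec Bool N → ℝ) → {P : Vec Bool N → Set} → Decidable P → ℝ
Pr ν P? = sumCube _ λ x → if does (P? x) then ν x else 0ℝ

error : ∀ {N m} → (Vec Bool N → Vec Bool m) → (Vec Bool N → ℝ) →
        ParityTree N (Vec Bool m) → ℝ
error g ν T = Pr ν λ x → ¬? (≡-dec Bool._≟_ (eval T x) (g x))

-- D[ g , ν , ε ]≡ d says that d is the least depth of a parity decision
-- tree computing g up to error ε under ν. It is a relation rather than a
-- function because the order on ℝ is undecidable; d is unique.

D[_,_,_]≡_ : ∀ {N m} → (Vec Bool N → Vec Bool m) → (Vec Bool N → ℝ) → ℝ → ℕ → Set
D[ g , ν , ε ]≡ d =
  (∃ λ T → error g ν T ≤ ε × depth T ≡ d) ×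
  (∀ T → error g ν T ≤ ε → d ℕ.≤ depth T)

-- ({0,1}ⁿ)ᵏ is identified with {0,1}ᵏⁿ by concatenation.

blocks : ∀ k n → Vec Bool (k ℕ.* n) → Vec (Vec Bool n) k
blocks k n x = proj₁ (group k n x)

directSum : ∀ {n} k → (Vec Bool n → Bool) → Vec Bool (k ℕ.* n) → Vec Bool k
directSum {n} k f x = map f (blocks k n x)

power : ∀ {n} k → (Vec Bool n → ℝ) → Vec Bool (k ℕ.* n) → ℝ
power {n} k μ x = ∏ (map μ (blocks k n x))

{-# OPTIONS --safe #-}

-- In a parity tree for f^k with d queries every input x has the same leaf as some y
-- that lies between x and the most likely input and differs from the latter in at
-- most d positions (column rank). So for some block i the block yⁱ differs in at
-- most q ~ d / (kδ) positions, except with probability δ. The variables outside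
-- block i are eliminated one by one: a Bernoulli bit is a mixture of its likelier
-- value and a uniform bit, and a uniform bit can absorb the first query in which it
-- occurs. This leaves a possibly deep tree S for f each of whose relevant leaves is
-- reached by one of the at most (n + 1)^q points near the most likely input.
-- Finally the leaf of S is found among these candidates by a noisy binary search:
-- a random parity of the constraints that define a node of S is always 0 below the
-- node and uniform elsewhere. This costs O(q log n + log (1/δ)) queries.

module Submission where

open import Defs
open import Data.Bool using (Bool; true; false; _∧_; _xor_; not; if_then_else_)
import Data.Bool.Properties as Bool
open import Data.Empty using (⊥)
open import Data.Fin using (Fin; zero; suc)
import Data.Integer as ℤ
open import Data.List using (List; []; _∷_)
open import Data.Nat as ℕ using (ℕ; zero; suc)
import Data.Nat.Properties as ℕ
open import Data.Product using (∃; _×_; _,_; proj₁; proj₂)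
open import Data.Rational as ℚ using (ℚ; 0ℚ; 1ℚ; ½)
import Data.Rational.Properties as ℚ
open import Data.Rational.Solver using (module +-*-Solver)
open import Data.Sum using (_⊎_; inj₁; inj₂; [_,_]′)
open import Data.Unit using (tt)
open import Data.Vec using (Vec; foldr; []; _∷_; [_]; _++_; take; drop; lookup; map; zipWith; replicate)
import Data.Vec.Properties as Vec
open import Data.Vec.Relation.Unary.All using (All; []; _∷_)
open import Data.Vec.Relation.Binary.Pointwise.Inductive as Pointwise using (Pointwise; []; _∷_)
open import Function using (_∘_)
open import Function.Bundles using (Equivalence)
open import Relation.Binary.PropositionalEquality
  using (_≡_; _≢_; refl; sym; trans; cong; cong₂; subst; subst₂; module ≡-Reasoning)
open import Relation.Nullary using (¬_; Dec; yes; no; does; contradiction)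
open import Relation.Nullary.Decidable using (¬?)
open Rational

-- Fixing the bits outside a block at typical values may lose the sparse representative `y`, which
-- can differ from `x` there and then leaves the restricted tree. This dictates how a bit is
-- eliminated. At its likelier value it may be fixed, because betweenness forces that value on `y`
-- as well; in the uniform part the bit of `y` is free, but the common path either determines it as
-- the pivot or never looks at it. The weighted average of the resulting failure probabilities is
-- the original one, so some choice is no worse. The search discounts by ¾ instead of the Bayesian
-- ½: with ½ the expected odds against the true leaf would not drop when the query is a fair coin.
-- Reals are Cauchy sequences with an undecidable order. The combinatorics is therefore done over ℚ,
-- with a rational product distribution close to `μ` and a rational `δ₀` below `δ` whose margin
-- absorbs the approximation errors. An inequality `≤` between reals is a negation, so proving one
-- means refuting a strict gap, and a single late index suffices for that.

-- Rational powers, indicators and sums over the cube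

infixr 8 _^ℚ_

_^ℚ_ : ℚ → ℕ → ℚ
a ^ℚ zero  = 1ℚ
a ^ℚ suc n = a ℚ.* a ^ℚ n

module _ where
  open +-*-Solver

  ≤-by : ∀ {a b} t → 0ℚ ℚ.≤ t → a ℚ.+ t ≡ b → a ℚ.≤ b
  ≤-by {a} t 0≤t eq = ℚ.≤-trans (x≤x+ a 0≤t) (ℚ.≤-reflexive eq)

  ≤⇒0≤- : ∀ {a b} → a ℚ.≤ b → 0ℚ ℚ.≤ b ℚ.- a
  ≤⇒0≤- {a} {b} a≤b = subst (ℚ._≤ b ℚ.- a) (ℚ.+-inverseʳ a) (ℚ.+-monoˡ-≤ (ℚ.- a) a≤b)

  +-nonNeg : ∀ {a b} → 0ℚ ℚ.≤ a → 0ℚ ℚ.≤ b → 0ℚ ℚ.≤ a ℚ.+ b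
  +-nonNeg {a} 0≤a 0≤b = ℚ.≤-trans 0≤a (x≤x+ a 0≤b)

  *-monoʳ : ∀ {a b} c → 0ℚ ℚ.≤ c → a ℚ.≤ b → c ℚ.* a ℚ.≤ c ℚ.* b
  *-monoʳ c 0≤c = ℚ.*-monoˡ-≤-nonNeg c {{ℚ.nonNegative 0≤c}}

  *-monoˡ : ∀ {a b} c → 0ℚ ℚ.≤ c → a ℚ.≤ b → a ℚ.* c ℚ.≤ b ℚ.* c
  *-monoˡ c 0≤c = ℚ.*-monoʳ-≤-nonNeg c {{ℚ.nonNegative 0≤c}}

  ^-nonNeg : ∀ {a} n → 0ℚ ℚ.≤ a → 0ℚ ℚ.≤ a ^ℚ n
  ^-nonNeg zero    0≤a = ℚ.<⇒≤ 0<1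
  ^-nonNeg (suc n) 0≤a = *-nonNeg 0≤a (^-nonNeg n 0≤a)

  ^-mono-≤ : ∀ {a b} n → 0ℚ ℚ.≤ a → a ℚ.≤ b → a ^ℚ n ℚ.≤ b ^ℚ n
  ^-mono-≤ zero    0≤a a≤b = ℚ.≤-refl
  ^-mono-≤ (suc n) 0≤a a≤b =
    *-mono-≤ 0≤a (^-nonNeg n (ℚ.≤-trans 0≤a a≤b)) a≤b (^-mono-≤ n 0≤a a≤b)

  ^-distribˡ-+ : ∀ a m n → a ^ℚ (m ℕ.+ n) ≡ a ^ℚ m ℚ.* a ^ℚ n
  ^-distribˡ-+ a zero    n = sym (ℚ.*-identityˡ (a ^ℚ n))
  ^-distribˡ-+ a (suc m) n =
    trans (cong (a ℚ.*_) (^-distribˡ-+ a m n)) (sym (ℚ.*-assoc a (a ^ℚ m) (a ^ℚ n)))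

  ^-*-assoc : ∀ a m n → (a ^ℚ m) ^ℚ n ≡ a ^ℚ (n ℕ.* m)
  ^-*-assoc a m zero    = refl
  ^-*-assoc a m (suc n) =
    trans (cong (a ^ℚ m ℚ.*_) (^-*-assoc a m n)) (sym (^-distribˡ-+ a m (n ℕ.* m)))

  ^-distribʳ-* : ∀ a b n → (a ℚ.* b) ^ℚ n ≡ a ^ℚ n ℚ.* b ^ℚ n
  ^-distribʳ-* a b zero    = refl
  ^-distribʳ-* a b (suc n) = trans (cong ((a ℚ.* b) ℚ.*_) (^-distribʳ-* a b n))
    (solve 4 (λ a b c d → (a :* b) :* (c :* d) := (a :* c) :* (b :* d)) refl
      a b (a ^ℚ n) (b ^ℚ n))

𝟙 : Bool → ℚ
𝟙 b = if b then 1ℚ else 0ℚ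

𝟙-nonNeg : ∀ b → 0ℚ ℚ.≤ 𝟙 b
𝟙-nonNeg true  = ℚ.<⇒≤ 0<1
𝟙-nonNeg false = ℚ.≤-refl

𝟙-≤1 : ∀ b → 𝟙 b ℚ.≤ 1ℚ
𝟙-≤1 true  = ℚ.≤-refl
𝟙-≤1 false = ℚ.<⇒≤ 0<1

∑ : ∀ {N} → (Vec Bool N → ℚ) → ℚ
∑ {zero}  F = F []
∑ {suc N} F = ∑ (F ∘ (false ∷_)) ℚ.+ ∑ (F ∘ (true ∷_))

module _ where
  open +-*-Solver

  ∑-cong : ∀ {N} {F G : Vec Bool N → ℚ} → (∀ x → F x ≡ G x) → ∑ F ≡ ∑ G
  ∑-cong {zero}  eq = eq []
  ∑-cong {suc N} eq = cong₂ ℚ._+_ (∑-cong (eq ∘ (false ∷_))) (∑-cong (eq ∘ (true ∷_)))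

  ∑-mono : ∀ {N} {F G : Vec Bool N → ℚ} → (∀ x → F x ℚ.≤ G x) → ∑ F ℚ.≤ ∑ G
  ∑-mono {zero}  le = le []
  ∑-mono {suc N} le = ℚ.+-mono-≤ (∑-mono (le ∘ (false ∷_))) (∑-mono (le ∘ (true ∷_)))

  ∑-nonNeg : ∀ {N} {F : Vec Bool N → ℚ} → (∀ x → 0ℚ ℚ.≤ F x) → 0ℚ ℚ.≤ ∑ F
  ∑-nonNeg {zero}  le = le []
  ∑-nonNeg {suc N} le = +-nonNeg (∑-nonNeg (le ∘ (false ∷_))) (∑-nonNeg (le ∘ (true ∷_)))

  ∑-+ : ∀ {N} (F G : Vec Bool N → ℚ) → ∑ (λ x → F x ℚ.+ G x) ≡ ∑ F ℚ.+ ∑ G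
  ∑-+ {zero}  F G = refl
  ∑-+ {suc N} F G = trans (cong₂ ℚ._+_ (∑-+ (F ∘ (false ∷_)) _) (∑-+ (F ∘ (true ∷_)) _))
    (solve 4 (λ a b c d → (a :+ b) :+ (c :+ d) := (a :+ c) :+ (b :+ d)) refl
      (∑ (F ∘ (false ∷_))) (∑ (G ∘ (false ∷_))) (∑ (F ∘ (true ∷_))) (∑ (G ∘ (true ∷_))))

  ∑-*ˡ : ∀ {N} c (F : Vec Bool N → ℚ) → ∑ (λ x → c ℚ.* F x) ≡ c ℚ.* ∑ F
  ∑-*ˡ {zero}  c F = refl
  ∑-*ˡ {suc N} c F = trans (cong₂ ℚ._+_ (∑-*ˡ c (F ∘ (false ∷_))) (∑-*ˡ c (F ∘ (true ∷_))))
    (sym (ℚ.*-distribˡ-+ c _ _))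

  ∑-swap : ∀ {M N} (F : Vec Bool M → Vec Bool N → ℚ) →
           ∑ (λ x → ∑ (F x)) ≡ ∑ (λ y → ∑ (λ x → F x y))
  ∑-swap {zero}  F = refl
  ∑-swap {suc M} F = trans
    (cong₂ ℚ._+_ (∑-swap (F ∘ (false ∷_))) (∑-swap (F ∘ (true ∷_))))
    (sym (∑-+ (λ y → ∑ (λ x → F (false ∷ x) y)) (λ y → ∑ (λ x → F (true ∷ x) y))))

  ∑-++ : ∀ M {N} (F : Vec Bool (M ℕ.+ N) → ℚ) → ∑ F ≡ ∑ λ (x : Vec Bool M) → ∑ λ (y : Vec Bool N) → F (x ++ y)
  ∑-++ zero    F = refl
  ∑-++ (suc M) F = cong₂ ℚ._+_ (∑-++ M (F ∘ (false ∷_))) (∑-++ M (F ∘ (true ∷_)))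

-- Product distributions with rational parameters

bernoulliℚ : Bool → ℚ → ℚ
bernoulliℚ b p = if b then p else 1ℚ ℚ.- p

pmf : ∀ {N} → Vec ℚ N → Vec Bool N → ℚ
pmf []      []      = 1ℚ
pmf (p ∷ r) (b ∷ x) = bernoulliℚ b p ℚ.* pmf r x

UnitInterval : ℚ → Set
UnitInterval p = 0ℚ ℚ.≤ p × p ℚ.≤ 1ℚ

bernoulliℚ-unit : ∀ b {p} → UnitInterval p → UnitInterval (bernoulliℚ b p)
bernoulliℚ-unit true  u = u
bernoulliℚ-unit false {p} (0≤p , p≤1) = ≤⇒0≤- p≤1 ,
  ≤-by p 0≤p (solve 1 (λ p → (con 1ℚ :- p) :+ p := con 1ℚ) refl p)
  where open +-*-Solver

pmf-unit : ∀ {N} {r : Vec ℚ N} → All UnitInterval r → ∀ x → UnitInterval (pmf r x)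
pmf-unit []      []      = ℚ.<⇒≤ 0<1 , ℚ.≤-refl
pmf-unit (u ∷ us) (b ∷ x) with bernoulliℚ-unit b u | pmf-unit us x
... | 0≤a , a≤1 | 0≤c , c≤1 = *-nonNeg 0≤a 0≤c , *-mono-≤ 0≤a (ℚ.<⇒≤ 0<1) a≤1 c≤1

pmf-nonNeg : ∀ {N} {r : Vec ℚ N} → All UnitInterval r → ∀ x → 0ℚ ℚ.≤ pmf r x
pmf-nonNeg us x = proj₁ (pmf-unit us x)

pmf-total : ∀ {N} (r : Vec ℚ N) → ∑ (pmf r) ≡ 1ℚ
pmf-total []      = refl
pmf-total (p ∷ r) = begin
  ∑ (λ x → (1ℚ ℚ.- p) ℚ.* pmf r x) ℚ.+ ∑ (λ x → p ℚ.* pmf r x)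
    ≡⟨ cong₂ ℚ._+_ (∑-*ˡ (1ℚ ℚ.- p) (pmf r)) (∑-*ˡ p (pmf r)) ⟩
  (1ℚ ℚ.- p) ℚ.* ∑ (pmf r) ℚ.+ p ℚ.* ∑ (pmf r)
    ≡⟨ solve 2 (λ p s → (con 1ℚ :- p) :* s :+ p :* s := s) refl p (∑ (pmf r)) ⟩
  ∑ (pmf r)
    ≡⟨ pmf-total r ⟩
  1ℚ ∎
  where
  open ≡-Reasoning
  open +-*-Solver

pmf-++ : ∀ {M N} (r : Vec ℚ M) (s : Vec ℚ N) x y → pmf (r ++ s) (x ++ y) ≡ pmf r x ℚ.* pmf s y
pmf-++ []      s []      y = sym (ℚ.*-identityˡ (pmf s y))
pmf-++ (p ∷ r) s (b ∷ x) y = trans (cong (bernoulliℚ b p ℚ.*_) (pmf-++ r s x y))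
  (sym (ℚ.*-assoc (bernoulliℚ b p) (pmf r x) (pmf s y)))

-- Affine forms and affine decision trees

-- (γ , a) stands for the affine form γ + ⟨a, x⟩. Affine rather than linear
-- forms are needed because eliminating a variable produces constants.

Form : ℕ → Set
Form N = Bool × Vec Bool N

value : ∀ {N} → Form N → Vec Bool N → Bool
value (γ , a) x = γ xor ⟨ a , x ⟩

infixl 6 _⊕_

_⊕_ : ∀ {N} → Form N → Form N → Form N
(γ , a) ⊕ (δ , b) = γ xor δ , zipWith _xor_ a b

constant : ∀ {N} → Bool → Form N
constant γ = γ , replicate _ false

data AffineTree (N : ℕ) (A : Set) : Set where
  leaf : A → AffineTree N A
  node : (φ : Form N) (T₀ T₁ : AffineTree N A) → AffineTree N A

run : ∀ {N A} → AffineTree N A → Vec Bool N → A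
run (leaf v)       x = v
run (node φ T₀ T₁) x = if value φ x then run T₁ x else run T₀ x

queries : ∀ {N A} → AffineTree N A → Vec Bool N → ℕ
queries (leaf v)       x = 0
queries (node φ T₀ T₁) x = suc (if value φ x then queries T₁ x else queries T₀ x)

-- A common path, not merely a common output: a leaf stands for the affine constraints along its
-- path, and these are what substitution, elimination and the search act on.
data SameLeaf {N A} : AffineTree N A → Vec Bool N → Vec Bool N → Set where
  leaf  : ∀ {v x y} → SameLeaf (leaf v) x y
  node₀ : ∀ {φ T₀ T₁ x y} → value φ x ≡ false → value φ y ≡ false →
          SameLeaf T₀ x y → SameLeaf (node φ T₀ T₁) x y
  node₁ : ∀ {φ T₀ T₁ x y} → value φ x ≡ true → value φ y ≡ true →
          SameLeaf T₁ x y → SameLeaf (node φ T₀ T₁) x y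

module _ where
  open import Data.Bool.Solver using (module xor-∧-Solver)
  open xor-∧-Solver

  ⟨⟩-⊕ : ∀ {N} (a b x : Vec Bool N) → ⟨ zipWith _xor_ a b , x ⟩ ≡ ⟨ a , x ⟩ xor ⟨ b , x ⟩
  ⟨⟩-⊕ []      []      []      = refl
  ⟨⟩-⊕ (α ∷ a) (β ∷ b) (ξ ∷ x) = trans (cong ((α xor β) ∧ ξ xor_) (⟨⟩-⊕ a b x))
    (solve 5 (λ α β ξ u v → ((α :+ β) :* ξ) :+ (u :+ v) := ((α :* ξ) :+ u) :+ ((β :* ξ) :+ v))
      refl α β ξ ⟨ a , x ⟩ ⟨ b , x ⟩)

  value-⊕ : ∀ {N} (φ ψ : Form N) x → value (φ ⊕ ψ) x ≡ value φ x xor value ψ x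
  value-⊕ (γ , a) (δ , b) x = trans (cong ((γ xor δ) xor_) (⟨⟩-⊕ a b x))
    (solve 4 (λ γ δ u v → (γ :+ δ) :+ (u :+ v) := (γ :+ u) :+ (δ :+ v))
      refl γ δ ⟨ a , x ⟩ ⟨ b , x ⟩)

  ⟨⟩-zero : ∀ {N} (x : Vec Bool N) → ⟨ replicate N false , x ⟩ ≡ false
  ⟨⟩-zero []      = refl
  ⟨⟩-zero (_ ∷ x) = ⟨⟩-zero x

  value-constant : ∀ {N} γ (x : Vec Bool N) → value (constant γ) x ≡ γ
  value-constant γ x = trans (cong (γ xor_) (⟨⟩-zero x)) (Bool.xor-identityʳ γ)

  -- Solving the query γ + τ + u = c for the pivot τ gives τ = c + γ + u.

  pivot-value : ∀ c γ u → γ xor (((c xor γ) xor u) xor u) ≡ c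
  pivot-value c γ u = trans (cong (γ xor_) (trans (Bool.xor-assoc (c xor γ) u u)
      (trans (cong ((c xor γ) xor_) (Bool.xor-same u)) (Bool.xor-identityʳ (c xor γ)))))
    (trans (cong (γ xor_) (Bool.xor-comm c γ))
      (trans (sym (Bool.xor-assoc γ γ c)) (cong (_xor c) (Bool.xor-same γ))))

  pivot-unique : ∀ γ τ u → ((γ xor (τ xor u)) xor γ) xor u ≡ τ
  pivot-unique false false false = refl
  pivot-unique false false true  = refl
  pivot-unique false true  false = refl
  pivot-unique false true  true  = refl
  pivot-unique true  false false = refl
  pivot-unique true  false true  = refl
  pivot-unique true  true  false = refl
  pivot-unique true  true  true  = refl

SameLeaf-run : ∀ {N A} {T : AffineTree N A} {x y} → SameLeaf T x y → run T x ≡ run T y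
SameLeaf-run leaf = refl
SameLeaf-run (node₀ p q s) rewrite p | q = SameLeaf-run s
SameLeaf-run (node₁ p q s) rewrite p | q = SameLeaf-run s

SameLeaf-queries : ∀ {N A} {T : AffineTree N A} {x y} → SameLeaf T x y → queries T x ≡ queries T y
SameLeaf-queries leaf = refl
SameLeaf-queries (node₀ p q s) rewrite p | q = cong suc (SameLeaf-queries s)
SameLeaf-queries (node₁ p q s) rewrite p | q = cong suc (SameLeaf-queries s)

SameLeaf-refl : ∀ {N A} (T : AffineTree N A) x → SameLeaf T x x
SameLeaf-refl (leaf v)       x = leaf
SameLeaf-refl (node φ T₀ T₁) x with value φ x in eq
... | false = node₀ eq eq (SameLeaf-refl T₀ x)
... | true  = node₁ eq eq (SameLeaf-refl T₁ x)

SameLeaf-trans : ∀ {N A} {T : AffineTree N A} {x y z} →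
                 SameLeaf T x y → SameLeaf T y z → SameLeaf T x z
SameLeaf-trans leaf          leaf             = leaf
SameLeaf-trans (node₀ p _ s) (node₀ _ q t)    = node₀ p q (SameLeaf-trans s t)
SameLeaf-trans (node₁ p _ s) (node₁ _ q t)    = node₁ p q (SameLeaf-trans s t)
SameLeaf-trans (node₀ _ p _) (node₁ q _ _)    = contradiction (trans (sym p) q) λ ()
SameLeaf-trans (node₁ _ p _) (node₀ q _ _)    = contradiction (trans (sym p) q) λ ()

-- Substituting for the head variable and eliminating it

substForm : ∀ {N} → Form N → Form (suc N) → Form N
substForm ψ (γ , false ∷ a) = γ , a
substForm ψ (γ , true ∷ a)  = ψ ⊕ (γ , a)

value-substForm : ∀ {N} (ψ : Form N) φ x → value (substForm ψ φ) x ≡ value φ (value ψ x ∷ x)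
value-substForm ψ (γ , false ∷ a) x = refl
value-substForm ψ (γ , true ∷ a)  x = trans (value-⊕ ψ (γ , a) x)
  (trans (sym (Bool.xor-assoc (value ψ x) γ ⟨ a , x ⟩))
    (trans (cong (_xor ⟨ a , x ⟩) (Bool.xor-comm (value ψ x) γ))
      (Bool.xor-assoc γ (value ψ x) ⟨ a , x ⟩)))

substTree : ∀ {N A} → Form N → AffineTree (suc N) A → AffineTree N A
substTree ψ (leaf v)       = leaf v
substTree ψ (node φ T₀ T₁) = node (substForm ψ φ) (substTree ψ T₀) (substTree ψ T₁)

run-substTree : ∀ {N A} ψ (T : AffineTree (suc N) A) x →
                run (substTree ψ T) x ≡ run T (value ψ x ∷ x)
run-substTree ψ (leaf v)       x = refl
run-substTree ψ (node φ T₀ T₁) x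
  rewrite value-substForm ψ φ x | run-substTree ψ T₀ x | run-substTree ψ T₁ x = refl

queries-substTree : ∀ {N A} ψ (T : AffineTree (suc N) A) x →
                    queries (substTree ψ T) x ≡ queries T (value ψ x ∷ x)
queries-substTree ψ (leaf v)       x = refl
queries-substTree ψ (node φ T₀ T₁) x
  rewrite value-substForm ψ φ x | queries-substTree ψ T₀ x | queries-substTree ψ T₁ x = refl

SameLeaf-substTree⁺ : ∀ {N A} ψ (T : AffineTree (suc N) A) {x y} →
  SameLeaf T (value ψ x ∷ x) (value ψ y ∷ y) → SameLeaf (substTree ψ T) x y
SameLeaf-substTree⁺ ψ (leaf v) leaf = leaf
SameLeaf-substTree⁺ ψ (node φ T₀ T₁) {x} {y} (node₀ p q s) =
  node₀ (trans (value-substForm ψ φ x) p) (trans (value-substForm ψ φ y) q)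
    (SameLeaf-substTree⁺ ψ T₀ s)
SameLeaf-substTree⁺ ψ (node φ T₀ T₁) {x} {y} (node₁ p q s) =
  node₁ (trans (value-substForm ψ φ x) p) (trans (value-substForm ψ φ y) q)
    (SameLeaf-substTree⁺ ψ T₁ s)

SameLeaf-substTree⁻ : ∀ {N A} ψ (T : AffineTree (suc N) A) {x y} →
  SameLeaf (substTree ψ T) x y → SameLeaf T (value ψ x ∷ x) (value ψ y ∷ y)
SameLeaf-substTree⁻ ψ (leaf v) leaf = leaf
SameLeaf-substTree⁻ ψ (node φ T₀ T₁) {x} {y} (node₀ p q s) =
  node₀ (trans (sym (value-substForm ψ φ x)) p) (trans (sym (value-substForm ψ φ y)) q)
    (SameLeaf-substTree⁻ ψ T₀ s)
SameLeaf-substTree⁻ ψ (node φ T₀ T₁) {x} {y} (node₁ p q s) =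
  node₁ (trans (sym (value-substForm ψ φ x)) p) (trans (sym (value-substForm ψ φ y)) q)
    (SameLeaf-substTree⁻ ψ T₁ s)

-- The tree in which the first query that involves the head variable is answered
-- by c, without looking at the input; from then on that variable is the function
-- pivot c T of the others. For uniform c this simulates a uniform head variable.

elim : ∀ {N A} → Bool → AffineTree (suc N) A → AffineTree N A
elim c (leaf v)                     = leaf v
elim c (node (γ , false ∷ a) T₀ T₁) = node (γ , a) (elim c T₀) (elim c T₁)
elim c (node (γ , true ∷ a) T₀ T₁)  = substTree (c xor γ , a) (if c then T₁ else T₀)

pivot : ∀ {N A} → Bool → AffineTree (suc N) A → Vec Bool N → Bool
-- On a path that never queries the head variable its value is immaterial for the output; `c` keeps
-- the values for the two choices of `c` complementary, as `pivot-not` needs.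
pivot c (leaf v)                     x = c
pivot c (node (γ , false ∷ a) T₀ T₁) x = if value (γ , a) x then pivot c T₁ x else pivot c T₀ x
pivot c (node (γ , true ∷ a) T₀ T₁)  x = value (c xor γ , a) x

run-elim : ∀ {N A} c (T : AffineTree (suc N) A) x → run (elim c T) x ≡ run T (pivot c T x ∷ x)
run-elim c (leaf v) x = refl
run-elim c (node (γ , false ∷ a) T₀ T₁) x with value (γ , a) x
... | false = run-elim c T₀ x
... | true  = run-elim c T₁ x
run-elim false (node (γ , true ∷ a) T₀ T₁) x
  rewrite pivot-value false γ ⟨ a , x ⟩ = run-substTree (false xor γ , a) T₀ x
run-elim true  (node (γ , true ∷ a) T₀ T₁) x
  rewrite pivot-value true γ ⟨ a , x ⟩ = run-substTree (true xor γ , a) T₁ x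

pivot-not : ∀ {N A} (T : AffineTree (suc N) A) x → pivot true T x ≡ not (pivot false T x)
pivot-not (leaf v) x = refl
pivot-not (node (γ , false ∷ a) T₀ T₁) x with value (γ , a) x
... | false = pivot-not T₀ x
... | true  = pivot-not T₁ x
pivot-not (node (false , true ∷ a) T₀ T₁) x = refl
pivot-not (node (true , true ∷ a) T₀ T₁)  x = sym (Bool.not-involutive ⟨ a , x ⟩)

-- The head `τ` may be arbitrary because the path leaves no freedom: either it never queries the
-- head variable, or the first such query has the answer `c` on both sides, and solving that
-- equation gives `τ` as the pivot at `y`.
SameLeaf-elim⁺ : ∀ {N A} c (T : AffineTree (suc N) A) {x τ y} →
  SameLeaf T (pivot c T x ∷ x) (τ ∷ y) → SameLeaf (elim c T) x y
SameLeaf-elim⁺ c (leaf v) leaf = leaf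
SameLeaf-elim⁺ c (node (γ , false ∷ a) T₀ T₁) (node₀ p q s) rewrite p =
  node₀ p q (SameLeaf-elim⁺ c T₀ s)
SameLeaf-elim⁺ c (node (γ , false ∷ a) T₀ T₁) (node₁ p q s) rewrite p =
  node₁ p q (SameLeaf-elim⁺ c T₁ s)
SameLeaf-elim⁺ c (node (γ , true ∷ a) T₀ T₁) {x} {τ} {y} (node₀ p q s)
  with refl ← trans (sym (pivot-value c γ ⟨ a , x ⟩)) p
  with refl ← trans (sym (pivot-unique γ τ ⟨ a , y ⟩)) (cong (λ u → (u xor γ) xor ⟨ a , y ⟩) q)
  = SameLeaf-substTree⁺ (false xor γ , a) T₀ s
SameLeaf-elim⁺ c (node (γ , true ∷ a) T₀ T₁) {x} {τ} {y} (node₁ p q s)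
  with refl ← trans (sym (pivot-value c γ ⟨ a , x ⟩)) p
  with refl ← trans (sym (pivot-unique γ τ ⟨ a , y ⟩)) (cong (λ u → (u xor γ) xor ⟨ a , y ⟩) q)
  = SameLeaf-substTree⁺ (true xor γ , a) T₁ s

SameLeaf-elim⁻ : ∀ {N A} c (T : AffineTree (suc N) A) {x y} →
  SameLeaf (elim c T) x y → SameLeaf T (pivot c T x ∷ x) (pivot c T y ∷ y)
SameLeaf-elim⁻ c (leaf v) leaf = leaf
SameLeaf-elim⁻ c (node (γ , false ∷ a) T₀ T₁) (node₀ p q s) rewrite p | q =
  node₀ p q (SameLeaf-elim⁻ c T₀ s)
SameLeaf-elim⁻ c (node (γ , false ∷ a) T₀ T₁) (node₁ p q s) rewrite p | q =
  node₁ p q (SameLeaf-elim⁻ c T₁ s)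
SameLeaf-elim⁻ false (node (γ , true ∷ a) T₀ T₁) {x} {y} s =
  node₀ (pivot-value false γ ⟨ a , x ⟩) (pivot-value false γ ⟨ a , y ⟩)
    (SameLeaf-substTree⁻ (false xor γ , a) T₀ s)
SameLeaf-elim⁻ true (node (γ , true ∷ a) T₀ T₁) {x} {y} s =
  node₁ (pivot-value true γ ⟨ a , x ⟩) (pivot-value true γ ⟨ a , y ⟩)
    (SameLeaf-substTree⁻ (true xor γ , a) T₁ s)

-- Follow the path of `τ ∷ x`. If it never meets the head variable, flipping that variable changes
-- nothing. Otherwise take for `c` the answer of the first query that meets it: the pivot is then
-- `τ` itself, and `elim c` saves exactly this query.
irrelevant⊎pivot : ∀ {N A} (T : AffineTree (suc N) A) x τ τ′ →
  SameLeaf T (τ ∷ x) (τ′ ∷ x) ⊎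
  ∃ λ c → pivot c T x ≡ τ × suc (queries (elim c T) x) ≡ queries T (τ ∷ x)
irrelevant⊎pivot (leaf v) x τ τ′ = inj₁ leaf
irrelevant⊎pivot (node (γ , false ∷ a) T₀ T₁) x τ τ′ with value (γ , a) x in eq
... | false with irrelevant⊎pivot T₀ x τ τ′
...   | inj₁ s           = inj₁ (node₀ eq eq s)
...   | inj₂ (c , p , q) = inj₂ (c , p , cong suc q)
irrelevant⊎pivot (node (γ , false ∷ a) T₀ T₁) x τ τ′ | true with irrelevant⊎pivot T₁ x τ τ′
...   | inj₁ s           = inj₁ (node₁ eq eq s)
...   | inj₂ (c , p , q) = inj₂ (c , p , cong suc q)
irrelevant⊎pivot (node (γ , true ∷ a) T₀ T₁) x τ τ′ =
  inj₂ (c , pivot-unique γ τ ⟨ a , x ⟩ , cong suc (saved c refl))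
  where
  c : Bool
  c = value (γ , true ∷ a) (τ ∷ x)
  saved : ∀ c → value (γ , true ∷ a) (τ ∷ x) ≡ c →
          queries (substTree (c xor γ , a) (if c then T₁ else T₀)) x ≡
          (if value (γ , true ∷ a) (τ ∷ x) then queries T₁ (τ ∷ x) else queries T₀ (τ ∷ x))
  saved false eq rewrite queries-substTree (false xor γ , a) T₀ x
    | trans (cong (λ u → (u xor γ) xor ⟨ a , x ⟩) (sym eq)) (pivot-unique γ τ ⟨ a , x ⟩) | eq = refl
  saved true  eq rewrite queries-substTree (true xor γ , a) T₁ x
    | trans (cong (λ u → (u xor γ) xor ⟨ a , x ⟩) (sym eq)) (pivot-unique γ τ ⟨ a , x ⟩) | eq = refl

-- Sparse representatives of leaves

dist : ∀ {N} → Vec Bool N → Vec Bool N → ℕ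
dist []      []      = 0
dist (β ∷ b) (ξ ∷ x) = if β xor ξ then suc (dist b x) else dist b x

-- At each position `y` copies `x` or `b`. Hence where `x` already agrees with `b` so does `y`
-- (`Between-head`), which lets `y` survive fixing a variable at its value in `b`.
data Between : ∀ {N} → Vec Bool N → Vec Bool N → Vec Bool N → Set where
  []    : Between [] [] []
  keep  : ∀ {N} {b x y : Vec Bool N} {β ξ} → Between b x y → Between (β ∷ b) (ξ ∷ x) (ξ ∷ y)
  reset : ∀ {N} {b x y : Vec Bool N} {β ξ} → Between b x y → Between (β ∷ b) (ξ ∷ x) (β ∷ y)

-- In linear algebra terms: a sum of vectors of 𝔽₂^d is the sum of at most d of them.

sparse-representative : ∀ {N A} (T : AffineTree N A) b x →
  ∃ λ y → Between b x y × dist b y ℕ.≤ queries T x × SameLeaf T x y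
sparse-representative {zero}  T [] [] = [] , [] , ℕ.z≤n , SameLeaf-refl T []
sparse-representative {suc N} T (β ∷ b) (ξ ∷ x) = choose (ξ Bool.≟ β) (irrelevant⊎pivot T x ξ β)
  where
  Goal : Set
  Goal = ∃ λ y → Between (β ∷ b) (ξ ∷ x) y × dist (β ∷ b) y ℕ.≤ queries T (ξ ∷ x) × SameLeaf T (ξ ∷ x) y

  reset-head : SameLeaf T (ξ ∷ x) (β ∷ x) → Goal
  reset-head s with sparse-representative (substTree (constant β) T) b x
  ... | y , between , small , s′ = β ∷ y , reset between ,
    subst (ℕ._≤ queries T (ξ ∷ x)) (sym dist-eq) (subst (dist b y ℕ.≤_) queries-eq small) ,
    SameLeaf-trans s (subst (λ u → SameLeaf T u (β ∷ y)) (cong (_∷ x) (value-constant β x))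
      (subst (SameLeaf T _) (cong (_∷ y) (value-constant β y)) (SameLeaf-substTree⁻ (constant β) T s′)))
    where
    dist-eq : dist (β ∷ b) (β ∷ y) ≡ dist b y
    dist-eq rewrite Bool.xor-same β = refl
    queries-eq : queries (substTree (constant β) T) x ≡ queries T (ξ ∷ x)
    queries-eq = trans (queries-substTree (constant β) T x)
      (trans (cong (λ u → queries T (u ∷ x)) (value-constant β x)) (sym (SameLeaf-queries s)))

  -- As `ξ` and `β` differ, every bit is one of the two, so the pivot at `y` may take any value.
  between-pivot : ∀ ζ {y} → Between b x y → ξ ≢ β → Between (β ∷ b) (ξ ∷ x) (ζ ∷ y)
  between-pivot ζ between ξ≢β with ζ Bool.≟ β
  ... | yes refl = reset between
  ... | no ζ≢β   = subst (λ u → Between (β ∷ b) (ξ ∷ x) (u ∷ _))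
    (trans (Bool.¬-not ξ≢β) (sym (Bool.¬-not ζ≢β))) (keep between)

  dist-∷ : ∀ ζ y → dist (β ∷ b) (ζ ∷ y) ℕ.≤ suc (dist b y)
  dist-∷ ζ y with β xor ζ
  ... | false = ℕ.n≤1+n (dist b y)
  ... | true  = ℕ.≤-refl

  choose : Dec (ξ ≡ β) →
           SameLeaf T (ξ ∷ x) (β ∷ x) ⊎
           (∃ λ c → pivot c T x ≡ ξ × suc (queries (elim c T) x) ≡ queries T (ξ ∷ x)) → Goal
  choose (yes refl) _        = reset-head (SameLeaf-refl T (ξ ∷ x))
  choose (no _)     (inj₁ s) = reset-head s
  -- The query saved by `elim c` pays for a possible disagreement with `b` at the head.
  choose (no ξ≢β)   (inj₂ (c , p , q)) with sparse-representative (elim c T) b x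
  ... | y , between , small , s = pivot c T y ∷ y , between-pivot (pivot c T y) between ξ≢β ,
    ℕ.≤-trans (dist-∷ (pivot c T y) y) (subst (suc (dist b y) ℕ.≤_) q (ℕ.s≤s small)) ,
    subst (λ u → SameLeaf T (u ∷ x) (pivot c T y ∷ y)) p (SameLeaf-elim⁻ c T s)

-- Eliminating variables under a product distribution

likelier : ℚ → Bool
likelier p with p ℚ.≤? ½
... | yes _ = false
... | no _  = true

majority : ∀ {N} → Vec ℚ N → Vec Bool N
majority = map likelier

-- `g` marks the good inputs, and `R` is what has to be remembered about the representative of a
-- good input, later its closeness to the likeliest point of the kept block. The point `y` itself
-- need not be good.
Simulates : ∀ {N A} → Vec Bool N → AffineTree N A → (Vec Bool N → Bool) →
            (Vec Bool N → A) → (Vec Bool N → Set) → Set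
Simulates b T g v R = ∀ x → g x ≡ true →
  run T x ≡ v x × ∃ λ y → SameLeaf T x y × Between b x y × R y

failure : ∀ {N} → Vec ℚ N → (Vec Bool N → Bool) → ℚ
failure r g = ∑ λ x → pmf r x ℚ.* 𝟙 (not (g x))

module _ where
  open +-*-Solver

  below-mixture : ∀ m A B C → 0ℚ ℚ.≤ m → 0ℚ ℚ.≤ 1ℚ ℚ.- (m ℚ.+ m) →
    let E = (1ℚ ℚ.- (m ℚ.+ m)) ℚ.* A ℚ.+ m ℚ.* (B ℚ.+ C) in
    A ℚ.≤ E ⊎ B ℚ.≤ E ⊎ C ℚ.≤ E
  below-mixture m A B C 0≤m 0≤1-2m = choose (ℚ.≤-total A B) (ℚ.≤-total A C) (ℚ.≤-total B C)
    where
    E : ℚ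
    E = (1ℚ ℚ.- (m ℚ.+ m)) ℚ.* A ℚ.+ m ℚ.* (B ℚ.+ C)
    bound : ∀ x → x ℚ.≤ A → x ℚ.≤ B → x ℚ.≤ C → x ℚ.≤ E
    bound x x≤A x≤B x≤C = ℚ.≤-trans
      (ℚ.≤-reflexive (solve 2 (λ m x → x := (con 1ℚ :- (m :+ m)) :* x :+ m :* (x :+ x)) refl m x))
      (ℚ.+-mono-≤ (*-monoʳ _ 0≤1-2m x≤A) (*-monoʳ m 0≤m (ℚ.+-mono-≤ x≤B x≤C)))
    choose : A ℚ.≤ B ⊎ B ℚ.≤ A → A ℚ.≤ C ⊎ C ℚ.≤ A → B ℚ.≤ C ⊎ C ℚ.≤ B →
             A ℚ.≤ E ⊎ B ℚ.≤ E ⊎ C ℚ.≤ E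
    choose (inj₁ A≤B) (inj₁ A≤C) _          = inj₁ (bound A ℚ.≤-refl A≤B A≤C)
    choose (inj₂ B≤A) _          (inj₁ B≤C) = inj₂ (inj₁ (bound B B≤A ℚ.≤-refl B≤C))
    choose _          (inj₂ C≤A) (inj₂ C≤B) = inj₂ (inj₂ (bound C C≤A C≤B ℚ.≤-refl))
    choose (inj₂ B≤A) (inj₁ A≤C) (inj₂ C≤B) =
      inj₂ (inj₁ (bound B B≤A ℚ.≤-refl (ℚ.≤-trans B≤A A≤C)))
    choose (inj₁ A≤B) (inj₂ C≤A) (inj₁ B≤C) =
      inj₁ (bound A ℚ.≤-refl A≤B (ℚ.≤-trans A≤B B≤C))

  -- A Bernoulli bit is constant with probability 1 − 2m and otherwise uniform,
  -- where m is the smaller of its two probabilities.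

  bernoulliℚ-mixture : ∀ {p} → UnitInterval p → ∃ λ m → 0ℚ ℚ.≤ m × 0ℚ ℚ.≤ 1ℚ ℚ.- (m ℚ.+ m) ×
    (∀ (F : Bool → ℚ) → (1ℚ ℚ.- (m ℚ.+ m)) ℚ.* F (likelier p) ℚ.+ m ℚ.* (F false ℚ.+ F true) ≡
      (1ℚ ℚ.- p) ℚ.* F false ℚ.+ p ℚ.* F true)
  bernoulliℚ-mixture {p} (0≤p , p≤1) with p ℚ.≤? ½
  ... | yes p≤½ = p , 0≤p , ≤⇒0≤- (ℚ.+-mono-≤ p≤½ p≤½) , λ F →
    solve 3 (λ p a b → (con 1ℚ :- (p :+ p)) :* a :+ p :* (a :+ b) := (con 1ℚ :- p) :* a :+ p :* b)
      refl p (F false) (F true)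
  ... | no p≰½ = 1ℚ ℚ.- p , ≤⇒0≤- p≤1 ,
    subst (0ℚ ℚ.≤_) (solve 1 (λ p → (p :+ p) :- con 1ℚ := con 1ℚ :- ((con 1ℚ :- p) :+ (con 1ℚ :- p))) refl p)
      (≤⇒0≤- (ℚ.+-mono-≤ ½≤p ½≤p)) , λ F →
    solve 3 (λ p a b → (con 1ℚ :- ((con 1ℚ :- p) :+ (con 1ℚ :- p))) :* b :+ (con 1ℚ :- p) :* (a :+ b)
        := (con 1ℚ :- p) :* a :+ p :* b)
      refl p (F false) (F true)
    where
    ½≤p : ½ ℚ.≤ p
    ½≤p = ℚ.<⇒≤ (ℚ.≰⇒> p≰½)

  failure-∷ : ∀ {N} p (r : Vec ℚ N) g → failure (p ∷ r) g ≡
    (1ℚ ℚ.- p) ℚ.* failure r (g ∘ (false ∷_)) ℚ.+ p ℚ.* failure r (g ∘ (true ∷_))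
  failure-∷ p r g = cong₂ ℚ._+_ (part false) (part true)
    where
    part : ∀ τ → ∑ (λ x → (bernoulliℚ τ p ℚ.* pmf r x) ℚ.* 𝟙 (not (g (τ ∷ x)))) ≡
           bernoulliℚ τ p ℚ.* failure r (g ∘ (τ ∷_))
    part τ = trans (∑-cong λ x → ℚ.*-assoc (bernoulliℚ τ p) (pmf r x) (𝟙 (not (g (τ ∷ x)))))
      (∑-*ˡ (bernoulliℚ τ p) (λ x → pmf r x ℚ.* 𝟙 (not (g (τ ∷ x)))))

-- For each fixed `x` the two pivots are complementary by `pivot-not`, so together they run through
-- both values of the head bit. A uniform `c` thus makes the pivot a uniform bit independent of `x`.
failure-pivot : ∀ {N A} (r : Vec ℚ N) (T : AffineTree (suc N) A) (g : Vec Bool (suc N) → Bool) →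
  failure r (λ x → g (pivot false T x ∷ x)) ℚ.+ failure r (λ x → g (pivot true T x ∷ x)) ≡
  failure r (g ∘ (false ∷_)) ℚ.+ failure r (g ∘ (true ∷_))
failure-pivot r T g = trans
  (sym (∑-+ (λ x → pmf r x ℚ.* 𝟙 (not (g (pivot false T x ∷ x))))
            (λ x → pmf r x ℚ.* 𝟙 (not (g (pivot true T x ∷ x))))))
  (trans (∑-cong pointwise)
    (∑-+ (λ x → pmf r x ℚ.* 𝟙 (not (g (false ∷ x)))) (λ x → pmf r x ℚ.* 𝟙 (not (g (true ∷ x))))))
  where
  pointwise : ∀ x →
    pmf r x ℚ.* 𝟙 (not (g (pivot false T x ∷ x))) ℚ.+ pmf r x ℚ.* 𝟙 (not (g (pivot true T x ∷ x))) ≡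
    pmf r x ℚ.* 𝟙 (not (g (false ∷ x))) ℚ.+ pmf r x ℚ.* 𝟙 (not (g (true ∷ x)))
  pointwise x rewrite pivot-not T x with pivot false T x
  ... | false = refl
  ... | true  = ℚ.+-comm (pmf r x ℚ.* 𝟙 (not (g (true ∷ x)))) (pmf r x ℚ.* 𝟙 (not (g (false ∷ x))))

Between-tail : ∀ {N β ξ η} {b x y : Vec Bool N} → Between (β ∷ b) (ξ ∷ x) (η ∷ y) → Between b x y
Between-tail (keep between)  = between
Between-tail (reset between) = between

Between-head : ∀ {N β η} {b x y : Vec Bool N} → Between (β ∷ b) (β ∷ x) (η ∷ y) → η ≡ β
Between-head (keep _)  = refl
Between-head (reset _) = refl

Simulated : ∀ {N A} → Vec ℚ N → (Vec Bool N → A) → (Vec Bool N → Set) → ℚ → Set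
Simulated {N} {A} r v R e = ∃ λ (S : AffineTree N A) → ∃ λ g →
  Simulates (majority r) S g v R × failure r g ℚ.≤ e

-- By `bernoulliℚ-mixture` the failure probability is a weighted average over three trees: the head
-- fixed at its likelier value with weight 1 - 2m, and the pivot for either `c` with weight m each.
-- By `below-mixture` one of them does not exceed the average.
eliminate-variable : ∀ {N A p} {r : Vec ℚ N} → UnitInterval p →
  ∀ (T : AffineTree (suc N) A) g {v v′} {R : Vec Bool (suc N) → Set} {R′ : Vec Bool N → Set} →
  (∀ τ x → v (τ ∷ x) ≡ v′ x) → (∀ τ x → R (τ ∷ x) → R′ x) →
  Simulates (majority (p ∷ r)) T g v R → Simulated r v′ R′ (failure (p ∷ r) g)
eliminate-variable {N} {A} {p} {r} unit T g {v} {v′} {R} {R′} v≡v′ R⇒R′ simulates =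
  from-mixture (bernoulliℚ-mixture unit)
  where
  β : Bool
  β = likelier p

  constant-simulates : Simulates (majority r) (substTree (constant β) T) (g ∘ (β ∷_)) v′ R′
  constant-simulates x gx with simulates (β ∷ x) gx
  -- The input has the likelier head `β`, so the representative has it too and its tail remains a
  -- representative.
  ... | v-eq , η ∷ y , same , between , Ry with refl ← Between-head between =
    trans (run-substTree (constant β) T x)
      (trans (cong (λ u → run T (u ∷ x)) (value-constant β x)) (trans v-eq (v≡v′ β x))) ,
    y , SameLeaf-substTree⁺ (constant β) T same′ , Between-tail between , R⇒R′ β y Ry
    where
    same′ : SameLeaf T (value (constant β) x ∷ x) (value (constant β) y ∷ y)
    same′ rewrite value-constant β x | value-constant β y = same

  coin-simulates : ∀ c → Simulates (majority r) (elim c T) (λ x → g (pivot c T x ∷ x)) v′ R′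
  coin-simulates c x gx with simulates (pivot c T x ∷ x) gx
  -- Here the head `η` of the representative is unknown; `SameLeaf-elim⁺` accepts any.
  ... | v-eq , η ∷ y , same , between , Ry =
    trans (run-elim c T x) (trans v-eq (v≡v′ (pivot c T x) x)) ,
    y , SameLeaf-elim⁺ c T same , Between-tail between , R⇒R′ η y Ry

  from-mixture : (∃ λ m → 0ℚ ℚ.≤ m × 0ℚ ℚ.≤ 1ℚ ℚ.- (m ℚ.+ m) ×
    (∀ (F : Bool → ℚ) → (1ℚ ℚ.- (m ℚ.+ m)) ℚ.* F (likelier p) ℚ.+ m ℚ.* (F false ℚ.+ F true) ≡
      (1ℚ ℚ.- p) ℚ.* F false ℚ.+ p ℚ.* F true)) → Simulated r v′ R′ (failure (p ∷ r) g)
  from-mixture (m , 0≤m , 0≤1-2m , mixture) = choose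
    (below-mixture m (failure r (g ∘ (β ∷_))) (failure r (λ x → g (pivot false T x ∷ x)))
      (failure r (λ x → g (pivot true T x ∷ x))) 0≤m 0≤1-2m)
    where
    E : ℚ
    E = (1ℚ ℚ.- (m ℚ.+ m)) ℚ.* failure r (g ∘ (β ∷_)) ℚ.+
        m ℚ.* (failure r (λ x → g (pivot false T x ∷ x)) ℚ.+ failure r (λ x → g (pivot true T x ∷ x)))
    total : E ≡ failure (p ∷ r) g
    total = trans
      (cong (λ u → (1ℚ ℚ.- (m ℚ.+ m)) ℚ.* failure r (g ∘ (β ∷_)) ℚ.+ m ℚ.* u) (failure-pivot r T g))
      (trans (mixture (λ τ → failure r (g ∘ (τ ∷_)))) (sym (failure-∷ p r g)))
    choose : failure r (g ∘ (β ∷_)) ℚ.≤ E ⊎ failure r (λ x → g (pivot false T x ∷ x)) ℚ.≤ E ⊎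
             failure r (λ x → g (pivot true T x ∷ x)) ℚ.≤ E → Simulated r v′ R′ (failure (p ∷ r) g)
    choose (inj₁ le)        = _ , _ , constant-simulates , subst (_ ℚ.≤_) total le
    choose (inj₂ (inj₁ le)) = _ , _ , coin-simulates false , subst (_ ℚ.≤_) total le
    choose (inj₂ (inj₂ le)) = _ , _ , coin-simulates true , subst (_ ℚ.≤_) total le

eliminate-variables : ∀ {M N A} {s : Vec ℚ M} {r : Vec ℚ N} → All UnitInterval s →
  ∀ (T : AffineTree (M ℕ.+ N) A) g {v} {R : Vec Bool N → Set} →
  Simulates (majority (s ++ r)) T g (v ∘ drop M) (R ∘ drop M) → Simulated r v R (failure (s ++ r) g)
eliminate-variables [] T g simulates = T , g , simulates , ℚ.≤-refl
eliminate-variables (u ∷ us) T g {v} {R} simulates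
  with eliminate-variable u T g (λ _ _ → refl) (λ _ _ Ry → Ry) simulates
... | S , h , simulates′ , le with eliminate-variables us S h {v} {R} simulates′
...   | S′ , h′ , simulates″ , le′ = S′ , h′ , simulates″ , ℚ.≤-trans le′ le

-- Isolating one block

-- Elimination acts on head variables only, so a block that is to be kept has to stand behind the
-- others.
rotate : ∀ {A : Set} M {N} → Vec A (M ℕ.+ N) → Vec A (N ℕ.+ M)
rotate M x = drop M x ++ take M x

take-++ : ∀ {A : Set} {M N} (x : Vec A M) (y : Vec A N) → take M (x ++ y) ≡ x
take-++ []      y = refl
take-++ (a ∷ x) y = cong (a ∷_) (take-++ x y)

drop-++ : ∀ {A : Set} {M N} (x : Vec A M) (y : Vec A N) → drop M (x ++ y) ≡ y
drop-++ []      y = refl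
drop-++ (a ∷ x) y = drop-++ x y

rotate-++ : ∀ {A : Set} {M N} (x : Vec A M) (y : Vec A N) → rotate M (x ++ y) ≡ y ++ x
rotate-++ x y = cong₂ _++_ (drop-++ x y) (take-++ x y)

rotate-rotate : ∀ {A : Set} M {N} (x : Vec A (M ℕ.+ N)) → rotate N (rotate M x) ≡ x
rotate-rotate M x = trans (rotate-++ (drop M x) (take M x)) (Vec.take++drop≡id M x)

⟨⟩-++ : ∀ {M N} (a : Vec Bool M) (b : Vec Bool N) x y → ⟨ a ++ b , x ++ y ⟩ ≡ ⟨ a , x ⟩ xor ⟨ b , y ⟩
⟨⟩-++ []      b []      y = refl
⟨⟩-++ (α ∷ a) b (ξ ∷ x) y = trans (cong ((α ∧ ξ) xor_) (⟨⟩-++ a b x y))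
  (sym (Bool.xor-assoc (α ∧ ξ) ⟨ a , x ⟩ ⟨ b , y ⟩))

rotateForm : ∀ M {N} → Form (M ℕ.+ N) → Form (N ℕ.+ M)
rotateForm M (γ , a) = γ , rotate M a

value-rotateForm : ∀ M {N} (φ : Form (M ℕ.+ N)) x → value (rotateForm M φ) (rotate M x) ≡ value φ x
value-rotateForm M (γ , a) x = cong (γ xor_) (begin
  ⟨ drop M a ++ take M a , drop M x ++ take M x ⟩
    ≡⟨ ⟨⟩-++ (drop M a) (take M a) (drop M x) (take M x) ⟩
  ⟨ drop M a , drop M x ⟩ xor ⟨ take M a , take M x ⟩
    ≡⟨ Bool.xor-comm ⟨ drop M a , drop M x ⟩ ⟨ take M a , take M x ⟩ ⟩
  ⟨ take M a , take M x ⟩ xor ⟨ drop M a , drop M x ⟩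
    ≡⟨ sym (⟨⟩-++ (take M a) (drop M a) (take M x) (drop M x)) ⟩
  ⟨ take M a ++ drop M a , take M x ++ drop M x ⟩
    ≡⟨ cong₂ ⟨_,_⟩ (Vec.take++drop≡id M a) (Vec.take++drop≡id M x) ⟩
  ⟨ a , x ⟩ ∎)
  where open ≡-Reasoning

rotateTree : ∀ M {N A} → AffineTree (M ℕ.+ N) A → AffineTree (N ℕ.+ M) A
rotateTree M (leaf v)       = leaf v
rotateTree M (node φ T₀ T₁) = node (rotateForm M φ) (rotateTree M T₀) (rotateTree M T₁)

run-rotateTree : ∀ M {N A} (T : AffineTree (M ℕ.+ N) A) x → run (rotateTree M T) (rotate M x) ≡ run T x
run-rotateTree M (leaf v)       x = refl
run-rotateTree M (node φ T₀ T₁) x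
  rewrite value-rotateForm M φ x | run-rotateTree M T₀ x | run-rotateTree M T₁ x = refl

SameLeaf-rotateTree : ∀ M {N A} {T : AffineTree (M ℕ.+ N) A} {x y} →
  SameLeaf T x y → SameLeaf (rotateTree M T) (rotate M x) (rotate M y)
SameLeaf-rotateTree M leaf = leaf
SameLeaf-rotateTree M {T = node φ _ _} {x} {y} (node₀ p q s) = node₀
  (trans (value-rotateForm M φ x) p) (trans (value-rotateForm M φ y) q) (SameLeaf-rotateTree M s)
SameLeaf-rotateTree M {T = node φ _ _} {x} {y} (node₁ p q s) = node₁
  (trans (value-rotateForm M φ x) p) (trans (value-rotateForm M φ y) q) (SameLeaf-rotateTree M s)

Between-++ : ∀ {M N} {b x y : Vec Bool M} {c z w : Vec Bool N} →
             Between b x y → Between c z w → Between (b ++ c) (x ++ z) (y ++ w)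
Between-++ []      q = q
Between-++ (keep p)  q = keep (Between-++ p q)
Between-++ (reset p) q = reset (Between-++ p q)

Between-take : ∀ M {N} {b x y : Vec Bool (M ℕ.+ N)} →
               Between b x y → Between (take M b) (take M x) (take M y)
Between-take zero    p         = []
Between-take (suc M) (keep p)  = keep (Between-take M p)
Between-take (suc M) (reset p) = reset (Between-take M p)

Between-drop : ∀ M {N} {b x y : Vec Bool (M ℕ.+ N)} →
               Between b x y → Between (drop M b) (drop M x) (drop M y)
Between-drop zero    p         = p
Between-drop (suc M) (keep p)  = Between-drop M p
Between-drop (suc M) (reset p) = Between-drop M p

Between-rotate : ∀ M {N} {b x y : Vec Bool (M ℕ.+ N)} →
                 Between b x y → Between (rotate M b) (rotate M x) (rotate M y)
Between-rotate M p = Between-++ (Between-drop M p) (Between-take M p)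

failure-rotate : ∀ {M N} (s : Vec ℚ M) (r : Vec ℚ N) g →
  failure (r ++ s) (g ∘ rotate N) ≡ failure (s ++ r) g
failure-rotate {M} {N} s r g = begin
  failure (r ++ s) (g ∘ rotate N)
    ≡⟨ ∑-++ N (λ x → pmf (r ++ s) x ℚ.* 𝟙 (not (g (rotate N x)))) ⟩
  ∑ (λ (y : Vec Bool N) → ∑ λ (x : Vec Bool M) →
      pmf (r ++ s) (y ++ x) ℚ.* 𝟙 (not (g (rotate N (y ++ x)))))
    ≡⟨ ∑-swap (λ (y : Vec Bool N) (x : Vec Bool M) →
         pmf (r ++ s) (y ++ x) ℚ.* 𝟙 (not (g (rotate N (y ++ x))))) ⟩
  ∑ (λ (x : Vec Bool M) → ∑ λ (y : Vec Bool N) →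
      pmf (r ++ s) (y ++ x) ℚ.* 𝟙 (not (g (rotate N (y ++ x)))))
    ≡⟨ ∑-cong (λ x → ∑-cong (λ y → cong₂ (λ u w → u ℚ.* 𝟙 (not (g w))) (pmf-swap x y) (rotate-++ y x))) ⟩
  ∑ (λ (x : Vec Bool M) → ∑ λ (y : Vec Bool N) → pmf (s ++ r) (x ++ y) ℚ.* 𝟙 (not (g (x ++ y))))
    ≡⟨ sym (∑-++ M (λ x → pmf (s ++ r) x ℚ.* 𝟙 (not (g x)))) ⟩
  failure (s ++ r) g ∎
  where
  open ≡-Reasoning
  pmf-swap : ∀ x y → pmf (r ++ s) (y ++ x) ≡ pmf (s ++ r) (x ++ y)
  pmf-swap x y = trans (pmf-++ r s y x)
    (trans (ℚ.*-comm (pmf r y) (pmf s x)) (sym (pmf-++ s r x y)))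

powerℚ : ∀ {n} k → Vec ℚ n → Vec ℚ (k ℕ.* n)
powerℚ zero    r = []
powerℚ (suc k) r = r ++ powerℚ k r

All-++ : ∀ {M N} {P : ℚ → Set} {s : Vec ℚ M} {r : Vec ℚ N} → All P s → All P r → All P (s ++ r)
All-++ []       qs = qs
All-++ (p ∷ ps) qs = p ∷ All-++ ps qs

powerℚ-unit : ∀ {n} k {r : Vec ℚ n} → All UnitInterval r → All UnitInterval (powerℚ k r)
powerℚ-unit zero    us = []
powerℚ-unit (suc k) us = All-++ us (powerℚ-unit k us)

block : ∀ {n} k → Fin k → Vec Bool (k ℕ.* n) → Vec Bool n
block {n} k i x = lookup (blocks k n x) i

-- Induction on the position of the block: blocks in front of it are eliminated one at a time, and
-- once it is the first it is rotated to the end and all later blocks are eliminated together.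
isolate-block : ∀ {n A} {r : Vec ℚ n} → All UnitInterval r → ∀ k (i : Fin k)
  (T : AffineTree (k ℕ.* n) A) g {v} {R : Vec Bool n → Set} →
  Simulates (majority (powerℚ k r)) T g (v ∘ block k i) (R ∘ block k i) →
  Simulated r v R (failure (powerℚ k r) g)
isolate-block {n} {r = r} us (suc k) zero T g {v} {R} simulates =
  subst (Simulated r v R) (failure-rotate r (powerℚ k r) g)
    (eliminate-variables (powerℚ-unit k us) (rotateTree n T) (g ∘ rotate (k ℕ.* n)) rotated)
  where
  m : ℕ
  m = k ℕ.* n
  rotated : Simulates (majority (powerℚ k r ++ r)) (rotateTree n T) (g ∘ rotate m) (v ∘ drop m) (R ∘ drop m)
  rotated x gx with simulates (rotate m x) gx
  ... | v-eq , y , same , between , Ry =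
    trans (subst (λ u → run (rotateTree n T) u ≡ run T (rotate m x)) (rotate-rotate m x)
        (run-rotateTree n T (rotate m x)))
      (trans v-eq (cong v (take-++ (drop m x) (take m x)))) ,
    rotate n y ,
    subst (λ u → SameLeaf (rotateTree n T) u (rotate n y)) (rotate-rotate m x) (SameLeaf-rotateTree n same) ,
    subst (λ u → Between u x (rotate n y)) majority-eq
      (subst (λ u → Between (rotate n (majority (r ++ powerℚ k r))) u (rotate n y)) (rotate-rotate m x)
        (Between-rotate n between)) ,
    subst R (sym (drop-++ (drop n y) (take n y))) Ry
    where
    majority-eq : rotate n (majority (r ++ powerℚ k r)) ≡ majority (powerℚ k r ++ r)
    majority-eq = trans (cong (rotate n) (Vec.map-++ likelier r (powerℚ k r)))
      (trans (rotate-++ (majority r) (majority (powerℚ k r)))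
        (sym (Vec.map-++ likelier (powerℚ k r) r)))
isolate-block {n} us (suc k) (suc i) T g {v} {R} simulates
  with eliminate-variables us T g {v ∘ block k i} {R ∘ block k i} simulates
... | S , h , simulates′ , le with isolate-block us k i S h {v} {R} simulates′
...   | S′ , h′ , simulates″ , le′ = S′ , h′ , simulates″ , ℚ.≤-trans le′ le

-- Weights of leaves and balanced nodes

𝟙-∧ : ∀ a b → 𝟙 (a ∧ b) ≡ 𝟙 a ℚ.* 𝟙 b
𝟙-∧ true  b = sym (ℚ.*-identityˡ (𝟙 b))
𝟙-∧ false b = sym (ℚ.*-zeroˡ (𝟙 b))

sameLeaf : ∀ {N A} → AffineTree N A → Vec Bool N → Vec Bool N → Bool
sameLeaf (leaf v)       x z = true
sameLeaf (node φ T₀ T₁) x z =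
  if value φ x then value φ z ∧ sameLeaf T₁ x z else not (value φ z) ∧ sameLeaf T₀ x z

SameLeaf⇒sameLeaf : ∀ {N A} {T : AffineTree N A} {x z} → SameLeaf T x z → sameLeaf T x z ≡ true
SameLeaf⇒sameLeaf leaf = refl
SameLeaf⇒sameLeaf (node₀ p q s) rewrite p | q = SameLeaf⇒sameLeaf s
SameLeaf⇒sameLeaf (node₁ p q s) rewrite p | q = SameLeaf⇒sameLeaf s

mass : ∀ {N} → (Vec Bool N → ℚ) → (Vec Bool N → Bool) → ℚ
mass W P = ∑ λ z → W z ℚ.* 𝟙 (P z)

cell : ∀ {N A} → AffineTree N A → (Vec Bool N → ℚ) → Vec Bool N → ℚ
cell T W x = mass W (sameLeaf T x)

NonNeg : ∀ {N} → (Vec Bool N → ℚ) → Set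
NonNeg W = ∀ x → 0ℚ ℚ.≤ W x

module _ {N} {W : Vec Bool N → ℚ} (0≤W : NonNeg W) (P : Vec Bool N → Bool) where

  restrict-nonNeg : NonNeg (λ z → W z ℚ.* 𝟙 (P z))
  restrict-nonNeg z = *-nonNeg (0≤W z) (𝟙-nonNeg (P z))

  mass-nonNeg : 0ℚ ℚ.≤ mass W P
  mass-nonNeg = ∑-nonNeg restrict-nonNeg

  mass≤∑ : mass W P ℚ.≤ ∑ W
  mass≤∑ = ∑-mono λ z → ℚ.≤-trans (*-monoʳ (W z) (0≤W z) (𝟙-≤1 (P z)))
    (ℚ.≤-reflexive (ℚ.*-identityʳ (W z)))

mass-cong : ∀ {N} (W : Vec Bool N → ℚ) {P Q : Vec Bool N → Bool} → (∀ z → P z ≡ Q z) → mass W P ≡ mass W Q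
mass-cong W eq = ∑-cong λ z → cong (λ b → W z ℚ.* 𝟙 b) (eq z)

mass-∧ : ∀ {N} (W : Vec Bool N → ℚ) (P Q : Vec Bool N → Bool) → mass W (λ z → P z ∧ Q z) ≡ mass (λ z → W z ℚ.* 𝟙 (P z)) Q
mass-∧ W P Q = ∑-cong λ z → trans (cong (W z ℚ.*_) (𝟙-∧ (P z) (Q z)))
  (sym (ℚ.*-assoc (W z) (𝟙 (P z)) (𝟙 (Q z))))

mass-not : ∀ {N} (W : Vec Bool N → ℚ) (P : Vec Bool N → Bool) → mass W (not ∘ P) ℚ.+ mass W P ≡ ∑ W
mass-not W P = trans (sym (∑-+ (λ z → W z ℚ.* 𝟙 (not (P z))) (λ z → W z ℚ.* 𝟙 (P z)))) (∑-cong pointwise)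
  where
  open +-*-Solver
  pointwise : ∀ z → W z ℚ.* 𝟙 (not (P z)) ℚ.+ W z ℚ.* 𝟙 (P z) ≡ W z
  pointwise z with P z
  ... | true  = solve 1 (λ w → w :* con 0ℚ :+ w :* con 1ℚ := w) refl (W z)
  ... | false = solve 1 (λ w → w :* con 1ℚ :+ w :* con 0ℚ := w) refl (W z)

-- Always descending into the heavier child reaches the only leaf that can carry
-- more than half of the weight.

heaviest-leaf : ∀ {N} (T : AffineTree N Bool) W → NonNeg W →
  ∃ λ v → ∀ x → v xor run T x ≡ true → cell T W x ℚ.+ cell T W x ℚ.≤ ∑ W
heaviest-leaf (leaf v) W 0≤W = v , λ x v≢v → contradiction (trans (sym v≢v) (Bool.xor-same v)) λ ()
heaviest-leaf (node φ T₀ T₁) W 0≤W =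
  choose (ℚ.≤-total (mass W (value φ)) (mass W (not ∘ value φ)))
    (heaviest-leaf T₀ W₀ (restrict-nonNeg 0≤W (not ∘ value φ)))
    (heaviest-leaf T₁ W₁ (restrict-nonNeg 0≤W (value φ)))
  where
  W₀ W₁ : Vec Bool _ → ℚ
  W₀ z = W z ℚ.* 𝟙 (not (value φ z))
  W₁ z = W z ℚ.* 𝟙 (value φ z)

  -- A leaf on the lighter side weighs at most as much as that side, hence at most half of the
  -- total.
  lighter : ∀ {a b c} → a ℚ.+ b ≡ c → b ℚ.≤ a → ∀ {w} → w ℚ.≤ b → w ℚ.+ w ℚ.≤ c
  lighter {a} {b} eq b≤a {w} w≤b = ℚ.≤-trans
    (ℚ.+-mono-≤ (ℚ.≤-trans w≤b b≤a) w≤b) (ℚ.≤-reflexive eq)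

  choose : ∑ W₁ ℚ.≤ ∑ W₀ ⊎ ∑ W₀ ℚ.≤ ∑ W₁ →
    (∃ λ v → ∀ x → v xor run T₀ x ≡ true → cell T₀ W₀ x ℚ.+ cell T₀ W₀ x ℚ.≤ ∑ W₀) →
    (∃ λ v → ∀ x → v xor run T₁ x ≡ true → cell T₁ W₁ x ℚ.+ cell T₁ W₁ x ℚ.≤ ∑ W₁) →
    ∃ λ v → ∀ x → v xor run (node φ T₀ T₁) x ≡ true →
      cell (node φ T₀ T₁) W x ℚ.+ cell (node φ T₀ T₁) W x ℚ.≤ ∑ W
  choose (inj₁ W₁≤W₀) (v , half) _ = v , bound
    where
    bound : ∀ x → v xor run (node φ T₀ T₁) x ≡ true →
            cell (node φ T₀ T₁) W x ℚ.+ cell (node φ T₀ T₁) W x ℚ.≤ ∑ W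
    bound x v≢ with value φ x
    ... | false rewrite mass-∧ W (not ∘ value φ) (sameLeaf T₀ x) =
      ℚ.≤-trans (half x v≢) (mass≤∑ 0≤W (not ∘ value φ))
    ... | true rewrite mass-∧ W (value φ) (sameLeaf T₁ x) =
      lighter (mass-not W (value φ)) W₁≤W₀
        (mass≤∑ (restrict-nonNeg 0≤W (value φ)) (sameLeaf T₁ x))
  choose (inj₂ W₀≤W₁) _ (v , half) = v , bound
    where
    bound : ∀ x → v xor run (node φ T₀ T₁) x ≡ true →
            cell (node φ T₀ T₁) W x ℚ.+ cell (node φ T₀ T₁) W x ℚ.≤ ∑ W
    bound x v≢ with value φ x
    ... | true rewrite mass-∧ W (value φ) (sameLeaf T₁ x) =
      ℚ.≤-trans (half x v≢) (mass≤∑ 0≤W (value φ))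
    ... | false rewrite mass-∧ W (not ∘ value φ) (sameLeaf T₀ x) =
      lighter (trans (ℚ.+-comm (∑ W₁) (∑ W₀)) (mass-not W (value φ))) W₀≤W₁
        (mass≤∑ (restrict-nonNeg 0≤W (not ∘ value φ)) (sameLeaf T₀ x))

vanish : ∀ {N} → List (Form N) → Vec Bool N → Bool
vanish []      x = true
vanish (φ ∷ C) x = not (value φ x) ∧ vanish C x

vanish-head : ∀ {N} (φ : Form N) C x → vanish (φ ∷ C) x ≡ true → value φ x ≡ false
vanish-head φ C x p with value φ x
... | false = refl

vanish-tail : ∀ {N} (φ : Form N) C x → vanish (φ ∷ C) x ≡ true → vanish C x ≡ true
vanish-tail φ C x p with value φ x
... | false = p

negate : ∀ {N} → Form N → Form N
negate (γ , a) = not γ , a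

value-negate : ∀ {N} (φ : Form N) x → value (negate φ) x ≡ not (value φ x)
value-negate (γ , a) x = sym (Bool.not-distribˡ-xor γ ⟨ a , x ⟩)

2ℚ 3ℚ ¾ 4/3 11/12 : ℚ
2ℚ = ℤ.+ 2 ℚ./ 1
3ℚ = ℤ.+ 3 ℚ./ 1
¾ = ℤ.+ 3 ℚ./ 4
4/3 = ℤ.+ 4 ℚ./ 3
11/12 = ℤ.+ 11 ℚ./ 12

-- The inputs that reach some node of S are the common zeros of a list of forms.

Splitter : ∀ {N A} → AffineTree N A → (Vec Bool N → ℚ) → Set
Splitter {N} S W = ∃ λ (C : List (Form N)) →
  (∀ x z → sameLeaf S x z ≡ true → vanish C x ≡ vanish C z) ×
  ∑ W ℚ.≤ 3ℚ ℚ.* mass W (vanish C) ×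
  (3ℚ ℚ.* mass W (vanish C) ℚ.≤ 2ℚ ℚ.* ∑ W ⊎
   (∀ x z → vanish C x ≡ true → vanish C z ≡ true → sameLeaf S x z ≡ true))

module _ {N A} (S : AffineTree N A) {W : Vec Bool N → ℚ} (0≤W : NonNeg W) where
  open +-*-Solver

  -- The usual one-third to two-thirds argument: while a node carries more than two thirds of the
  -- weight, its heavier child carries more than one third. The descent ends at the first node with
  -- at most two thirds or at a leaf, which may be heavier.
  splitter : Splitter S W
  splitter = descend S [] (λ _ _ _ → refl) (λ _ _ _ _ → refl) all-heavy
    where
    all-heavy : ∑ W ℚ.≤ 3ℚ ℚ.* mass W (vanish [])
    all-heavy = ≤-by (2ℚ ℚ.* ∑ W) (*-nonNeg (ℚ.nonNegative⁻¹ 2ℚ) (∑-nonNeg 0≤W))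
      (trans (solve 1 (λ w → w :+ con 2ℚ :* w := con 3ℚ :* w) refl (∑ W))
        (cong (3ℚ ℚ.*_) (∑-cong λ z → sym (ℚ.*-identityʳ (W z)))))

    descend : ∀ (T : AffineTree N A) C →
      (∀ x z → sameLeaf S x z ≡ true → vanish C x ≡ vanish C z) →
      (∀ x z → vanish C x ≡ true → vanish C z ≡ true → sameLeaf S x z ≡ sameLeaf T x z) →
      ∑ W ℚ.≤ 3ℚ ℚ.* mass W (vanish C) → Splitter S W
    descend T C respects below heavy with 3ℚ ℚ.* mass W (vanish C) ℚ.≤? 2ℚ ℚ.* ∑ W
    ... | yes light = C , respects , heavy , inj₁ light
    descend (leaf v) C respects below heavy | no _ = C , respects , heavy , inj₂ below
    descend (node φ T₀ T₁) C respects below heavy | no dominant = choose (ℚ.≤-total m₁ m₀)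
      where
      m m₀ m₁ : ℚ
      m  = mass W (vanish C)
      m₀ = mass W (vanish (φ ∷ C))
      m₁ = mass W (vanish (negate φ ∷ C))

      split : m₁ ℚ.+ m₀ ≡ m
      split = trans (cong₂ ℚ._+_
          (trans (mass-cong W λ z → trans
                (cong (_∧ vanish C z) (trans (cong not (value-negate φ z)) (Bool.not-involutive (value φ z))))
                (Bool.∧-comm (value φ z) (vanish C z)))
            (mass-∧ W (vanish C) (value φ)))
          (trans (mass-cong W λ z → Bool.∧-comm (not (value φ z)) (vanish C z))
            (mass-∧ W (vanish C) (not ∘ value φ))))
        (trans (ℚ.+-comm (mass W′ (value φ)) (mass W′ (not ∘ value φ))) (mass-not W′ (value φ)))
        where
        W′ : Vec Bool N → ℚ
        W′ z = W z ℚ.* 𝟙 (vanish C z)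

      -- Where `C` vanishes, the leaves of `S` are those of the current node, so inputs with a
      -- common leaf give the same answer to its query `φ`. Elsewhere the extended list does not
      -- vanish in any case.
      agree : ∀ x z → sameLeaf S x z ≡ true → vanish C x ≡ true → value φ x ≡ value φ z
      agree x z s Cx with trans (sym (below x z Cx (trans (sym (respects x z s)) Cx))) s
      ... | s′ with value φ x | value φ z
      ...   | true  | true  = refl
      ...   | false | false = refl
      agree x z s Cx | () | true  | false
      agree x z s Cx | () | false | true

      extend-respects : ∀ (ψ : Form N) → (∀ x z → value φ x ≡ value φ z → value ψ x ≡ value ψ z) →
        ∀ x z → sameLeaf S x z ≡ true → vanish (ψ ∷ C) x ≡ vanish (ψ ∷ C) z
      extend-respects ψ φ⇒ψ x z s with vanish C x in Cx | respects x z s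
      ... | false | Cz rewrite sym Cz = trans (Bool.∧-zeroʳ (not (value ψ x))) (sym (Bool.∧-zeroʳ (not (value ψ z))))
      ... | true  | Cz rewrite sym Cz = cong (λ b → not b ∧ true) (φ⇒ψ x z (agree x z s Cx))

      below₀ : ∀ x z → vanish (φ ∷ C) x ≡ true → vanish (φ ∷ C) z ≡ true → sameLeaf S x z ≡ sameLeaf T₀ x z
      below₀ x z p q = trans (below x z (vanish-tail φ C x p) (vanish-tail φ C z q)) at-child
        where
        at-child : sameLeaf (node φ T₀ T₁) x z ≡ sameLeaf T₀ x z
        at-child rewrite vanish-head φ C x p | vanish-head φ C z q = refl

      below₁ : ∀ x z → vanish (negate φ ∷ C) x ≡ true → vanish (negate φ ∷ C) z ≡ true →
               sameLeaf S x z ≡ sameLeaf T₁ x z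
      below₁ x z p q = trans (below x z (vanish-tail (negate φ) C x p) (vanish-tail (negate φ) C z q)) at-child
        where
        true-value : ∀ x → vanish (negate φ ∷ C) x ≡ true → value φ x ≡ true
        true-value x p = Bool.not-injective (trans (sym (value-negate φ x)) (vanish-head (negate φ) C x p))
        at-child : sameLeaf (node φ T₀ T₁) x z ≡ sameLeaf T₁ x z
        at-child rewrite true-value x p | true-value z q = refl

      half-heavy : ∀ {a b} → a ℚ.+ b ≡ m → a ℚ.≤ b → ∑ W ℚ.≤ 3ℚ ℚ.* b
      half-heavy {a} {b} a+b≡m a≤b = begin
        ∑ W
          ≡⟨ solve 1 (λ w → w := con ½ :* (con 2ℚ :* w)) refl (∑ W) ⟩
        ½ ℚ.* (2ℚ ℚ.* ∑ W)
          ≤⟨ *-monoʳ ½ (ℚ.nonNegative⁻¹ ½) (ℚ.<⇒≤ (ℚ.≰⇒> dominant)) ⟩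
        ½ ℚ.* (3ℚ ℚ.* m)
          ≡⟨ cong (λ u → ½ ℚ.* (3ℚ ℚ.* u)) (sym a+b≡m) ⟩
        ½ ℚ.* (3ℚ ℚ.* (a ℚ.+ b))
          ≤⟨ *-monoʳ ½ (ℚ.nonNegative⁻¹ ½) (*-monoʳ 3ℚ (ℚ.nonNegative⁻¹ 3ℚ) (ℚ.+-monoˡ-≤ b a≤b)) ⟩
        ½ ℚ.* (3ℚ ℚ.* (b ℚ.+ b))
          ≡⟨ solve 1 (λ b → con ½ :* (con 3ℚ :* (b :+ b)) := con 3ℚ :* b) refl b ⟩
        3ℚ ℚ.* b ∎
        where open ℚ.≤-Reasoning

      choose : m₁ ℚ.≤ m₀ ⊎ m₀ ℚ.≤ m₁ → Splitter S W
      choose (inj₁ m₁≤m₀) = descend T₀ (φ ∷ C) (extend-respects φ λ _ _ eq → eq) below₀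
        (half-heavy split m₁≤m₀)
      choose (inj₂ m₀≤m₁) = descend T₁ (negate φ ∷ C)
        (extend-respects (negate φ) λ x z eq →
          trans (value-negate φ x) (trans (cong not eq) (sym (value-negate φ z)))) below₁
        (half-heavy (trans (ℚ.+-comm m₀ m₁) split) m₀≤m₁)

-- Derandomised parities of constraints

if-xor : ∀ {A : Set} b c {p q : A} →
  (if b xor c then q else p) ≡ (if b then (if c then p else q) else (if c then q else p))
if-xor true  true  = refl
if-xor true  false = refl
if-xor false c     = refl

-- A random linear combination of forms that do not all vanish at x is 1 at x with
-- probability ½. This is its derandomisation for the total cost of both outcomes.

random-combination : ∀ {N} (C : List (Form N)) (A B : Vec Bool N → ℚ) → ∃ λ (φ : Form N) →
  (∀ x → vanish C x ≡ true → value φ x ≡ false) ×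
  ∑ (λ x → if value φ x then B x else A x) ℚ.≤
  ∑ (λ x → if vanish C x then A x else ½ ℚ.* (A x ℚ.+ B x))
random-combination [] A B = constant false , (λ x _ → value-constant false x) ,
  ℚ.≤-reflexive (∑-cong λ x → cong (if_then B x else A x) (value-constant false x))
random-combination {N} (φ ∷ C) A B =
  choose (random-combination C A B) (random-combination C A′ B′) (ℚ.≤-total U₀ U₁)
  where
  open +-*-Solver
  -- Adding `φ` to a combination exchanges the two outcomes exactly where `φ` is 1. Coefficient 0 or
  -- 1 for `φ` therefore amounts to recursion with `A`, `B` or with `A′`, `B′`, and the two bounds
  -- average to `∑ U`.
  A′ B′ : Vec Bool N → ℚ
  A′ x = if value φ x then B x else A x
  B′ x = if value φ x then A x else B x

  U₀ U₁ : ℚ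
  U₀ = ∑ λ x → if vanish C x then A x else ½ ℚ.* (A x ℚ.+ B x)
  U₁ = ∑ λ x → if vanish C x then A′ x else ½ ℚ.* (A′ x ℚ.+ B′ x)
  U : Vec Bool N → ℚ
  U x = if vanish (φ ∷ C) x then A x else ½ ℚ.* (A x ℚ.+ B x)

  average : U₀ ℚ.+ U₁ ≡ 2ℚ ℚ.* ∑ U
  average = trans (sym (∑-+ (λ x → if vanish C x then A x else ½ ℚ.* (A x ℚ.+ B x))
                          (λ x → if vanish C x then A′ x else ½ ℚ.* (A′ x ℚ.+ B′ x))))
    (trans (∑-cong pointwise) (∑-*ˡ 2ℚ U))
    where
    pointwise : ∀ x → (if vanish C x then A x else ½ ℚ.* (A x ℚ.+ B x)) ℚ.+
                      (if vanish C x then A′ x else ½ ℚ.* (A′ x ℚ.+ B′ x)) ≡ 2ℚ ℚ.* U x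
    pointwise x with vanish C x | value φ x
    ... | true  | true  = solve 2 (λ a b → a :+ b := con 2ℚ :* (con ½ :* (a :+ b))) refl (A x) (B x)
    ... | true  | false = solve 1 (λ a → a :+ a := con 2ℚ :* a) refl (A x)
    ... | false | true  = solve 2 (λ a b → con ½ :* (a :+ b) :+ con ½ :* (b :+ a) := con 2ℚ :* (con ½ :* (a :+ b)))
                            refl (A x) (B x)
    ... | false | false = solve 2 (λ a b → con ½ :* (a :+ b) :+ con ½ :* (a :+ b) := con 2ℚ :* (con ½ :* (a :+ b)))
                            refl (A x) (B x)

  below-average : ∀ {a b} → a ℚ.+ b ≡ 2ℚ ℚ.* ∑ U → a ℚ.≤ b → a ℚ.≤ ∑ U
  below-average {a} {b} eq a≤b = begin
    a                     ≡⟨ solve 1 (λ a → a := con ½ :* (a :+ a)) refl a ⟩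
    ½ ℚ.* (a ℚ.+ a)       ≤⟨ *-monoʳ ½ (ℚ.nonNegative⁻¹ ½) (ℚ.+-monoʳ-≤ a a≤b) ⟩
    ½ ℚ.* (a ℚ.+ b)       ≡⟨ cong (½ ℚ.*_) eq ⟩
    ½ ℚ.* (2ℚ ℚ.* ∑ U)    ≡⟨ solve 1 (λ u → con ½ :* (con 2ℚ :* u) := u) refl (∑ U) ⟩
    ∑ U                   ∎
    where open ℚ.≤-Reasoning

  Goal : Set
  Goal = ∃ λ (ψ : Form N) → (∀ x → vanish (φ ∷ C) x ≡ true → value ψ x ≡ false) ×
    ∑ (λ x → if value ψ x then B x else A x) ℚ.≤ ∑ U

  choose :
    (∃ λ (ψ : Form N) → (∀ x → vanish C x ≡ true → value ψ x ≡ false) ×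
      ∑ (λ x → if value ψ x then B x else A x) ℚ.≤ U₀) →
    (∃ λ (ψ : Form N) → (∀ x → vanish C x ≡ true → value ψ x ≡ false) ×
      ∑ (λ x → if value ψ x then B′ x else A′ x) ℚ.≤ U₁) →
    U₀ ℚ.≤ U₁ ⊎ U₁ ℚ.≤ U₀ → Goal
  choose (ψ , sound , cost) _ (inj₁ U₀≤U₁) =
    ψ , (λ x p → sound x (vanish-tail φ C x p)) , ℚ.≤-trans cost (below-average {U₀} {U₁} average U₀≤U₁)
  choose _ (ψ , sound , cost) (inj₂ U₁≤U₀) = ψ ⊕ φ , sound′ , cost′
    where
    sound′ : ∀ x → vanish (φ ∷ C) x ≡ true → value (ψ ⊕ φ) x ≡ false
    sound′ x p = trans (value-⊕ ψ φ x) (cong₂ _xor_ (sound x (vanish-tail φ C x p)) (vanish-head φ C x p))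
    swapped : ∀ x → (if value (ψ ⊕ φ) x then B x else A x) ≡ (if value ψ x then B′ x else A′ x)
    swapped x = trans (cong (if_then B x else A x) (value-⊕ ψ φ x)) (if-xor (value ψ x) (value φ x))
    U₁≤∑U : U₁ ℚ.≤ ∑ U
    U₁≤∑U = below-average (trans (ℚ.+-comm U₁ U₀) average) U₁≤U₀
    cost′ : ∑ (λ x → if value (ψ ⊕ φ) x then B x else A x) ℚ.≤ ∑ U
    cost′ = subst (ℚ._≤ ∑ U) (sym (∑-cong swapped)) (ℚ.≤-trans cost U₁≤∑U)

-- A parity tree has only linear queries; the constant term of the form is absorbed by exchanging
-- the children.
query : ∀ {N A} → Form N → ParityTree N A → ParityTree N A → ParityTree N A
query (false , a) T₀ T₁ = node a T₀ T₁
query (true  , a) T₀ T₁ = node a T₁ T₀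

eval-query : ∀ {N A} φ (T₀ T₁ : ParityTree N A) x →
             eval (query φ T₀ T₁) x ≡ (if value φ x then eval T₁ x else eval T₀ x)
eval-query (false , a) T₀ T₁ x = refl
eval-query (true  , a) T₀ T₁ x with ⟨ a , x ⟩
... | true  = refl
... | false = refl

depth-query : ∀ {N A} φ (T₀ T₁ : ParityTree N A) {M} →
              depth T₀ ℕ.≤ M → depth T₁ ℕ.≤ M → depth (query φ T₀ T₁) ℕ.≤ suc M
depth-query (false , a) T₀ T₁ p q = ℕ.s≤s (ℕ.⊔-lub p q)
depth-query (true  , a) T₀ T₁ p q = ℕ.s≤s (ℕ.⊔-lub q p)

if-𝟙 : ∀ b p q → q ℚ.* 𝟙 (not b) ℚ.+ p ℚ.* 𝟙 b ≡ (if b then p else q)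
if-𝟙 true  p q = solve 2 (λ p q → q :* con 0ℚ :+ p :* con 1ℚ := p) refl p q
  where open +-*-Solver
if-𝟙 false p q = solve 2 (λ p q → q :* con 1ℚ :+ p :* con 0ℚ := q) refl p q
  where open +-*-Solver

Respects : ∀ {N A} → AffineTree N A → (Vec Bool N → Bool) → Set
Respects S P = ∀ x z → sameLeaf S x z ≡ true → P x ≡ P z

-- `P` is constant on each leaf, so a factor that depends on `P` alone leaves the sum over the leaf.
cell-scale : ∀ {N A} (S : AffineTree N A) W {P : Vec Bool N → Bool} → Respects S P →
  ∀ (κ : Bool → ℚ) x → cell S (λ z → κ (P z) ℚ.* W z) x ≡ κ (P x) ℚ.* cell S W x
cell-scale S W {P} respects κ x =
  trans (∑-cong pointwise) (∑-*ˡ (κ (P x)) (λ z → W z ℚ.* 𝟙 (sameLeaf S x z)))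
  where
  open +-*-Solver
  pointwise : ∀ z → (κ (P z) ℚ.* W z) ℚ.* 𝟙 (sameLeaf S x z) ≡ κ (P x) ℚ.* (W z ℚ.* 𝟙 (sameLeaf S x z))
  pointwise z with sameLeaf S x z in eq
  ... | true rewrite respects x z eq = ℚ.*-assoc (κ (P z)) (W z) 1ℚ
  ... | false = solve 3 (λ k l w → (k :* w) :* con 0ℚ := l :* (w :* con 0ℚ)) refl (κ (P z)) (κ (P x)) (W z)

-- Noisy binary search for the leaf

module Halving {N} (S : AffineTree N Bool) where
  open +-*-Solver

  errorMass : (Vec Bool N → ℚ) → (Vec Bool N → ℚ) → ParityTree N Bool → ℚ
  errorMass ν W T = ∑ λ x → ν x ℚ.* (cell S W x ℚ.* 𝟙 (eval T x xor run S x))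

  -- ν(x) / W(cell of x) is the probability of x: the error mass of a tree is then
  -- its error, and potential is the expected value of (1 − π) / π, where π is the
  -- posterior probability of the leaf of x.

  potential : (Vec Bool N → ℚ) → (Vec Bool N → ℚ) → ℚ
  potential ν W = ∑ λ x → ν x ℚ.* (∑ W ℚ.- cell S W x)

  module Step (ν W : Vec Bool N → ℚ) (0≤ν : NonNeg ν) (0≤W : NonNeg W)
              (C : List (Form N)) (respects : Respects S (vanish C))
              (heavy : ∑ W ℚ.≤ 3ℚ ℚ.* mass W (vanish C))
              (balanced : 3ℚ ℚ.* mass W (vanish C) ℚ.≤ 2ℚ ℚ.* ∑ W ⊎
                (∀ x z → vanish C x ≡ true → vanish C z ≡ true → sameLeaf S x z ≡ true)) where

    -- `reward` is the reciprocal of `discount`, so that answer 0 leaves the product of `ν x` and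
    -- the weight of the leaf of `x` unchanged. With discount ρ outside the zero set the potential
    -- term of `x`, up to the factor `ν x`, drops by (1 - ρ)(t - m) inside and on average by m (1 -
    -- 1/(2ρ)) outside. The Bayesian ρ = ½ gives nothing outside. With ρ = ¾ and m between t/3 and
    -- 2t/3 the drops are at least t/12 and t/9, which is the origin of 11/12.
    discount reward : Bool → ℚ
    discount b = if b then 1ℚ else ¾
    reward   b = if b then 1ℚ else 4/3

    W₀ W₁ : Vec Bool N → ℚ
    W₀ z = discount (vanish C z) ℚ.* W z
    W₁ z = 𝟙 (not (vanish C z)) ℚ.* W z

    A B : Vec Bool N → ℚ
    A x = (reward (vanish C x) ℚ.* ν x) ℚ.* (∑ W₀ ℚ.- cell S W₀ x)
    B x = ν x ℚ.* (∑ W₁ ℚ.- cell S W₁ x)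

    m t : ℚ
    m = mass W (vanish C)
    t = ∑ W

    ∑W₀ : ∑ W₀ ≡ ¾ ℚ.* t ℚ.+ (1ℚ ℚ.- ¾) ℚ.* m
    ∑W₀ = trans (∑-cong pointwise)
      (trans (∑-+ (λ z → ¾ ℚ.* W z) (λ z → (1ℚ ℚ.- ¾) ℚ.* (W z ℚ.* 𝟙 (vanish C z))))
        (cong₂ ℚ._+_ (∑-*ˡ ¾ W) (∑-*ˡ (1ℚ ℚ.- ¾) (λ z → W z ℚ.* 𝟙 (vanish C z)))))
      where
      pointwise : ∀ z → discount (vanish C z) ℚ.* W z ≡
                        ¾ ℚ.* W z ℚ.+ (1ℚ ℚ.- ¾) ℚ.* (W z ℚ.* 𝟙 (vanish C z))
      pointwise z with vanish C z
      ... | true  = solve 1 (λ w → con 1ℚ :* w := con ¾ :* w :+ con (1ℚ ℚ.- ¾) :* (w :* con 1ℚ)) refl (W z)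
      ... | false = solve 1 (λ w → con ¾ :* w := con ¾ :* w :+ con (1ℚ ℚ.- ¾) :* (w :* con 0ℚ)) refl (W z)

    ∑W₁ : ∑ W₁ ≡ t ℚ.- m
    ∑W₁ = trans (∑-cong λ z → ℚ.*-comm (𝟙 (not (vanish C z))) (W z))
      (trans (solve 2 (λ a b → a := (a :+ b) :- b) refl (mass W (not ∘ vanish C)) m)
        (cong (ℚ._- m) (mass-not W (vanish C))))

    0≤cell : ∀ x → 0ℚ ℚ.≤ cell S W x
    0≤cell x = mass-nonNeg 0≤W (sameLeaf S x)

    1/12 : ℚ
    1/12 = ℤ.+ 1 ℚ./ 12

    inside : ∀ x → vanish C x ≡ true → A x ℚ.≤ 11/12 ℚ.* (ν x ℚ.* (t ℚ.- cell S W x))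
    inside x Cx = subst (ℚ._≤ 11/12 ℚ.* (ν x ℚ.* (t ℚ.- w))) (sym A-eq) (bound balanced)
      where
      w : ℚ
      w = cell S W x
      A-eq : A x ≡ ν x ℚ.* ((¾ ℚ.* t ℚ.+ (1ℚ ℚ.- ¾) ℚ.* m) ℚ.- w)
      A-eq = trans (cong₂ (λ a b → (reward (vanish C x) ℚ.* ν x) ℚ.* (a ℚ.- b)) ∑W₀
                 (cell-scale S W respects discount x))
        (trans (cong (λ b → (reward b ℚ.* ν x) ℚ.* ((¾ ℚ.* t ℚ.+ (1ℚ ℚ.- ¾) ℚ.* m) ℚ.- discount b ℚ.* w)) Cx)
          (solve 3 (λ n u w → (con 1ℚ :* n) :* (u :- con 1ℚ :* w) := n :* (u :- w)) refl
            (ν x) (¾ ℚ.* t ℚ.+ (1ℚ ℚ.- ¾) ℚ.* m) w))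

      bound : 3ℚ ℚ.* m ℚ.≤ 2ℚ ℚ.* t ⊎
              (∀ x z → vanish C x ≡ true → vanish C z ≡ true → sameLeaf S x z ≡ true) →
              ν x ℚ.* ((¾ ℚ.* t ℚ.+ (1ℚ ℚ.- ¾) ℚ.* m) ℚ.- w) ℚ.≤ 11/12 ℚ.* (ν x ℚ.* (t ℚ.- w))
      bound (inj₁ light) = ≤-by (ν x ℚ.* (1/12 ℚ.* ((2ℚ ℚ.* t ℚ.- 3ℚ ℚ.* m) ℚ.+ w)))
        (*-nonNeg (0≤ν x) (*-nonNeg (ℚ.nonNegative⁻¹ 1/12) (+-nonNeg (≤⇒0≤- light) (0≤cell x))))
        (solve 4 (λ n t m w →
            n :* ((con ¾ :* t :+ con (1ℚ ℚ.- ¾) :* m) :- w) :+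
            n :* (con 1/12 :* ((con 2ℚ :* t :- con 3ℚ :* m) :+ w))
            := con 11/12 :* (n :* (t :- w))) refl (ν x) t m w)
      -- If the zero set is a single leaf, m may be close to t, but then m is the weight w of the
      -- leaf of `x`, and the drop (t - m)/4 is a quarter of t - w.
      bound (inj₂ single) = subst
        (λ u → ν x ℚ.* ((¾ ℚ.* t ℚ.+ (1ℚ ℚ.- ¾) ℚ.* m) ℚ.- u) ℚ.≤ 11/12 ℚ.* (ν x ℚ.* (t ℚ.- u))) (sym w≡m)
        (≤-by (ν x ℚ.* (1/12 ℚ.* (2ℚ ℚ.* (t ℚ.- m))))
          (*-nonNeg (0≤ν x) (*-nonNeg (ℚ.nonNegative⁻¹ 1/12) (*-nonNeg (ℚ.nonNegative⁻¹ 2ℚ)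
            (≤⇒0≤- (mass≤∑ 0≤W (vanish C))))))
          (solve 3 (λ n t m →
              n :* ((con ¾ :* t :+ con (1ℚ ℚ.- ¾) :* m) :- m) :+ n :* (con 1/12 :* (con 2ℚ :* (t :- m)))
              := con 11/12 :* (n :* (t :- m))) refl (ν x) t m))
        where
        w≡m : w ≡ m
        w≡m = mass-cong W pointwise
          where
          pointwise : ∀ z → sameLeaf S x z ≡ vanish C z
          pointwise z with sameLeaf S x z in eq
          ... | true = trans (sym Cx) (respects x z eq)
          ... | false with vanish C z in Cz
          ...   | false = refl
          ...   | true  = trans (sym eq) (single x z Cx Cz)

    outside : ∀ x → vanish C x ≡ false →
              ½ ℚ.* (A x ℚ.+ B x) ℚ.≤ 11/12 ℚ.* (ν x ℚ.* (t ℚ.- cell S W x))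
    outside x Cx = subst (ℚ._≤ 11/12 ℚ.* (ν x ℚ.* (t ℚ.- w))) (sym AB-eq)
      (≤-by (ν x ℚ.* (1/12 ℚ.* ((3ℚ ℚ.* m ℚ.- t) ℚ.+ (m ℚ.+ w))))
        (*-nonNeg (0≤ν x) (*-nonNeg (ℚ.nonNegative⁻¹ 1/12)
          (+-nonNeg (≤⇒0≤- heavy) (+-nonNeg (mass-nonNeg 0≤W (vanish C)) (0≤cell x)))))
        (solve 4 (λ n t m w →
            con ½ :* ((con 4/3 :* n) :* ((con ¾ :* t :+ con (1ℚ ℚ.- ¾) :* m) :- con ¾ :* w) :+
                      n :* ((t :- m) :- con 1ℚ :* w)) :+
            n :* (con 1/12 :* ((con 3ℚ :* m :- t) :+ (m :+ w)))
            := con 11/12 :* (n :* (t :- w))) refl (ν x) t m w))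
      where
      w : ℚ
      w = cell S W x
      AB-eq : ½ ℚ.* (A x ℚ.+ B x) ≡
        ½ ℚ.* ((4/3 ℚ.* ν x) ℚ.* ((¾ ℚ.* t ℚ.+ (1ℚ ℚ.- ¾) ℚ.* m) ℚ.- ¾ ℚ.* w) ℚ.+
               ν x ℚ.* ((t ℚ.- m) ℚ.- 1ℚ ℚ.* w))
      AB-eq = cong₂ (λ a b → ½ ℚ.* (a ℚ.+ b))
        (trans (cong₂ (λ a b → (reward (vanish C x) ℚ.* ν x) ℚ.* (a ℚ.- b)) ∑W₀
                 (cell-scale S W respects discount x))
          (cong (λ b → (reward b ℚ.* ν x) ℚ.* ((¾ ℚ.* t ℚ.+ (1ℚ ℚ.- ¾) ℚ.* m) ℚ.- discount b ℚ.* w)) Cx))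
        (trans (cong₂ (λ a b → ν x ℚ.* (a ℚ.- b)) ∑W₁ (cell-scale S W respects (𝟙 ∘ not) x))
          (cong (λ b → ν x ℚ.* ((t ℚ.- m) ℚ.- 𝟙 (not b) ℚ.* w)) Cx))

    shrinks : ∀ x → (if vanish C x then A x else ½ ℚ.* (A x ℚ.+ B x)) ℚ.≤
                    11/12 ℚ.* (ν x ℚ.* (t ℚ.- cell S W x))
    shrinks x = cases (vanish C x) refl
      where
      cases : ∀ b → vanish C x ≡ b → (if b then A x else ½ ℚ.* (A x ℚ.+ B x)) ℚ.≤
              11/12 ℚ.* (ν x ℚ.* (t ℚ.- cell S W x))
      cases true  Cx = inside x Cx
      cases false Cx = outside x Cx

    module Answer (φ : Form N) (sound : ∀ x → vanish C x ≡ true → value φ x ≡ false)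
                  (cost : ∑ (λ x → if value φ x then B x else A x) ℚ.≤
                          ∑ (λ x → if vanish C x then A x else ½ ℚ.* (A x ℚ.+ B x))) where

      ν₀ ν₁ : Vec Bool N → ℚ
      ν₀ x = (reward (vanish C x) ℚ.* ν x) ℚ.* 𝟙 (not (value φ x))
      ν₁ x = ν x ℚ.* 𝟙 (value φ x)

      reward-nonNeg : ∀ b → 0ℚ ℚ.≤ reward b
      reward-nonNeg true  = ℚ.nonNegative⁻¹ 1ℚ
      reward-nonNeg false = ℚ.nonNegative⁻¹ 4/3

      discount-nonNeg : ∀ b → 0ℚ ℚ.≤ discount b
      discount-nonNeg true  = ℚ.nonNegative⁻¹ 1ℚ
      discount-nonNeg false = ℚ.nonNegative⁻¹ ¾

      ν₀-nonNeg : NonNeg ν₀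
      ν₀-nonNeg x = *-nonNeg (*-nonNeg (reward-nonNeg (vanish C x)) (0≤ν x)) (𝟙-nonNeg (not (value φ x)))

      ν₁-nonNeg : NonNeg ν₁
      ν₁-nonNeg x = *-nonNeg (0≤ν x) (𝟙-nonNeg (value φ x))

      W₀-nonNeg : NonNeg W₀
      W₀-nonNeg z = *-nonNeg (discount-nonNeg (vanish C z)) (0≤W z)

      W₁-nonNeg : NonNeg W₁
      W₁-nonNeg z = *-nonNeg (𝟙-nonNeg (not (vanish C z))) (0≤W z)

      potential-drop : potential ν₀ W₀ ℚ.+ potential ν₁ W₁ ℚ.≤ 11/12 ℚ.* potential ν W
      potential-drop = begin
        potential ν₀ W₀ ℚ.+ potential ν₁ W₁
          ≡⟨ sym (∑-+ (λ x → ν₀ x ℚ.* (∑ W₀ ℚ.- cell S W₀ x)) (λ x → ν₁ x ℚ.* (∑ W₁ ℚ.- cell S W₁ x))) ⟩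
        ∑ (λ x → ν₀ x ℚ.* (∑ W₀ ℚ.- cell S W₀ x) ℚ.+ ν₁ x ℚ.* (∑ W₁ ℚ.- cell S W₁ x))
          ≡⟨ ∑-cong pointwise ⟩
        ∑ (λ x → if value φ x then B x else A x)
          ≤⟨ cost ⟩
        ∑ (λ x → if vanish C x then A x else ½ ℚ.* (A x ℚ.+ B x))
          ≤⟨ ∑-mono shrinks ⟩
        ∑ (λ x → 11/12 ℚ.* (ν x ℚ.* (t ℚ.- cell S W x)))
          ≡⟨ ∑-*ˡ 11/12 (λ x → ν x ℚ.* (t ℚ.- cell S W x)) ⟩
        11/12 ℚ.* potential ν W ∎
        where
        open ℚ.≤-Reasoning
        regroup : ∀ a b c d e f → (a ℚ.* b) ℚ.* c ℚ.+ (d ℚ.* e) ℚ.* f ≡ (a ℚ.* c) ℚ.* b ℚ.+ (d ℚ.* f) ℚ.* e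
        regroup = solve 6 (λ a b c d e f → (a :* b) :* c :+ (d :* e) :* f := (a :* c) :* b :+ (d :* f) :* e) refl
        pointwise : ∀ x → ν₀ x ℚ.* (∑ W₀ ℚ.- cell S W₀ x) ℚ.+ ν₁ x ℚ.* (∑ W₁ ℚ.- cell S W₁ x) ≡
                          (if value φ x then B x else A x)
        pointwise x = trans
          (regroup (reward (vanish C x) ℚ.* ν x) (𝟙 (not (value φ x))) (∑ W₀ ℚ.- cell S W₀ x)
                   (ν x) (𝟙 (value φ x)) (∑ W₁ ℚ.- cell S W₁ x))
          (if-𝟙 (value φ x) (B x) (A x))

      -- Each input is counted in the branch that it takes, with its former weight: `reward` and
      -- `discount` cancel under answer 0, and under answer 1 the weight outside the zero set is
      -- kept. Inputs in the zero set, whose weight in `W₁` is 0, never take that branch by `sound`.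
      errorMass-query : ∀ T₀ T₁ → errorMass ν W (query φ T₀ T₁) ≡ errorMass ν₀ W₀ T₀ ℚ.+ errorMass ν₁ W₁ T₁
      errorMass-query T₀ T₁ = trans (∑-cong pointwise)
        (∑-+ (λ x → ν₀ x ℚ.* (cell S W₀ x ℚ.* 𝟙 (eval T₀ x xor run S x)))
             (λ x → ν₁ x ℚ.* (cell S W₁ x ℚ.* 𝟙 (eval T₁ x xor run S x))))
        where
        cases : ∀ b c (n w : ℚ) e₀ e₁ r → (b ≡ true → c ≡ false) →
          n ℚ.* (w ℚ.* 𝟙 ((if c then e₁ else e₀) xor r)) ≡
          ((reward b ℚ.* n) ℚ.* 𝟙 (not c)) ℚ.* ((discount b ℚ.* w) ℚ.* 𝟙 (e₀ xor r)) ℚ.+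
          (n ℚ.* 𝟙 c) ℚ.* ((𝟙 (not b) ℚ.* w) ℚ.* 𝟙 (e₁ xor r))
        cases true true n w e₀ e₁ r sound = contradiction (sound refl) λ ()
        cases true false n w e₀ e₁ r _ = solve 4 (λ n w i j → n :* (w :* i) :=
            ((con 1ℚ :* n) :* con 1ℚ) :* ((con 1ℚ :* w) :* i) :+ (n :* con 0ℚ) :* ((con 0ℚ :* w) :* j)) refl
          n w (𝟙 (e₀ xor r)) (𝟙 (e₁ xor r))
        cases false true n w e₀ e₁ r _ = solve 4 (λ n w i j → n :* (w :* j) :=
            ((con 4/3 :* n) :* con 0ℚ) :* ((con ¾ :* w) :* i) :+ (n :* con 1ℚ) :* ((con 1ℚ :* w) :* j)) refl
          n w (𝟙 (e₀ xor r)) (𝟙 (e₁ xor r))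
        cases false false n w e₀ e₁ r _ = solve 4 (λ n w i j → n :* (w :* i) :=
            ((con 4/3 :* n) :* con 1ℚ) :* ((con ¾ :* w) :* i) :+ (n :* con 0ℚ) :* ((con 1ℚ :* w) :* j)) refl
          n w (𝟙 (e₀ xor r)) (𝟙 (e₁ xor r))

        pointwise : ∀ x → ν x ℚ.* (cell S W x ℚ.* 𝟙 (eval (query φ T₀ T₁) x xor run S x)) ≡
          ν₀ x ℚ.* (cell S W₀ x ℚ.* 𝟙 (eval T₀ x xor run S x)) ℚ.+
          ν₁ x ℚ.* (cell S W₁ x ℚ.* 𝟙 (eval T₁ x xor run S x))
        pointwise x = trans
          (cong (λ e → ν x ℚ.* (cell S W x ℚ.* 𝟙 (e xor run S x))) (eval-query φ T₀ T₁ x))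
          (trans (cases (vanish C x) (value φ x) (ν x) (cell S W x) (eval T₀ x) (eval T₁ x) (run S x) (sound x))
            (sym (cong₂ (λ u v → ν₀ x ℚ.* (u ℚ.* 𝟙 (eval T₀ x xor run S x)) ℚ.+
                                 ν₁ x ℚ.* (v ℚ.* 𝟙 (eval T₁ x xor run S x)))
              (cell-scale S W respects discount x) (cell-scale S W respects (𝟙 ∘ not) x))))

  -- Every query multiplies the total potential by at most 11/12. With no queries left the output is
  -- that of `heaviest-leaf`: where it is wrong, the leaf of `x` has weight w with 2w ≤ t, so the
  -- error term w is at most t - w, the potential term.
  compress : ∀ M ν W → NonNeg ν → NonNeg W →
    ∃ λ (T : ParityTree N Bool) → depth T ℕ.≤ M × errorMass ν W T ℚ.≤ 11/12 ^ℚ M ℚ.* potential ν W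
  compress zero ν W 0≤ν 0≤W = from-leaf (heaviest-leaf S W 0≤W)
    where
    from-leaf : (∃ λ v → ∀ x → v xor run S x ≡ true → cell S W x ℚ.+ cell S W x ℚ.≤ ∑ W) →
      ∃ λ (T : ParityTree N Bool) → depth T ℕ.≤ 0 × errorMass ν W T ℚ.≤ 1ℚ ℚ.* potential ν W
    from-leaf (v , half) = leaf v , ℕ.z≤n , ℚ.≤-trans
      (∑-mono λ x → *-monoʳ (ν x) (0≤ν x) (bound x (v xor run S x) refl))
      (ℚ.≤-reflexive (sym (ℚ.*-identityˡ (potential ν W))))
      where
      bound : ∀ x b → v xor run S x ≡ b → cell S W x ℚ.* 𝟙 b ℚ.≤ ∑ W ℚ.- cell S W x
      bound x true  eq = ≤-by (∑ W ℚ.- (cell S W x ℚ.+ cell S W x)) (≤⇒0≤- (half x eq))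
        (solve 2 (λ t w → w :* con 1ℚ :+ (t :- (w :+ w)) := t :- w) refl (∑ W) (cell S W x))
      bound x false eq = ℚ.≤-trans (ℚ.≤-reflexive (ℚ.*-zeroʳ (cell S W x)))
        (≤⇒0≤- (mass≤∑ 0≤W (sameLeaf S x)))
  compress (suc M) ν W 0≤ν 0≤W = from-splitter (splitter S 0≤W)
    where
    Goal : Set
    Goal = ∃ λ (T : ParityTree N Bool) →
      depth T ℕ.≤ suc M × errorMass ν W T ℚ.≤ 11/12 ^ℚ suc M ℚ.* potential ν W

    from-splitter : Splitter S W → Goal
    from-splitter (C , respects , heavy , balanced) = from-answer (random-combination C A B)
      where
      open Step ν W 0≤ν 0≤W C respects heavy balanced
      from-answer : (∃ λ (φ : Form N) → (∀ x → vanish C x ≡ true → value φ x ≡ false) ×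
        ∑ (λ x → if value φ x then B x else A x) ℚ.≤
        ∑ (λ x → if vanish C x then A x else ½ ℚ.* (A x ℚ.+ B x))) → Goal
      from-answer (φ , sound , cost) =
        combine (compress M ν₀ W₀ ν₀-nonNeg W₀-nonNeg) (compress M ν₁ W₁ ν₁-nonNeg W₁-nonNeg)
        where
        open Answer φ sound cost
        combine :
          (∃ λ (T : ParityTree N Bool) → depth T ℕ.≤ M × errorMass ν₀ W₀ T ℚ.≤ 11/12 ^ℚ M ℚ.* potential ν₀ W₀) →
          (∃ λ (T : ParityTree N Bool) → depth T ℕ.≤ M × errorMass ν₁ W₁ T ℚ.≤ 11/12 ^ℚ M ℚ.* potential ν₁ W₁) →
          Goal
        combine (T₀ , depth₀ , error₀) (T₁ , depth₁ , error₁) =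
          query φ T₀ T₁ , depth-query φ T₀ T₁ depth₀ depth₁ , (begin
            errorMass ν W (query φ T₀ T₁)
              ≡⟨ errorMass-query T₀ T₁ ⟩
            errorMass ν₀ W₀ T₀ ℚ.+ errorMass ν₁ W₁ T₁
              ≤⟨ ℚ.+-mono-≤ error₀ error₁ ⟩
            11/12 ^ℚ M ℚ.* potential ν₀ W₀ ℚ.+ 11/12 ^ℚ M ℚ.* potential ν₁ W₁
              ≡⟨ sym (ℚ.*-distribˡ-+ (11/12 ^ℚ M) (potential ν₀ W₀) (potential ν₁ W₁)) ⟩
            11/12 ^ℚ M ℚ.* (potential ν₀ W₀ ℚ.+ potential ν₁ W₁)
              ≤⟨ *-monoʳ (11/12 ^ℚ M) (^-nonNeg M (ℚ.nonNegative⁻¹ 11/12)) potential-drop ⟩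
            11/12 ^ℚ M ℚ.* (11/12 ℚ.* potential ν W)
              ≡⟨ solve 3 (λ p a b → p :* (a :* b) := (a :* p) :* b) refl (11/12 ^ℚ M) 11/12 (potential ν W) ⟩
            11/12 ^ℚ suc M ℚ.* potential ν W ∎)
          where open ℚ.≤-Reasoning

-- From an isolated block to a shallow parity tree

mapLeaves : ∀ {N A B} → (A → B) → ParityTree N A → ParityTree N B
mapLeaves h (leaf v)       = leaf (h v)
mapLeaves h (node a T₀ T₁) = node a (mapLeaves h T₀) (mapLeaves h T₁)

eval-mapLeaves : ∀ {N A B} (h : A → B) (T : ParityTree N A) x → eval (mapLeaves h T) x ≡ h (eval T x)
eval-mapLeaves h (leaf v)       x = refl
eval-mapLeaves h (node a T₀ T₁) x with ⟨ a , x ⟩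
... | true  = eval-mapLeaves h T₁ x
... | false = eval-mapLeaves h T₀ x

depth-mapLeaves : ∀ {N A B} (h : A → B) (T : ParityTree N A) → depth (mapLeaves h T) ≡ depth T
depth-mapLeaves h (leaf v)       = refl
depth-mapLeaves h (node a T₀ T₁) = cong₂ (λ c d → suc (c ℕ.⊔ d)) (depth-mapLeaves h T₀) (depth-mapLeaves h T₁)

affine : ∀ {N A} → ParityTree N A → AffineTree N A
affine (leaf v)       = leaf v
affine (node a T₀ T₁) = node (false , a) (affine T₀) (affine T₁)

run-affine : ∀ {N A} (T : ParityTree N A) x → run (affine T) x ≡ eval T x
run-affine (leaf v)       x = refl
run-affine (node a T₀ T₁) x rewrite run-affine T₀ x | run-affine T₁ x = refl

queries-affine : ∀ {N A} (T : ParityTree N A) x → queries (affine T) x ℕ.≤ depth T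
queries-affine (leaf v)       x = ℕ.z≤n
queries-affine (node a T₀ T₁) x with ⟨ a , x ⟩
... | true  = ℕ.s≤s (ℕ.≤-trans (queries-affine T₁ x) (ℕ.m≤n⊔m (depth T₀) (depth T₁)))
... | false = ℕ.s≤s (ℕ.≤-trans (queries-affine T₀ x) (ℕ.m≤m⊔n (depth T₀) (depth T₁)))

SameLeaf-mapLeaves : ∀ {N A B} (h : A → B) (T : ParityTree N A) {x y} →
  SameLeaf (affine T) x y → SameLeaf (affine (mapLeaves h T)) x y
SameLeaf-mapLeaves h (leaf v)       leaf          = leaf
SameLeaf-mapLeaves h (node a T₀ T₁) (node₀ p q s) = node₀ p q (SameLeaf-mapLeaves h T₀ s)
SameLeaf-mapLeaves h (node a T₀ T₁) (node₁ p q s) = node₁ p q (SameLeaf-mapLeaves h T₁ s)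

fromℕℚ-+ : ∀ m n → fromℕℚ (m ℕ.+ n) ≡ fromℕℚ m ℚ.+ fromℕℚ n
fromℕℚ-+ zero    n = sym (ℚ.+-identityˡ (fromℕℚ n))
fromℕℚ-+ (suc m) n = trans (fromℕℚ-suc (m ℕ.+ n))
  (trans (cong (1ℚ ℚ.+_) (fromℕℚ-+ m n))
    (trans (sym (ℚ.+-assoc 1ℚ (fromℕℚ m) (fromℕℚ n))) (cong (ℚ._+ fromℕℚ n) (sym (fromℕℚ-suc m)))))

fromℕℚ-mono : ∀ {m n} → m ℕ.≤ n → fromℕℚ m ℚ.≤ fromℕℚ n
fromℕℚ-mono {m} {n} m≤n = ≤-by (fromℕℚ (n ℕ.∸ m)) (fromℕℚ-nonNeg (n ℕ.∸ m))
  (trans (sym (fromℕℚ-+ m (n ℕ.∸ m))) (cong fromℕℚ (ℕ.m+[n∸m]≡n m≤n)))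

1≤^ : ∀ {a} n → 1ℚ ℚ.≤ a → 1ℚ ℚ.≤ a ^ℚ n
1≤^ zero    1≤a = ℚ.≤-refl
1≤^ (suc n) 1≤a = *-mono-≤ (ℚ.<⇒≤ 0<1) (^-nonNeg n (ℚ.≤-trans (ℚ.<⇒≤ 0<1) 1≤a)) 1≤a (1≤^ n 1≤a)

1≤fromℕℚ : ∀ n → 1ℚ ℚ.≤ fromℕℚ (suc n)
1≤fromℕℚ n = fromℕℚ-mono {1} {suc n} (ℕ.s≤s ℕ.z≤n)

∑-zero : ∀ N → ∑ {N} (λ _ → 0ℚ) ≡ 0ℚ
∑-zero zero    = refl
∑-zero (suc N) = cong₂ ℚ._+_ (∑-zero N) (∑-zero N)

near : ∀ {N} → Vec Bool N → ℕ → Vec Bool N → Bool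
near b q z = dist b z ℕ.≤ᵇ q

≤ᵇ-suc : ∀ m q → (suc m ℕ.≤ᵇ suc q) ≡ (m ℕ.≤ᵇ q)
≤ᵇ-suc zero    q = refl
≤ᵇ-suc (suc m) q = refl

module _ where
  open +-*-Solver

  ball-size : ∀ {N} (b : Vec Bool N) q → ∑ (𝟙 ∘ near b q) ℚ.≤ fromℕℚ (suc N) ^ℚ q
  ball-size [] q = 1≤^ q ℚ.≤-refl
  ball-size {suc N} (β ∷ b) q = ℚ.≤-trans (split β) (bound q)
    where
    -- The points that differ from `b` at the head form a ball of radius one less, which is empty
    -- for radius 0. This is Pascal's recursion.
    other : ℕ → ℚ
    other zero    = 0ℚ
    other (suc q) = ∑ (𝟙 ∘ near b q)

    other-eq : ∀ q → ∑ (λ z → 𝟙 (suc (dist b z) ℕ.≤ᵇ q)) ≡ other q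
    other-eq zero    = ∑-zero N
    other-eq (suc q) = ∑-cong λ z → cong 𝟙 (≤ᵇ-suc (dist b z) q)

    split : ∀ β → ∑ (𝟙 ∘ near (β ∷ b) q) ℚ.≤ ∑ (𝟙 ∘ near b q) ℚ.+ other q
    split false = ℚ.≤-reflexive (cong (∑ (𝟙 ∘ near b q) ℚ.+_) (other-eq q))
    split true  = ℚ.≤-reflexive (trans (ℚ.+-comm (∑ (λ z → 𝟙 (suc (dist b z) ℕ.≤ᵇ q))) (∑ (𝟙 ∘ near b q)))
      (cong (∑ (𝟙 ∘ near b q) ℚ.+_) (other-eq q)))

    bound : ∀ q → ∑ (𝟙 ∘ near b q) ℚ.+ other q ℚ.≤ fromℕℚ (suc (suc N)) ^ℚ q
    bound zero    = ℚ.≤-trans (ℚ.≤-reflexive (ℚ.+-identityʳ (∑ (𝟙 ∘ near b 0)))) (ball-size b zero)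
    bound (suc q) = begin
      ∑ (𝟙 ∘ near b (suc q)) ℚ.+ ∑ (𝟙 ∘ near b q)
        ≤⟨ ℚ.+-mono-≤ (ball-size b (suc q)) (ball-size b q) ⟩
      a ℚ.* a ^ℚ q ℚ.+ a ^ℚ q
        ≡⟨ solve 2 (λ a p → a :* p :+ p := (con 1ℚ :+ a) :* p) refl a (a ^ℚ q) ⟩
      (1ℚ ℚ.+ a) ℚ.* a ^ℚ q
        ≡⟨ cong (ℚ._* a ^ℚ q) (sym (fromℕℚ-suc (suc N))) ⟩
      a′ ℚ.* a ^ℚ q
        ≤⟨ *-monoʳ a′ (fromℕℚ-nonNeg (suc (suc N)))
             (^-mono-≤ q (fromℕℚ-nonNeg (suc N)) (fromℕℚ-mono (ℕ.n≤1+n (suc N)))) ⟩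
      a′ ^ℚ suc q ∎
      where
      open ℚ.≤-Reasoning
      a a′ : ℚ
      a  = fromℕℚ (suc N)
      a′ = fromℕℚ (suc (suc N))

∑-term : ∀ {N} {F : Vec Bool N → ℚ} → (∀ x → 0ℚ ℚ.≤ F x) → ∀ z → F z ℚ.≤ ∑ F
∑-term 0≤F [] = ℚ.≤-refl
∑-term {F = F} 0≤F (false ∷ z) = ℚ.≤-trans (∑-term (0≤F ∘ (false ∷_)) z)
  (x≤x+ (∑ (F ∘ (false ∷_))) (∑-nonNeg (0≤F ∘ (true ∷_))))
∑-term {F = F} 0≤F (true ∷ z) = ℚ.≤-trans (∑-term (0≤F ∘ (true ∷_)) z)
  (ℚ.≤-trans (x≤x+ (∑ (F ∘ (true ∷_))) (∑-nonNeg (0≤F ∘ (false ∷_))))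
    (ℚ.≤-reflexive (ℚ.+-comm (∑ (F ∘ (true ∷_))) (∑ (F ∘ (false ∷_))))))

errorℚ : ∀ {N m} → (Vec Bool N → Vec Bool m) → (Vec Bool N → ℚ) → ParityTree N (Vec Bool m) → ℚ
errorℚ g P T = ∑ λ x → if does (¬? (Vec.≡-dec Bool._≟_ (eval T x) (g x))) then P x else 0ℚ

-- The prior `W` counts the points within distance `q` of the likeliest one. The leaf of a good
-- input contains such a point, so it has weight at least 1, and `errorMass` bounds the probability
-- of a wrong output on good inputs from above. The initial potential is at most the number of
-- candidates.
compress-isolated : ∀ {n} {r : Vec ℚ n} → All UnitInterval r → ∀ (f : Vec Bool n → Bool) q M {e η} →
  11/12 ^ℚ M ℚ.* fromℕℚ (suc n) ^ℚ q ℚ.≤ η →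
  Simulated r f (λ z → near (majority r) q z ≡ true) e →
  ∃ λ (T : ParityTree n (Vec Bool 1)) → depth T ℕ.≤ M × errorℚ ([_] ∘ f) (pmf r) T ℚ.≤ e ℚ.+ η
compress-isolated {n} {r} us f q M {e} {η} small (S , g , simulates , failure≤e) =
  from-tree (compress M ν W ν-nonNeg (λ z → 𝟙-nonNeg (near b q z)))
  where
  open Halving S
  open +-*-Solver
  b : Vec Bool n
  b = majority r
  ν W : Vec Bool n → ℚ
  ν x = pmf r x ℚ.* 𝟙 (g x)
  W z = 𝟙 (near b q z)

  ν-nonNeg : NonNeg ν
  ν-nonNeg x = *-nonNeg (pmf-nonNeg us x) (𝟙-nonNeg (g x))

  W-nonNeg : NonNeg W
  W-nonNeg z = 𝟙-nonNeg (near b q z)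

  1≤cell : ∀ x → g x ≡ true → 1ℚ ℚ.≤ cell S W x
  1≤cell x gx with simulates x gx
  ... | _ , z , same , _ , close = ℚ.≤-trans
    (ℚ.≤-reflexive (sym (cong₂ (λ c d → 𝟙 c ℚ.* 𝟙 d) close (SameLeaf⇒sameLeaf same))))
    (∑-term (restrict-nonNeg W-nonNeg (sameLeaf S x)) z)

  potential≤ : potential ν W ℚ.≤ fromℕℚ (suc n) ^ℚ q
  potential≤ = begin
    potential ν W              ≤⟨ ∑-mono pointwise ⟩
    ∑ (λ x → ∑ W ℚ.* pmf r x)  ≡⟨ ∑-*ˡ (∑ W) (pmf r) ⟩
    ∑ W ℚ.* ∑ (pmf r)          ≡⟨ cong (∑ W ℚ.*_) (pmf-total r) ⟩
    ∑ W ℚ.* 1ℚ                 ≡⟨ ℚ.*-identityʳ (∑ W) ⟩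
    ∑ W                        ≤⟨ ball-size b q ⟩
    fromℕℚ (suc n) ^ℚ q        ∎
    where
    open ℚ.≤-Reasoning
    pointwise : ∀ x → ν x ℚ.* (∑ W ℚ.- cell S W x) ℚ.≤ ∑ W ℚ.* pmf r x
    pointwise x = ℚ.≤-trans
      (*-mono-≤ (ν-nonNeg x) (∑-nonNeg W-nonNeg)
        (ℚ.≤-trans (*-monoʳ (pmf r x) (pmf-nonNeg us x) (𝟙-≤1 (g x))) (ℚ.≤-reflexive (ℚ.*-identityʳ (pmf r x))))
        (≤-by (cell S W x) (mass-nonNeg W-nonNeg (sameLeaf S x))
          (solve 2 (λ t w → (t :- w) :+ w := t) refl (∑ W) (cell S W x))))
      (ℚ.≤-reflexive (ℚ.*-comm (pmf r x) (∑ W)))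

  from-tree : (∃ λ (T : ParityTree n Bool) → depth T ℕ.≤ M × errorMass ν W T ℚ.≤ 11/12 ^ℚ M ℚ.* potential ν W) →
    ∃ λ (T : ParityTree n (Vec Bool 1)) → depth T ℕ.≤ M × errorℚ ([_] ∘ f) (pmf r) T ℚ.≤ e ℚ.+ η
  from-tree (T , shallow , accurate) = mapLeaves [_] T ,
    subst (ℕ._≤ M) (sym (depth-mapLeaves [_] T)) shallow , (begin
      errorℚ ([_] ∘ f) (pmf r) (mapLeaves [_] T)
        ≤⟨ ∑-mono pointwise ⟩
      ∑ (λ x → pmf r x ℚ.* 𝟙 (not (g x)) ℚ.+ ν x ℚ.* (cell S W x ℚ.* 𝟙 (eval T x xor run S x)))
        ≡⟨ ∑-+ (λ x → pmf r x ℚ.* 𝟙 (not (g x))) (λ x → ν x ℚ.* (cell S W x ℚ.* 𝟙 (eval T x xor run S x))) ⟩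
      failure r g ℚ.+ errorMass ν W T
        ≤⟨ ℚ.+-mono-≤ failure≤e (ℚ.≤-trans accurate
             (ℚ.≤-trans (*-monoʳ (11/12 ^ℚ M) (^-nonNeg M (ℚ.nonNegative⁻¹ 11/12)) potential≤) small)) ⟩
      e ℚ.+ η ∎)
    where
    open ℚ.≤-Reasoning

    wrong : ∀ x → does (¬? (Vec.≡-dec Bool._≟_ (eval (mapLeaves [_] T) x) [ f x ])) ≡ eval T x xor f x
    wrong x rewrite eval-mapLeaves [_] T x with eval T x | f x
    ... | true  | true  = refl
    ... | true  | false = refl
    ... | false | true  = refl
    ... | false | false = refl

    cases : ∀ c w p → 0ℚ ℚ.≤ p → (c ≡ true → 1ℚ ℚ.≤ w) → 0ℚ ℚ.≤ w → ∀ i j → (c ≡ true → i ≡ j) →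
      (if i then p else 0ℚ) ℚ.≤ p ℚ.* 𝟙 (not c) ℚ.+ (p ℚ.* 𝟙 c) ℚ.* (w ℚ.* 𝟙 j)
    cases true w p 0≤p 1≤w 0≤w i j i≡j with refl ← i≡j refl with i
    ... | true  = ≤-by (p ℚ.* (w ℚ.- 1ℚ)) (*-nonNeg 0≤p (≤⇒0≤- (1≤w refl)))
      (solve 2 (λ p w → p :+ p :* (w :- con 1ℚ) := p :* con 0ℚ :+ (p :* con 1ℚ) :* (w :* con 1ℚ)) refl p w)
    ... | false = ℚ.≤-reflexive
      (solve 2 (λ p w → con 0ℚ := p :* con 0ℚ :+ (p :* con 1ℚ) :* (w :* con 0ℚ)) refl p w)
    cases false w p 0≤p _ 0≤w i j _ = ℚ.≤-trans (if≤ i)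
      (ℚ.≤-reflexive (solve 3 (λ p w j → p := p :* con 1ℚ :+ (p :* con 0ℚ) :* (w :* j)) refl p w (𝟙 j)))
      where
      if≤ : ∀ i → (if i then p else 0ℚ) ℚ.≤ p
      if≤ true  = ℚ.≤-refl
      if≤ false = 0≤p

    pointwise : ∀ x →
      (if does (¬? (Vec.≡-dec Bool._≟_ (eval (mapLeaves [_] T) x) [ f x ])) then pmf r x else 0ℚ) ℚ.≤
      pmf r x ℚ.* 𝟙 (not (g x)) ℚ.+ ν x ℚ.* (cell S W x ℚ.* 𝟙 (eval T x xor run S x))
    pointwise x rewrite wrong x = cases (g x) (cell S W x) (pmf r x) (pmf-nonNeg us x) (1≤cell x)
      (mass-nonNeg W-nonNeg (sameLeaf S x)) (eval T x xor f x) (eval T x xor run S x)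
      (λ gx → cong (eval T x xor_) (sym (proj₁ (simulates x gx))))

-- Choosing a block on which the representative is sparse

sumFin : ∀ k → (Fin k → ℚ) → ℚ
sumFin zero    F = 0ℚ
sumFin (suc k) F = F zero ℚ.+ sumFin k (F ∘ suc)

pigeonhole : ∀ k (F : Fin (suc k) → ℚ) c →
             sumFin (suc k) F ℚ.≤ fromℕℚ (suc k) ℚ.* c → ∃ λ i → F i ℚ.≤ c
pigeonhole k F c le with F zero ℚ.≤? c
... | yes F₀≤c = zero , F₀≤c
pigeonhole zero F c le | no F₀≰c = contradiction
  (ℚ.≤-trans (ℚ.≤-reflexive (sym (ℚ.+-identityʳ (F zero)))) (ℚ.≤-trans le (ℚ.≤-reflexive (ℚ.*-identityˡ c)))) F₀≰c
pigeonhole (suc k) F c le | no F₀≰c = suc-case (pigeonhole k (F ∘ suc) c rest)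
  where
  open +-*-Solver
  open ℚ.≤-Reasoning
  s : ℚ
  s = sumFin (suc k) (F ∘ suc)
  rest : s ℚ.≤ fromℕℚ (suc k) ℚ.* c
  rest = begin
    s                                   ≡⟨ solve 2 (λ c s → s := (c :+ s) :- c) refl c s ⟩
    (c ℚ.+ s) ℚ.- c                     ≤⟨ ℚ.+-monoˡ-≤ (ℚ.- c) (ℚ.+-monoˡ-≤ s (ℚ.<⇒≤ (ℚ.≰⇒> F₀≰c))) ⟩
    (F zero ℚ.+ s) ℚ.- c                ≤⟨ ℚ.+-monoˡ-≤ (ℚ.- c) le ⟩
    fromℕℚ (suc (suc k)) ℚ.* c ℚ.- c    ≡⟨ cong (λ u → u ℚ.* c ℚ.- c) (fromℕℚ-suc (suc k)) ⟩
    (1ℚ ℚ.+ fromℕℚ (suc k)) ℚ.* c ℚ.- c ≡⟨ solve 2 (λ a c → (con 1ℚ :+ a) :* c :- c := a :* c) refl (fromℕℚ (suc k)) c ⟩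
    fromℕℚ (suc k) ℚ.* c                ∎
  suc-case : (∃ λ i → F (suc i) ℚ.≤ c) → ∃ λ i → F i ℚ.≤ c
  suc-case (i , Fi≤c) = suc i , Fi≤c

sumFin-∑ : ∀ {N} k (F : Fin k → Vec Bool N → ℚ) → sumFin k (λ i → ∑ (F i)) ≡ ∑ (λ x → sumFin k (λ i → F i x))
sumFin-∑ {N} zero    F = sym (∑-zero N)
sumFin-∑     (suc k) F = trans (cong (∑ (F zero) ℚ.+_) (sumFin-∑ k (F ∘ suc)))
  (sym (∑-+ (F zero) (λ x → sumFin k (λ i → F (suc i) x))))

sumFin-*ˡ : ∀ k c (F : Fin k → ℚ) → sumFin k (λ i → c ℚ.* F i) ≡ c ℚ.* sumFin k F
sumFin-*ˡ zero    c F = sym (ℚ.*-zeroʳ c)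
sumFin-*ˡ (suc k) c F = trans (cong (c ℚ.* F zero ℚ.+_) (sumFin-*ˡ k c (F ∘ suc)))
  (sym (ℚ.*-distribˡ-+ c (F zero) (sumFin k (F ∘ suc))))

dist-++ : ∀ {M N} (b : Vec Bool M) (c : Vec Bool N) x y → dist (b ++ c) (x ++ y) ≡ dist b x ℕ.+ dist c y
dist-++ []      c []      y = refl
dist-++ (β ∷ b) c (ξ ∷ x) y with β xor ξ
... | true  = cong suc (dist-++ b c x y)
... | false = dist-++ b c x y

-- Markov's inequality before taking expectations: a point that is not within distance `q` is at
-- distance at least `suc q`.
far-cost : ∀ {n} (b y : Vec Bool n) q → fromℕℚ (suc q) ℚ.* 𝟙 (not (near b q y)) ℚ.≤ fromℕℚ (dist b y)
far-cost b y q with dist b y ℕ.≤ᵇ q in eq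
... | true  = ℚ.≤-trans (ℚ.≤-reflexive (ℚ.*-zeroʳ (fromℕℚ (suc q)))) (fromℕℚ-nonNeg (dist b y))
... | false = ℚ.≤-trans (ℚ.≤-reflexive (ℚ.*-identityʳ (fromℕℚ (suc q))))
  (fromℕℚ-mono {suc q} {dist b y} (ℕ.≰⇒> λ le → subst T eq (ℕ.≤⇒≤ᵇ {dist b y} {q} le)))
  where open import Data.Bool using (T)

far-blocks : ∀ {n} k (r : Vec ℚ n) q (y : Vec Bool (k ℕ.* n)) →
  sumFin k (λ i → fromℕℚ (suc q) ℚ.* 𝟙 (not (near (majority r) q (block k i y)))) ℚ.≤
  fromℕℚ (dist (majority (powerℚ k r)) y)
far-blocks zero    r q [] = ℚ.≤-refl
far-blocks {n} (suc k) r q y = begin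
  fromℕℚ (suc q) ℚ.* 𝟙 (not (near (majority r) q (take n y))) ℚ.+
  sumFin k (λ i → fromℕℚ (suc q) ℚ.* 𝟙 (not (near (majority r) q (block k i (drop n y)))))
    ≤⟨ ℚ.+-mono-≤ (far-cost (majority r) (take n y) q) (far-blocks k r q (drop n y)) ⟩
  fromℕℚ (dist (majority r) (take n y)) ℚ.+ fromℕℚ (dist (majority (powerℚ k r)) (drop n y))
    ≡⟨ sym (fromℕℚ-+ (dist (majority r) (take n y)) (dist (majority (powerℚ k r)) (drop n y))) ⟩
  fromℕℚ (dist (majority r) (take n y) ℕ.+ dist (majority (powerℚ k r)) (drop n y))
    ≡⟨ cong fromℕℚ (sym (dist-++ (majority r) (majority (powerℚ k r)) (take n y) (drop n y))) ⟩
  fromℕℚ (dist (majority r ++ majority (powerℚ k r)) (take n y ++ drop n y))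
    ≡⟨ cong₂ (λ u v → fromℕℚ (dist u v)) (sym (Vec.map-++ likelier r (powerℚ k r))) (Vec.take++drop≡id n y) ⟩
  fromℕℚ (dist (majority (powerℚ (suc k) r)) y) ∎
  where open ℚ.≤-Reasoning

-- The representative differs from the likeliest point in at most `depth T` positions, so on average
-- at most K η of the K blocks are far, and some block is far with probability at most η. The error
-- grows by η for this event and by another η for the search.
directSumℚ : ∀ {n} k → (f : Vec Bool n → Bool) → ∀ {r : Vec ℚ n} → All UnitInterval r →
  ∀ (T : ParityTree (suc k ℕ.* n) (Vec Bool (suc k))) q M {e η} →
  errorℚ (directSum (suc k) f) (pmf (powerℚ (suc k) r)) T ℚ.≤ e →
  fromℕℚ (depth T) ℚ.≤ fromℕℚ (suc q) ℚ.* (fromℕℚ (suc k) ℚ.* η) →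
  11/12 ^ℚ M ℚ.* fromℕℚ (suc n) ^ℚ q ℚ.≤ η →
  ∃ λ (T′ : ParityTree n (Vec Bool 1)) → depth T′ ℕ.≤ M × errorℚ ([_] ∘ f) (pmf r) T′ ℚ.≤ (e ℚ.+ η) ℚ.+ η
directSumℚ {n} k f {r} us T q M {e} {η} error≤e depth≤ small = from-block (pigeonhole k far η far-total)
  where
  K : ℕ
  K = suc k
  P : Vec Bool (K ℕ.* n) → ℚ
  P = pmf (powerℚ K r)
  0≤P : ∀ x → 0ℚ ℚ.≤ P x
  0≤P = pmf-nonNeg (powerℚ-unit K us)
  b : Vec Bool n
  b = majority r

  representative : ∀ x → ∃ λ y →
    Between (majority (powerℚ K r)) x y × dist (majority (powerℚ K r)) y ℕ.≤ queries (affine T) x ×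
    SameLeaf (affine T) x y
  representative = sparse-representative (affine T) (majority (powerℚ K r))

  rep : Vec Bool (K ℕ.* n) → Vec Bool (K ℕ.* n)
  rep x = proj₁ (representative x)

  isFar : Fin K → Vec Bool (K ℕ.* n) → ℚ
  isFar i x = 𝟙 (not (near b q (block K i (rep x))))

  far : Fin K → ℚ
  far i = ∑ λ x → P x ℚ.* isFar i x

  far-total : sumFin K far ℚ.≤ fromℕℚ K ℚ.* η
  far-total = ℚ.*-cancelˡ-≤-pos (fromℕℚ (suc q)) {{ℚ.positive (fromℕℚ-pos q)}} (begin
    Q ℚ.* sumFin K far
      ≡⟨ cong (Q ℚ.*_) (sumFin-∑ K (λ i x → P x ℚ.* isFar i x)) ⟩
    Q ℚ.* ∑ (λ x → sumFin K (λ i → P x ℚ.* isFar i x))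
      ≡⟨ sym (∑-*ˡ Q (λ x → sumFin K (λ i → P x ℚ.* isFar i x))) ⟩
    ∑ (λ x → Q ℚ.* sumFin K (λ i → P x ℚ.* isFar i x))
      ≤⟨ ∑-mono pointwise ⟩
    ∑ (λ x → fromℕℚ (depth T) ℚ.* P x)
      ≡⟨ ∑-*ˡ (fromℕℚ (depth T)) P ⟩
    fromℕℚ (depth T) ℚ.* ∑ P
      ≡⟨ trans (cong (fromℕℚ (depth T) ℚ.*_) (pmf-total (powerℚ K r))) (ℚ.*-identityʳ (fromℕℚ (depth T))) ⟩
    fromℕℚ (depth T)
      ≤⟨ depth≤ ⟩
    Q ℚ.* (fromℕℚ K ℚ.* η) ∎)
    where
    open ℚ.≤-Reasoning
    open +-*-Solver
    Q : ℚ
    Q = fromℕℚ (suc q)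
    pointwise : ∀ x → Q ℚ.* sumFin K (λ i → P x ℚ.* isFar i x) ℚ.≤ fromℕℚ (depth T) ℚ.* P x
    pointwise x = begin
      Q ℚ.* sumFin K (λ i → P x ℚ.* isFar i x)
        ≡⟨ cong (Q ℚ.*_) (sumFin-*ˡ K (P x) (λ i → isFar i x)) ⟩
      Q ℚ.* (P x ℚ.* sumFin K (λ i → isFar i x))
        ≡⟨ solve 3 (λ a b c → a :* (b :* c) := b :* (a :* c)) refl Q (P x) (sumFin K (λ i → isFar i x)) ⟩
      P x ℚ.* (Q ℚ.* sumFin K (λ i → isFar i x))
        ≡⟨ cong (P x ℚ.*_) (sym (sumFin-*ˡ K Q (λ i → isFar i x))) ⟩
      P x ℚ.* sumFin K (λ i → Q ℚ.* isFar i x)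
        ≤⟨ *-monoʳ (P x) (0≤P x) (ℚ.≤-trans (far-blocks K r q (rep x))
             (fromℕℚ-mono (ℕ.≤-trans (proj₁ (proj₂ (proj₂ (representative x)))) (queries-affine T x)))) ⟩
      P x ℚ.* fromℕℚ (depth T)
        ≡⟨ ℚ.*-comm (P x) (fromℕℚ (depth T)) ⟩
      fromℕℚ (depth T) ℚ.* P x ∎

  from-block : (∃ λ i → far i ℚ.≤ η) →
    ∃ λ (T′ : ParityTree n (Vec Bool 1)) → depth T′ ℕ.≤ M × errorℚ ([_] ∘ f) (pmf r) T′ ℚ.≤ (e ℚ.+ η) ℚ.+ η
  from-block (i , far≤η) = compress-isolated us f q M small (weaken
      (isolate-block us K i (affine Tᵢ) g {f} {λ z → near b q z ≡ true} simulates))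
    where
    Tᵢ : ParityTree (K ℕ.* n) Bool
    Tᵢ = mapLeaves (λ v → lookup v i) T

    -- An input is good for block `i` if the `i`-th output bit is right and the representative is
    -- near in that block.
    agrees close g : Vec Bool (K ℕ.* n) → Bool
    agrees x = not (lookup (eval T x) i xor f (block K i x))
    close x = near b q (block K i (rep x))
    g x = agrees x ∧ close x

    agrees⇒≡ : ∀ u v → not (u xor v) ≡ true → u ≡ v
    agrees⇒≡ true  true  _ = refl
    agrees⇒≡ false false _ = refl

    simulates : Simulates (majority (powerℚ K r)) (affine Tᵢ) g (f ∘ block K i)
                  (λ x → near b q (block K i x) ≡ true)
    simulates x gx = trans (run-affine Tᵢ x) (trans (eval-mapLeaves (λ v → lookup v i) T x)
        (agrees⇒≡ (lookup (eval T x) i) (f (block K i x)) (Bool.∧-conicalˡ (agrees x) (close x) gx))) ,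
      rep x , SameLeaf-mapLeaves (λ v → lookup v i) T (proj₂ (proj₂ (proj₂ (representative x)))) ,
      proj₁ (proj₂ (representative x)) , Bool.∧-conicalʳ (agrees x) (close x) gx

    errs : Vec Bool (K ℕ.* n) → Bool
    errs x = does (¬? (Vec.≡-dec Bool._≟_ (eval T x) (directSum K f x)))

    disagrees⇒errs : ∀ x → agrees x ≡ false → errs x ≡ true
    disagrees⇒errs x eq with Vec.≡-dec Bool._≟_ (eval T x) (directSum K f x)
    ... | no _  = refl
    ... | yes p = contradiction (trans (sym eq) (cong not (trans
      (cong (_xor f (block K i x)) (trans (cong (λ v → lookup v i) p) (Vec.lookup-map i f (blocks K n x))))
      (Bool.xor-same (f (block K i x)))))) λ ()

    failure≤ : failure (powerℚ K r) g ℚ.≤ e ℚ.+ η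
    failure≤ = ℚ.≤-trans (∑-mono λ x → cases (agrees x) (close x) (errs x) (0≤P x) (disagrees⇒errs x))
      (ℚ.≤-trans (ℚ.≤-reflexive (∑-+ (λ x → if errs x then P x else 0ℚ) (λ x → P x ℚ.* isFar i x)))
        (ℚ.+-mono-≤ error≤e far≤η))
      where
      cases : ∀ a c w {p} → 0ℚ ℚ.≤ p → (a ≡ false → w ≡ true) →
              p ℚ.* 𝟙 (not (a ∧ c)) ℚ.≤ (if w then p else 0ℚ) ℚ.+ p ℚ.* 𝟙 (not c)
      cases false c w {p} 0≤p sound with refl ← sound refl = ℚ.≤-trans
        (ℚ.≤-reflexive (ℚ.*-identityʳ p)) (x≤x+ p (*-nonNeg 0≤p (𝟙-nonNeg (not c))))
      cases true c w {p} 0≤p _ = ℚ.≤-trans (x≤x+ (p ℚ.* 𝟙 (not c)) (if-nonNeg w))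
        (ℚ.≤-reflexive (ℚ.+-comm (p ℚ.* 𝟙 (not c)) (if w then p else 0ℚ)))
        where
        if-nonNeg : ∀ w → 0ℚ ℚ.≤ (if w then p else 0ℚ)
        if-nonNeg true  = 0≤p
        if-nonNeg false = ℚ.≤-refl

    weaken : Simulated r f (λ z → near b q z ≡ true) (failure (powerℚ K r) g) →
             Simulated r f (λ z → near b q z ≡ true) (e ℚ.+ η)
    weaken (S , h , sim , le) = S , h , sim , ℚ.≤-trans le failure≤

-- Rational approximation of real distributions and errors

prodℚ : ∀ {k} → Vec ℚ k → ℚ
prodℚ = foldr _ ℚ._*_ 1ℚ

∑-seq : ∀ N (F : Vec Bool N → ℝ) m → seq (sumCube N F) m ≡ ∑ (λ x → seq (F x) m)
∑-seq zero    F m = refl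
∑-seq (suc N) F m = cong₂ ℚ._+_ (∑-seq N (F ∘ (false ∷_)) m) (∑-seq N (F ∘ (true ∷_)) m)

seq-error : ∀ {N k} (g : Vec Bool N → Vec Bool k) ν T m →
            seq (error g ν T) m ≡ errorℚ g (λ x → seq (ν x) m) T
seq-error {N} g ν T m = trans
  (∑-seq N (λ x → if does (¬? (Vec.≡-dec Bool._≟_ (eval T x) (g x))) then ν x else 0ℝ) m)
  (∑-cong λ x → seq-if (does (¬? (Vec.≡-dec Bool._≟_ (eval T x) (g x)))) (ν x))
  where
  seq-if : ∀ b y → seq (if b then y else 0ℝ) m ≡ (if b then seq y m else 0ℚ)
  seq-if true  y = refl
  seq-if false y = refl

seq-∏ : ∀ {k} (v : Vec ℝ k) m → seq (∏ v) m ≡ prodℚ (map (λ y → seq y m) v)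
seq-∏ []      m = refl
seq-∏ (y ∷ v) m = cong (seq y m ℚ.*_) (seq-∏ v m)

seq-^ : ∀ x q m → seq (x ^ q) m ≡ seq x m ^ℚ q
seq-^ x zero    m = refl
seq-^ x (suc q) m = cong (seq x m ℚ.*_) (seq-^ x q m)

prodℚ-pmf : ∀ {N} (r : Vec ℚ N) x → prodℚ (zipWith bernoulliℚ x r) ≡ pmf r x
prodℚ-pmf []      []      = refl
prodℚ-pmf (p ∷ r) (b ∷ x) = cong (bernoulliℚ b p ℚ.*_) (prodℚ-pmf r x)

prodℚ-powerℚ : ∀ {n} k (r : Vec ℚ n) x → prodℚ (map (pmf r) (blocks k n x)) ≡ pmf (powerℚ k r) x
prodℚ-powerℚ zero    r [] = refl
prodℚ-powerℚ {n} (suc k) r x = trans (cong (pmf r (take n x) ℚ.*_) (prodℚ-powerℚ k r (drop n x)))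
  (trans (sym (pmf-++ r (powerℚ k r) (take n x) (drop n x)))
    (cong (pmf (r ++ powerℚ k r)) (Vec.take++drop≡id n x)))

Eventually : (ℕ → Set) → Set
Eventually P = ∃ λ N → ∀ m → N ℕ.≤ m → P m

eventually-× : ∀ {P Q} → Eventually P → Eventually Q → Eventually (λ m → P m × Q m)
eventually-× (M , p) (N , q) = M ℕ.⊔ N , λ m m≥ →
  p m (ℕ.m⊔n≤o⇒m≤o M N m≥) , q m (ℕ.m⊔n≤o⇒n≤o M N m≥)

eventually-map : ∀ {P Q : ℕ → Set} → (∀ m → P m → Q m) → Eventually P → Eventually Q
eventually-map f (N , p) = N , λ m m≥ → f m (p m m≥)

eventually-∀ : ∀ {N} {P : Vec Bool N → ℕ → Set} → (∀ x → Eventually (P x)) → Eventually (λ m → ∀ x → P x m)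
eventually-∀ {zero}  ev = eventually-map (λ { m p [] → p }) (ev [])
eventually-∀ {suc N} ev = eventually-map
  (λ { m (p , q) (false ∷ x) → p x ; m (p , q) (true ∷ x) → q x })
  (eventually-× (eventually-∀ (ev ∘ (false ∷_))) (eventually-∀ (ev ∘ (true ∷_))))

-- `x ≤ y` only denies `y < x`. Comparing `x` with the gap between `y` and `y + fromℚ θ` by
-- `cotransitive` leaves the alternative that does bound the terms.
≤⇒eventually : ∀ {x y} → x ≤ y → ∀ {θ} → 0ℚ ℚ.< θ → Eventually (λ m → seq x m ℚ.≤ seq y m ℚ.+ θ)
≤⇒eventually {x} {y} x≤y {θ} 0<θ
  with cotransitive y (y + fromℚ θ) (θ , 0<θ , 0 , λ _ _ → ℚ.≤-refl) x
... | inj₁ y<x = contradiction y<x x≤y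
... | inj₂ (η , 0<η , N , le) = N , λ m m≥ → ℚ.≤-trans (x≤x+ (seq x m) (ℚ.<⇒≤ 0<η)) (le m m≥)

seq-0ℝ : ∀ m → seq 0ℝ m ≡ 0ℚ
seq-0ℝ m = refl

seq-1ℝ : ∀ m → seq 1ℝ m ≡ 1ℚ
seq-1ℝ m = refl

Near : ℚ → ℚ → ℚ → Set
Near θ a b = ℚ.∣ a ℚ.- b ∣ ℚ.≤ θ

module _ where
  open +-*-Solver

  near-intro : ∀ {a b θ} → a ℚ.≤ b ℚ.+ θ → b ℚ.≤ a ℚ.+ θ → Near θ a b
  near-intro {a} {b} {θ} a≤ b≤ with ℚ.∣p∣≡p∨∣p∣≡-p (a ℚ.- b)
  ... | inj₁ eq = subst (ℚ._≤ θ) (sym eq)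
    (≤-by ((b ℚ.+ θ) ℚ.- a) (≤⇒0≤- a≤) (solve 3 (λ a b t → (a :- b) :+ ((b :+ t) :- a) := t) refl a b θ))
  ... | inj₂ eq = subst (ℚ._≤ θ) (sym eq)
    (≤-by ((a ℚ.+ θ) ℚ.- b) (≤⇒0≤- b≤) (solve 3 (λ a b t → :- (a :- b) :+ ((a :+ t) :- b) := t) refl a b θ))

  near-sym : ∀ {a b θ} → Near θ a b → Near θ b a
  near-sym {a} {b} {θ} = subst (ℚ._≤ θ) (trans (sym (ℚ.∣-p∣≡∣p∣ (a ℚ.- b)))
    (cong ℚ.∣_∣ (solve 2 (λ a b → :- (a :- b) := b :- a) refl a b)))

  near-trans : ∀ {a b c θ κ} → Near θ a b → Near κ b c → Near (θ ℚ.+ κ) a c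
  near-trans {a} {b} {c} p q = ℚ.≤-trans (ℚ.≤-reflexive
      (cong ℚ.∣_∣ (solve 3 (λ a b c → a :- c := (a :- b) :+ (b :- c)) refl a b c)))
    (ℚ.≤-trans (ℚ.∣p+q∣≤∣p∣+∣q∣ (a ℚ.- b) (b ℚ.- c)) (ℚ.+-mono-≤ p q))

  near-complement : ∀ {a b θ} → Near θ a b → Near θ (1ℚ ℚ.- a) (1ℚ ℚ.- b)
  near-complement {a} {b} {θ} p = subst (ℚ._≤ θ)
    (cong ℚ.∣_∣ (solve 2 (λ a b → b :- a := (con 1ℚ :- a) :- (con 1ℚ :- b)) refl a b)) (near-sym {a} {b} p)

∣unit∣≤1 : ∀ {a} → UnitInterval a → ℚ.∣ a ∣ ℚ.≤ 1ℚ
∣unit∣≤1 (0≤a , a≤1) = subst (ℚ._≤ 1ℚ) (sym (ℚ.0≤p⇒∣p∣≡p 0≤a)) a≤1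

prodℚ-unit : ∀ {k} {v : Vec ℚ k} → All UnitInterval v → UnitInterval (prodℚ v)
prodℚ-unit []                 = ℚ.<⇒≤ 0<1 , ℚ.≤-refl
prodℚ-unit ((0≤a , a≤1) ∷ us) with prodℚ-unit us
... | 0≤b , b≤1 = *-nonNeg 0≤a 0≤b , *-mono-≤ 0≤a (ℚ.<⇒≤ 0<1) a≤1 b≤1

⊓-pos : ∀ {a b} → 0ℚ ℚ.< a → 0ℚ ℚ.< b → 0ℚ ℚ.< a ℚ.⊓ b
⊓-pos {a} {b} 0<a 0<b with ℚ.≤-total a b
... | inj₁ a≤b = subst (0ℚ ℚ.<_) (sym (ℚ.p≤q⇒p⊓q≡p a≤b)) 0<a
... | inj₂ b≤a = subst (0ℚ ℚ.<_) (sym (ℚ.p≥q⇒p⊓q≡q b≤a)) 0<b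

prodℚ-modulus : ∀ k {η} → 0ℚ ℚ.< η → ∃ λ θ → 0ℚ ℚ.< θ ×
  (∀ {u v : Vec ℚ k} → Pointwise (Near θ) u v → All UnitInterval v → Near η (prodℚ u) (prodℚ v))
prodℚ-modulus zero {η} 0<η = 1ℚ , 0<1 , λ { [] [] → ℚ.<⇒≤ 0<η }
prodℚ-modulus (suc k) {η} 0<η = from-tail (prodℚ-modulus k 0<κ)
  where
  η′ κ : ℚ
  η′ = η ℚ.⊓ 1ℚ
  -- The denominator is A + B in `*-close`: the approximated factor is at most 2 in absolute value,
  -- being within 1 of the unit interval, and the exact product is at most 1. The minimum with 1
  -- ensures κ ≤ 1.
  κ  = η′ ℚ.* recip (2ℚ ℚ.+ 1ℚ)
  0<η′ : 0ℚ ℚ.< η′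
  0<η′ = ⊓-pos 0<η 0<1
  0<κ : 0ℚ ℚ.< κ
  0<κ = *-pos 0<η′ (ℚ.positive⁻¹ (recip (2ℚ ℚ.+ 1ℚ)))
  κ≤1 : κ ℚ.≤ 1ℚ
  κ≤1 = ℚ.≤-trans (*-monoˡ (recip (2ℚ ℚ.+ 1ℚ)) (ℚ.nonNegative⁻¹ (recip (2ℚ ℚ.+ 1ℚ))) (ℚ.p⊓q≤q η 1ℚ))
    (ℚ.≤ᵇ⇒≤ tt)
  from-tail : (∃ λ θ → 0ℚ ℚ.< θ ×
      (∀ {u v : Vec ℚ k} → Pointwise (Near θ) u v → All UnitInterval v → Near κ (prodℚ u) (prodℚ v))) →
    ∃ λ θ → 0ℚ ℚ.< θ ×
      (∀ {u v : Vec ℚ (suc k)} → Pointwise (Near θ) u v → All UnitInterval v → Near η (prodℚ u) (prodℚ v))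
  from-tail (θ , 0<θ , close) = θ ℚ.⊓ κ , ⊓-pos 0<θ 0<κ , near-prod
    where
    near-prod : ∀ {u v : Vec ℚ (suc k)} → Pointwise (Near (θ ℚ.⊓ κ)) u v → All UnitInterval v →
                Near η (prodℚ u) (prodℚ v)
    near-prod {a ∷ u} {c ∷ v} (p ∷ ps) (unit ∷ us) = ℚ.≤-trans
      (*-close a (prodℚ u) c (prodℚ v) {2ℚ} {1ℚ} {η′} (ℚ.positive⁻¹ 2ℚ) 0<1 0<η′
        (ℚ.≤-trans (∣-∣≤⇒∣∣≤+ {a} {c} (ℚ.≤-trans near-κ κ≤1)) (ℚ.+-monoˡ-≤ 1ℚ (∣unit∣≤1 unit)))
        (∣unit∣≤1 (prodℚ-unit us)) near-κ
        (close (Pointwise.map (λ le → ℚ.≤-trans le (ℚ.p⊓q≤p θ κ)) ps) us))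
      (ℚ.p⊓q≤p η 1ℚ)
      where
      near-κ : Near κ a c
      near-κ = ℚ.≤-trans p (ℚ.p⊓q≤q θ κ)

-- The terms of a real in [0,1] may lie slightly outside, whereas `pmf` needs exact probabilities;
-- so a late term is clipped to the interval.
approximate : ∀ y → 0ℝ ≤ y → y ≤ 1ℝ → ∀ {θ} → 0ℚ ℚ.< θ →
              ∃ λ c → UnitInterval c × Eventually (λ m → Near θ (seq y m) c)
approximate y 0≤y y≤1 {θ} 0<θ = from-moduli (cauchy y (½ ℚ.* θ) (half-pos 0<θ))
    (eventually-× above below)
  where
  above : Eventually (λ m → 0ℚ ℚ.≤ seq y m ℚ.+ ½ ℚ.* θ)
  above = eventually-map (λ m → subst (ℚ._≤ seq y m ℚ.+ ½ ℚ.* θ) (seq-0ℝ m))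
    (≤⇒eventually {0ℝ} {y} 0≤y (half-pos 0<θ))
  below : Eventually (λ m → seq y m ℚ.≤ 1ℚ ℚ.+ ½ ℚ.* θ)
  below = eventually-map (λ m → subst (λ u → seq y m ℚ.≤ u ℚ.+ ½ ℚ.* θ) (seq-1ℝ m))
    (≤⇒eventually {y} {1ℝ} y≤1 (half-pos 0<θ))

  clip : ∀ a → 0ℚ ℚ.≤ a ℚ.+ ½ ℚ.* θ → a ℚ.≤ 1ℚ ℚ.+ ½ ℚ.* θ → ∃ λ c → UnitInterval c × Near (½ ℚ.* θ) a c
  clip a lower upper = choose (a ℚ.≤? 0ℚ) (a ℚ.≤? 1ℚ)
    where
    choose : Dec (a ℚ.≤ 0ℚ) → Dec (a ℚ.≤ 1ℚ) → ∃ λ c → UnitInterval c × Near (½ ℚ.* θ) a c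
    choose (yes a≤0) _         = 0ℚ , (ℚ.≤-refl , ℚ.<⇒≤ 0<1) ,
      near-intro {a} {0ℚ} (ℚ.≤-trans a≤0 (x≤x+ 0ℚ (ℚ.<⇒≤ (half-pos 0<θ)))) lower
    choose (no a≰0)  (yes a≤1) = a , (ℚ.<⇒≤ (ℚ.≰⇒> a≰0) , a≤1) ,
      near-intro {a} {a} (x≤x+ a (ℚ.<⇒≤ (half-pos 0<θ))) (x≤x+ a (ℚ.<⇒≤ (half-pos 0<θ)))
    choose (no _)    (no a≰1)  = 1ℚ , (ℚ.<⇒≤ 0<1 , ℚ.≤-refl) ,
      near-intro {a} {1ℚ} upper (ℚ.≤-trans (ℚ.<⇒≤ (ℚ.≰⇒> a≰1)) (x≤x+ a (ℚ.<⇒≤ (half-pos 0<θ))))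

  from-moduli : EventuallyWithin (½ ℚ.* θ) (seq y) →
    Eventually (λ m → 0ℚ ℚ.≤ seq y m ℚ.+ ½ ℚ.* θ × seq y m ℚ.≤ 1ℚ ℚ.+ ½ ℚ.* θ) →
    ∃ λ c → UnitInterval c × Eventually (λ m → Near θ (seq y m) c)
  from-moduli (M , close) (N , bounds) =
    from-clip (clip (seq y K) (proj₁ (bounds K (ℕ.m≤n⊔m M N))) (proj₂ (bounds K (ℕ.m≤n⊔m M N))))
    where
    K : ℕ
    K = M ℕ.⊔ N
    from-clip : (∃ λ c → UnitInterval c × Near (½ ℚ.* θ) (seq y K) c) →
                ∃ λ c → UnitInterval c × Eventually (λ m → Near θ (seq y m) c)
    from-clip (c , unit , near) = c , unit , K , λ m m≥ → subst (λ u → Near u (seq y m) c) (half+half θ)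
      (near-trans {seq y m} {seq y K} {c} (close m K (ℕ.m⊔n≤o⇒m≤o M N m≥) (ℕ.m≤m⊔n M N)) near)

approximates : ∀ {n} (p : Vec ℝ n) → (∀ i → 0ℝ ≤ lookup p i × lookup p i ≤ 1ℝ) → ∀ {θ} → 0ℚ ℚ.< θ →
  ∃ λ (r : Vec ℚ n) → All UnitInterval r ×
    Eventually (λ m → Pointwise (Near θ) (map (λ y → seq y m) p) r)
approximates []      _    _   = [] , [] , 0 , λ _ _ → []
approximates {suc n} (y ∷ p) unit {θ} 0<θ =
  extend (approximate y (proj₁ (unit zero)) (proj₂ (unit zero)) 0<θ) (approximates p (unit ∘ suc) 0<θ)
  where
  extend : (∃ λ c → UnitInterval c × Eventually (λ m → Near θ (seq y m) c)) →
    (∃ λ (r : Vec ℚ n) → All UnitInterval r ×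
      Eventually (λ m → Pointwise (Near θ) (map (λ y → seq y m) p) r)) →
    ∃ λ (r : Vec ℚ (suc n)) → All UnitInterval r ×
      Eventually (λ m → Pointwise (Near θ) (map (λ y → seq y m) (y ∷ p)) r)
  extend (c , u , ev) (r , us , evs) = c ∷ r , u ∷ us ,
    eventually-map (λ _ (near , nears) → near ∷ nears) (eventually-× ev evs)

approximate-product : ∀ {n} (μ : Vec Bool n → ℝ) → IsProduct μ → ∀ {η} → 0ℚ ℚ.< η →
  ∃ λ (r : Vec ℚ n) → All UnitInterval r × Eventually (λ m → ∀ x → Near η (seq (μ x) m) (pmf r x))
approximate-product {n} μ (p , unit , isProduct) {η} 0<η =
  from-modulus (prodℚ-modulus n (half-pos 0<η))
  where
  weights : Vec Bool n → Vec ℝ n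
  weights x = zipWith (λ b q → if b then q else 1ℝ - q) x p

  Goal : Set
  Goal = ∃ λ (r : Vec ℚ n) → All UnitInterval r × Eventually (λ m → ∀ x → Near η (seq (μ x) m) (pmf r x))

  μ-near : Eventually (λ m → ∀ x → Near (½ ℚ.* η) (seq (μ x) m) (seq (∏ (weights x)) m))
  μ-near = eventually-∀ λ x → eventually-map (λ m (le , ge) → near-intro {seq (μ x) m} {seq (∏ (weights x)) m} le ge)
    (eventually-× (≤⇒eventually {μ x} {∏ (weights x)} (proj₁ (isProduct x)) (half-pos 0<η))
                  (≤⇒eventually {∏ (weights x)} {μ x} (proj₂ (isProduct x)) (half-pos 0<η)))

  weights-near : ∀ {k θ} (x : Vec Bool k) (p : Vec ℝ k) {r} m → Pointwise (Near θ) (map (λ y → seq y m) p) r →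
    Pointwise (Near θ) (map (λ y → seq y m) (zipWith (λ b q → if b then q else 1ℝ - q) x p)) (zipWith bernoulliℚ x r)
  weights-near []          []      m []         = []
  weights-near (true ∷ x)  (y ∷ p) m (near ∷ nears) = near ∷ weights-near x p m nears
  weights-near (false ∷ x) (y ∷ p) {c ∷ _} m (near ∷ nears) =
    near-complement {seq y m} {c} near ∷ weights-near x p m nears

  weights-unit : ∀ {k} (x : Vec Bool k) {r : Vec ℚ k} → All UnitInterval r → All UnitInterval (zipWith bernoulliℚ x r)
  weights-unit []      []       = []
  weights-unit (b ∷ x) (u ∷ us) = bernoulliℚ-unit b u ∷ weights-unit x us

  from-modulus : (∃ λ θ → 0ℚ ℚ.< θ × (∀ {u v : Vec ℚ n} → Pointwise (Near θ) u v → All UnitInterval v →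
    Near (½ ℚ.* η) (prodℚ u) (prodℚ v))) → Goal
  from-modulus (θ , 0<θ , continuous) = from-approximation (approximates p unit 0<θ)
    where
    from-approximation : (∃ λ (r : Vec ℚ n) → All UnitInterval r ×
      Eventually (λ m → Pointwise (Near θ) (map (λ y → seq y m) p) r)) → Goal
    from-approximation (r , us , ev) = r , us , eventually-map combine (eventually-× μ-near ev)
      where
      combine : ∀ m → (∀ x → Near (½ ℚ.* η) (seq (μ x) m) (seq (∏ (weights x)) m)) ×
                      Pointwise (Near θ) (map (λ y → seq y m) p) r → ∀ x → Near η (seq (μ x) m) (pmf r x)
      combine m (near , nears) x = subst (λ u → Near u (seq (μ x) m) (pmf r x)) (half+half η)
        (near-trans {seq (μ x) m} {seq (∏ (weights x)) m} {pmf r x} (near x)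
          (subst₂ (Near (½ ℚ.* η)) (sym (seq-∏ (weights x) m)) (prodℚ-pmf r x)
            (continuous (weights-near x p m nears) (weights-unit x us))))

power-near : ∀ {n} k {η} → 0ℚ ℚ.< η → ∃ λ θ → 0ℚ ℚ.< θ ×
  (∀ (μ : Vec Bool n → ℝ) {r} m → All UnitInterval r → (∀ x → Near θ (seq (μ x) m) (pmf r x)) →
    ∀ x → Near η (seq (power k μ x) m) (pmf (powerℚ k r) x))
power-near {n} k {η} 0<η with prodℚ-modulus k 0<η
... | θ , 0<θ , continuous = θ , 0<θ , λ μ {r} m us near x →
  subst₂ (Near η) (sym (seq-∏ (map μ (blocks k n x)) m)) (prodℚ-powerℚ k r x)
    (continuous (factors μ r m near (blocks k n x)) (units us (blocks k n x)))
  where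
  factors : ∀ μ (r : Vec ℚ n) m → (∀ x → Near θ (seq (μ x) m) (pmf r x)) → ∀ {k} (xs : Vec (Vec Bool n) k) →
    Pointwise (Near θ) (map (λ y → seq y m) (map μ xs)) (map (pmf r) xs)
  factors μ r m near []       = []
  factors μ r m near (x ∷ xs) = near x ∷ factors μ r m near xs
  units : ∀ {r : Vec ℚ n} → All UnitInterval r → ∀ {k} (xs : Vec (Vec Bool n) k) → All UnitInterval (map (pmf r) xs)
  units us []       = []
  units us (x ∷ xs) = pmf-unit us x ∷ units us xs

∑-share : ∀ N η → ∑ {N} (λ _ → ½ ^ℚ N ℚ.* η) ≡ η
∑-share zero    η = ℚ.*-identityˡ η
∑-share (suc N) η = trans (cong₂ ℚ._+_ share share) (half+half η)
  where
  share : ∑ {N} (λ _ → ½ ^ℚ suc N ℚ.* η) ≡ ½ ℚ.* η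
  share = trans (∑-cong {N} λ _ → ℚ.*-assoc ½ (½ ^ℚ N) η)
    (trans (∑-*ˡ {N} ½ (λ _ → ½ ^ℚ N ℚ.* η)) (cong (½ ℚ.*_) (∑-share N η)))

^-pos : ∀ {a} n → 0ℚ ℚ.< a → 0ℚ ℚ.< a ^ℚ n
^-pos zero    0<a = 0<1
^-pos (suc n) 0<a = *-pos 0<a (^-pos n 0<a)

-- The tolerance η is shared equally among the points of the cube, at most all of which are
-- erroneous.
errorℚ-near : ∀ {N k} (g : Vec Bool N → Vec Bool k) {P Q : Vec Bool N → ℚ} {η} T → 0ℚ ℚ.< η →
  (∀ x → Near (½ ^ℚ N ℚ.* η) (P x) (Q x)) → errorℚ g P T ℚ.≤ errorℚ g Q T ℚ.+ η
errorℚ-near {N} g {P} {Q} {η} T 0<η near = ℚ.≤-trans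
  (∑-mono {G = λ x → (if wrong x then Q x else 0ℚ) ℚ.+ θ} λ x → cases (wrong x) (∣-∣≤⇒≤+ (P x) (Q x) (near x)))
  (ℚ.≤-reflexive (trans (∑-+ (λ x → if wrong x then Q x else 0ℚ) (λ _ → θ))
    (cong (errorℚ g Q T ℚ.+_) (∑-share N η))))
  where
  θ : ℚ
  θ = ½ ^ℚ N ℚ.* η
  wrong : Vec Bool N → Bool
  wrong x = does (¬? (Vec.≡-dec Bool._≟_ (eval T x) (g x)))
  cases : ∀ b {p q} → p ℚ.≤ q ℚ.+ θ → (if b then p else 0ℚ) ℚ.≤ (if b then q else 0ℚ) ℚ.+ θ
  cases true  le = le
  cases false _  = x≤x+ 0ℚ (ℚ.<⇒≤ (*-pos (^-pos N (ℚ.positive⁻¹ ½)) 0<η))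

-- The conclusion is a negation: a supposed strict gap is refuted at one index that is late enough
-- for the gap, the approximation and the bound on `y`.
errorℚ⇒error : ∀ {N k} (g : Vec Bool N → Vec Bool k) (μ : Vec Bool N → ℝ) {Q : Vec Bool N → ℚ} {y τ B} T →
  0ℚ ℚ.< τ → Eventually (λ m → ∀ x → Near (½ ^ℚ N ℚ.* τ) (seq (μ x) m) (Q x)) →
  Eventually (λ m → B ℚ.+ τ ℚ.≤ seq y m) → errorℚ g Q T ℚ.≤ B → error g μ T ≤ y
errorℚ⇒error g μ {Q} {y} {τ} {B} T 0<τ near big small (η , 0<η , N , gap)
  with eventually-× near big
... | M , both = ℚ.<-irrefl refl (ℚ.<-≤-trans (x<x+ (seq y m) 0<η) (begin
  seq y m ℚ.+ η                     ≤⟨ gap m (ℕ.m≤m⊔n N M) ⟩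
  seq (error g μ T) m               ≡⟨ seq-error g μ T m ⟩
  errorℚ g (λ x → seq (μ x) m) T    ≤⟨ errorℚ-near g T 0<τ (proj₁ (both m (ℕ.m≤n⊔m N M))) ⟩
  errorℚ g Q T ℚ.+ τ                ≤⟨ ℚ.+-monoˡ-≤ τ small ⟩
  B ℚ.+ τ                           ≤⟨ proj₂ (both m (ℕ.m≤n⊔m N M)) ⟩
  seq y m                           ∎))
  where
  open ℚ.≤-Reasoning
  m : ℕ
  m = N ℕ.⊔ M

-- Choice of parameters and the logarithm

fromℕℚ-* : ∀ m n → fromℕℚ (m ℕ.* n) ≡ fromℕℚ m ℚ.* fromℕℚ n
fromℕℚ-* zero    n = sym (ℚ.*-zeroˡ (fromℕℚ n))
fromℕℚ-* (suc m) n = begin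
  fromℕℚ (n ℕ.+ m ℕ.* n)                 ≡⟨ fromℕℚ-+ n (m ℕ.* n) ⟩
  fromℕℚ n ℚ.+ fromℕℚ (m ℕ.* n)          ≡⟨ cong (fromℕℚ n ℚ.+_) (fromℕℚ-* m n) ⟩
  fromℕℚ n ℚ.+ fromℕℚ m ℚ.* fromℕℚ n     ≡⟨ solve 2 (λ m n → n :+ m :* n := (con 1ℚ :+ m) :* n) refl (fromℕℚ m) (fromℕℚ n) ⟩
  (1ℚ ℚ.+ fromℕℚ m) ℚ.* fromℕℚ n         ≡⟨ cong (ℚ._* fromℕℚ n) (sym (fromℕℚ-suc m)) ⟩
  fromℕℚ (suc m) ℚ.* fromℕℚ n            ∎
  where
  open ≡-Reasoning
  open +-*-Solver

1^ : ∀ n → 1ℚ ^ℚ n ≡ 1ℚ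
1^ zero    = refl
1^ (suc n) = trans (ℚ.*-identityˡ (1ℚ ^ℚ n)) (1^ n)

fromℕℚ≤2^ : ∀ n → fromℕℚ n ℚ.≤ 2ℚ ^ℚ n
fromℕℚ≤2^ zero    = ℚ.<⇒≤ 0<1
fromℕℚ≤2^ (suc n) = begin
  fromℕℚ (suc n)           ≡⟨ fromℕℚ-suc n ⟩
  1ℚ ℚ.+ fromℕℚ n          ≤⟨ ℚ.+-mono-≤ (1≤^ n (ℚ.≤ᵇ⇒≤ tt)) (fromℕℚ≤2^ n) ⟩
  2ℚ ^ℚ n ℚ.+ 2ℚ ^ℚ n      ≡⟨ solve 1 (λ a → a :+ a := con 2ℚ :* a) refl (2ℚ ^ℚ n) ⟩
  2ℚ ^ℚ suc n              ∎
  where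
  open ℚ.≤-Reasoning
  open +-*-Solver

-- Only failure at the predecessor is provided; for the least `q` and `ℓ` this is the tightness that
-- the final estimate uses.
threshold : ∀ {P : ℕ → Set} → (∀ n → Dec (P n)) → ∀ N → P N →
            ∃ λ n → P n × (∀ j → n ≡ suc j → ¬ P j)
threshold P? zero    p = zero , p , λ _ ()
threshold P? (suc N) p with P? N
... | yes q = threshold P? N q
... | no ¬q = suc N , p , λ { _ refl → ¬q }

⅛ ¼ 3/2 : ℚ
⅛ = ℤ.+ 1 ℚ./ 8
¼ = ℤ.+ 1 ℚ./ 4
3/2 = ℤ.+ 3 ℚ./ 2

-- The margin of `δ₀` below `δ` pays for replacing `μ`, `ε` and `δ` by rationals; the upper bound
-- limits the loss in the final constant.
Bracket : ℝ → ℚ → Set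
Bracket δ δ₀ = Eventually (λ m → δ₀ ℚ.+ ⅛ ℚ.* δ₀ ℚ.≤ seq δ m × seq δ m ℚ.≤ 3/2 ℚ.* δ₀)

bracket : ∀ δ → 0ℝ < δ → ∃ λ δ₀ → 0ℚ ℚ.< δ₀ × Bracket δ δ₀
bracket δ (s , 0<s , N , s≤δ) = from-modulus (cauchy δ (⅛ ℚ.* s) (*-pos (ℚ.positive⁻¹ ⅛) 0<s))
  where
  open +-*-Solver
  from-modulus : EventuallyWithin (⅛ ℚ.* s) (seq δ) → ∃ λ δ₀ → 0ℚ ℚ.< δ₀ × Bracket δ δ₀
  -- From this index on δ stays between 7/8 a and 9/8 a. The factor ¾ suits both sides: 9/8 of ¾ is
  -- 27/32, below 7/8, and 3/2 of ¾ is 9/8.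
  from-modulus (M , close) = ¾ ℚ.* a , *-pos (ℚ.positive⁻¹ ¾) (ℚ.<-≤-trans 0<s s≤a) , K , bounds
    where
    K : ℕ
    K = N ℕ.⊔ M
    a : ℚ
    a = seq δ K
    s≤a : s ℚ.≤ a
    s≤a = ℚ.≤-trans (ℚ.≤-reflexive (sym (ℚ.+-identityˡ s))) (s≤δ K (ℕ.m≤m⊔n N M))
    0≤a : 0ℚ ℚ.≤ a
    0≤a = ℚ.≤-trans (ℚ.<⇒≤ 0<s) s≤a
    1/32 : ℚ
    1/32 = ℤ.+ 1 ℚ./ 32
    ⅛s≤⅛a : ⅛ ℚ.* s ℚ.≤ ⅛ ℚ.* a
    ⅛s≤⅛a = *-monoʳ ⅛ (ℚ.nonNegative⁻¹ ⅛) s≤a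
    bounds : ∀ m → K ℕ.≤ m → ¾ ℚ.* a ℚ.+ ⅛ ℚ.* (¾ ℚ.* a) ℚ.≤ seq δ m × seq δ m ℚ.≤ 3/2 ℚ.* (¾ ℚ.* a)
    bounds m m≥ = lower , upper
      where
      b : ℚ
      b = seq δ m
      b≈a : Near (⅛ ℚ.* s) b a
      b≈a = close m K (ℕ.m⊔n≤o⇒n≤o N M m≥) (ℕ.m≤n⊔m N M)
      a≤ : a ℚ.≤ b ℚ.+ ⅛ ℚ.* a
      a≤ = ℚ.≤-trans (∣-∣≤⇒≤+ a b (near-sym {b} {a} b≈a)) (ℚ.+-monoʳ-≤ b ⅛s≤⅛a)
      lower : ¾ ℚ.* a ℚ.+ ⅛ ℚ.* (¾ ℚ.* a) ℚ.≤ b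
      lower = ≤-by (1/32 ℚ.* a ℚ.+ ((b ℚ.+ ⅛ ℚ.* a) ℚ.- a))
        (+-nonNeg (*-nonNeg (ℚ.nonNegative⁻¹ 1/32) 0≤a) (≤⇒0≤- a≤))
        (solve 2 (λ a b → (con ¾ :* a :+ con ⅛ :* (con ¾ :* a)) :+ (con 1/32 :* a :+ ((b :+ con ⅛ :* a) :- a)) := b)
          refl a b)
      upper : b ℚ.≤ 3/2 ℚ.* (¾ ℚ.* a)
      upper = ℚ.≤-trans (∣-∣≤⇒≤+ b a b≈a) (ℚ.≤-trans (ℚ.+-monoʳ-≤ a ⅛s≤⅛a)
        (ℚ.≤-reflexive (solve 1 (λ a → a :+ con ⅛ :* a := con 3/2 :* (con ¾ :* a)) refl a)))

-- The factor 8 is there because (11/12)^8 ≤ ½.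

budget : ℕ → ℕ → ℕ
budget q ℓ = ((3 ℕ.+ q) ℕ.* ℓ) ℕ.* 8

-- Eight queries gain a factor ½, so the budget gives 3 + q factors h = 2^(-ℓ). Of these, q cancel
-- the number of candidates, since h times the dimension is at most δ₀ ≤ ½ and h times its successor
-- at most 1. One more is at most δ₀, and the last two give ¼.
budget-suffices : ∀ n {δ₀} ℓ q → 0ℚ ℚ.< δ₀ → δ₀ ℚ.≤ ½ → fromℕℚ (suc n) ℚ.≤ δ₀ ℚ.* 2ℚ ^ℚ ℓ →
  11/12 ^ℚ budget q ℓ ℚ.* fromℕℚ (suc (suc n)) ^ℚ q ℚ.≤ ¼ ℚ.* δ₀
budget-suffices n {δ₀} ℓ q 0<δ₀ δ₀≤½ n≤ = begin
  11/12 ^ℚ budget q ℓ ℚ.* a ^ℚ q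
    ≤⟨ *-monoˡ (a ^ℚ q) (^-nonNeg q (fromℕℚ-nonNeg (suc (suc n)))) power≤ ⟩
  (h ℚ.* (h ℚ.* (h ℚ.* h ^ℚ q))) ℚ.* a ^ℚ q
    ≡⟨ solve 3 (λ h p s → (h :* (h :* (h :* p))) :* s := h :* ((h :* h) :* (p :* s))) refl h (h ^ℚ q) (a ^ℚ q) ⟩
  h ℚ.* ((h ℚ.* h) ℚ.* (h ^ℚ q ℚ.* a ^ℚ q))
    ≡⟨ cong (λ u → h ℚ.* ((h ℚ.* h) ℚ.* u)) (sym (^-distribʳ-* h a q)) ⟩
  h ℚ.* ((h ℚ.* h) ℚ.* (h ℚ.* a) ^ℚ q)
    ≤⟨ *-mono-≤ 0≤h (*-nonNeg (ℚ.nonNegative⁻¹ (½ ℚ.* ½)) (ℚ.<⇒≤ 0<1)) h≤δ₀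
         (*-mono-≤ (*-nonNeg 0≤h 0≤h) (ℚ.<⇒≤ 0<1) (*-mono-≤ 0≤h (ℚ.nonNegative⁻¹ ½) h≤½ h≤½) ha^q≤1) ⟩
  δ₀ ℚ.* ((½ ℚ.* ½) ℚ.* 1ℚ)
    ≡⟨ solve 1 (λ d → d :* con ((½ ℚ.* ½) ℚ.* 1ℚ) := con ¼ :* d) refl δ₀ ⟩
  ¼ ℚ.* δ₀ ∎
  where
  open ℚ.≤-Reasoning
  open +-*-Solver
  a b h : ℚ
  a = fromℕℚ (suc (suc n))
  b = fromℕℚ (suc n)
  h = ½ ^ℚ ℓ
  0≤h : 0ℚ ℚ.≤ h
  0≤h = ^-nonNeg ℓ (ℚ.nonNegative⁻¹ ½)

  power≤ : 11/12 ^ℚ budget q ℓ ℚ.≤ h ^ℚ (3 ℕ.+ q)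
  power≤ = begin
    11/12 ^ℚ budget q ℓ                ≡⟨ sym (^-*-assoc 11/12 8 ((3 ℕ.+ q) ℕ.* ℓ)) ⟩
    (11/12 ^ℚ 8) ^ℚ ((3 ℕ.+ q) ℕ.* ℓ)  ≤⟨ ^-mono-≤ ((3 ℕ.+ q) ℕ.* ℓ) (^-nonNeg 8 (ℚ.nonNegative⁻¹ 11/12)) (ℚ.≤ᵇ⇒≤ tt) ⟩
    ½ ^ℚ ((3 ℕ.+ q) ℕ.* ℓ)             ≡⟨ sym (^-*-assoc ½ ℓ (3 ℕ.+ q)) ⟩
    h ^ℚ (3 ℕ.+ q)                     ∎

  hb≤δ₀ : h ℚ.* b ℚ.≤ δ₀
  hb≤δ₀ = begin
    h ℚ.* b                     ≤⟨ *-monoʳ h 0≤h n≤ ⟩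
    h ℚ.* (δ₀ ℚ.* 2ℚ ^ℚ ℓ)      ≡⟨ solve 3 (λ h d t → h :* (d :* t) := d :* (h :* t)) refl h δ₀ (2ℚ ^ℚ ℓ) ⟩
    δ₀ ℚ.* (h ℚ.* 2ℚ ^ℚ ℓ)      ≡⟨ cong (δ₀ ℚ.*_) (trans (sym (^-distribʳ-* ½ 2ℚ ℓ)) (1^ ℓ)) ⟩
    δ₀ ℚ.* 1ℚ                   ≡⟨ ℚ.*-identityʳ δ₀ ⟩
    δ₀                          ∎

  h≤δ₀ : h ℚ.≤ δ₀
  h≤δ₀ = ℚ.≤-trans (ℚ.≤-reflexive (sym (ℚ.*-identityʳ h)))
    (ℚ.≤-trans (*-monoʳ h 0≤h (1≤fromℕℚ n)) hb≤δ₀)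

  h≤½ : h ℚ.≤ ½
  h≤½ = ℚ.≤-trans h≤δ₀ δ₀≤½

  ha≤1 : h ℚ.* a ℚ.≤ 1ℚ
  ha≤1 = begin
    h ℚ.* a                  ≡⟨ cong (h ℚ.*_) (fromℕℚ-suc (suc n)) ⟩
    h ℚ.* (1ℚ ℚ.+ b)         ≤⟨ *-monoʳ h 0≤h (ℚ.+-monoˡ-≤ b (1≤fromℕℚ n)) ⟩
    h ℚ.* (b ℚ.+ b)          ≡⟨ ℚ.*-distribˡ-+ h b b ⟩
    h ℚ.* b ℚ.+ h ℚ.* b      ≤⟨ ℚ.+-mono-≤ (ℚ.≤-trans hb≤δ₀ δ₀≤½) (ℚ.≤-trans hb≤δ₀ δ₀≤½) ⟩
    ½ ℚ.+ ½                  ≡⟨ refl ⟩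
    1ℚ                       ∎

  ha^q≤1 : (h ℚ.* a) ^ℚ q ℚ.≤ 1ℚ
  ha^q≤1 = ℚ.≤-trans (^-mono-≤ q (*-nonNeg 0≤h (fromℕℚ-nonNeg (suc (suc n)))) ha≤1) (ℚ.≤-reflexive (1^ q))

-- Let y approximate n / δ, with n the dimension. Minimality of ℓ gives 2^ℓ ≤ 3 y, and δ₀ ≤ ½ gives
-- y ≥ 4/3, so that 3 ≤ y^5 and 2^ℓ ≤ y^6. Hence ℓ ≤ 6 L as reals. For the terms this holds only up
-- to an additive error; 1/7 is small enough for one more L to absorb it when ℓ ≥ 1.
log-bound : ∀ n δ {δ₀} ℓ (0<δ : 0ℝ < δ) L → 0ℝ < L → IsLog₂ (fromℕ (suc n) / δ [ 0<δ ]) L →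
  0ℚ ℚ.< δ₀ → δ₀ ℚ.≤ ½ → Bracket δ δ₀ → (∀ j → ℓ ≡ suc j → ¬ (fromℕℚ (suc n) ℚ.≤ δ₀ ℚ.* 2ℚ ^ℚ j)) →
  Eventually (λ m → fromℕℚ ℓ ℚ.≤ fromℕℚ 7 ℚ.* seq L m)
log-bound n δ {δ₀} ℓ 0<δ L 0<L isLog 0<δ₀ δ₀≤½ (N , bounds) minimal =
  eventually-map (λ m (le , 0≤Lm) → conclude ℓ le 0≤Lm)
    (eventually-× (≤⇒eventually {fromℕ ℓ} {fromℕ 6 * L} (Equivalence.to (isLog ℓ 6) 2^ℓ≤x^6) (ℚ.positive⁻¹ 1/7))
      (from-positive 0<L))
  where
  open +-*-Solver
  1/7 7/6 : ℚ
  1/7 = ℤ.+ 1 ℚ./ 7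
  7/6 = ℤ.+ 7 ℚ./ 6
  x : ℝ
  x = fromℕ (suc n) / δ [ 0<δ ]

  from-positive : 0ℝ < L → Eventually (λ m → 0ℚ ℚ.≤ seq L m)
  from-positive (s , 0<s , M , s≤L) = M , λ m m≥ →
    ℚ.≤-trans (ℚ.<⇒≤ 0<s) (ℚ.≤-trans (ℚ.≤-reflexive (sym (ℚ.+-identityˡ s))) (s≤L m m≥))

  conclude : ∀ ℓ {l} → fromℕℚ ℓ ℚ.≤ fromℕℚ 6 ℚ.* l ℚ.+ 1/7 → 0ℚ ℚ.≤ l → fromℕℚ ℓ ℚ.≤ fromℕℚ 7 ℚ.* l
  conclude zero    le 0≤l = *-nonNeg (fromℕℚ-nonNeg 7) 0≤l
  conclude (suc j) {l} le 0≤l = ≤-by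
    (7/6 ℚ.* ((fromℕℚ 6 ℚ.* l ℚ.+ 1/7) ℚ.- u) ℚ.+ (7/6 ℚ.* 1/7) ℚ.* (u ℚ.- 1ℚ))
    (+-nonNeg (*-nonNeg (ℚ.nonNegative⁻¹ 7/6) (≤⇒0≤- le))
      (*-nonNeg (ℚ.nonNegative⁻¹ (7/6 ℚ.* 1/7)) (≤⇒0≤- (1≤fromℕℚ j))))
    (solve 2 (λ u l → u :+ (con 7/6 :* ((con (fromℕℚ 6) :* l :+ con 1/7) :- u) :+
        con (7/6 ℚ.* 1/7) :* (u :- con 1ℚ)) := con (fromℕℚ 7) :* l) refl u l)
    where
    u : ℚ
    u = fromℕℚ (suc j)

  2^ℓ≤x^6 : 2ℝ ^ ℓ ≤ x ^ 6
  2^ℓ≤x^6 (η , 0<η , M , gap) = ℚ.<-irrefl refl (ℚ.<-≤-trans (x<x+ (seq (x ^ 6) m) 0<η)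
    (ℚ.≤-trans (gap m (ℕ.m≤n⊔m N M)) (ℚ.≤-trans (ℚ.≤-reflexive (seq-^ 2ℝ ℓ m))
      (ℚ.≤-trans (power≤ ℓ minimal) (ℚ.≤-trans 3y≤y^6 (ℚ.≤-reflexive (sym (seq-^ x 6 m))))))))
    where
    m : ℕ
    m = N ℕ.⊔ M
    b y : ℚ
    b = seq δ m
    y = fromℕℚ (suc n) ℚ.* recip b
    δ₀≤b : δ₀ ℚ.+ ⅛ ℚ.* δ₀ ℚ.≤ b
    δ₀≤b = proj₁ (bounds m (ℕ.m≤m⊔n N M))
    b≤ : b ℚ.≤ 3/2 ℚ.* δ₀
    b≤ = proj₂ (bounds m (ℕ.m≤m⊔n N M))
    0<b : 0ℚ ℚ.< b
    0<b = ℚ.<-≤-trans (ℚ.<-≤-trans 0<δ₀ (x≤x+ δ₀ (*-nonNeg (ℚ.nonNegative⁻¹ ⅛) (ℚ.<⇒≤ 0<δ₀)))) δ₀≤b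

    4/3≤y : 4/3 ℚ.≤ y
    4/3≤y = ℚ.≤-trans (ℚ.≤-reflexive (sym (ℚ.*-identityˡ 4/3)))
      (*-mono-≤ (ℚ.<⇒≤ 0<1) (ℚ.<⇒≤ (recip-pos 0<b)) (1≤fromℕℚ n)
        (recip-anti {b} {¾} 0<b (ℚ.≤-trans b≤ (*-monoʳ 3/2 (ℚ.nonNegative⁻¹ 3/2) δ₀≤½))))

    0≤y : 0ℚ ℚ.≤ y
    0≤y = ℚ.≤-trans (ℚ.nonNegative⁻¹ 4/3) 4/3≤y

    n≤ : fromℕℚ (suc n) ℚ.≤ δ₀ ℚ.* (3/2 ℚ.* y)
    n≤ = begin
      fromℕℚ (suc n)                      ≡⟨ sym (ℚ.*-identityʳ (fromℕℚ (suc n))) ⟩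
      fromℕℚ (suc n) ℚ.* 1ℚ               ≡⟨ cong (fromℕℚ (suc n) ℚ.*_) (sym (recip-inverseʳ 0<b)) ⟩
      fromℕℚ (suc n) ℚ.* (b ℚ.* recip b)  ≡⟨ solve 3 (λ n b r → n :* (b :* r) := b :* (n :* r)) refl (fromℕℚ (suc n)) b (recip b) ⟩
      b ℚ.* y                             ≤⟨ *-monoˡ y 0≤y b≤ ⟩
      (3/2 ℚ.* δ₀) ℚ.* y                  ≡⟨ solve 2 (λ d y → (con 3/2 :* d) :* y := d :* (con 3/2 :* y)) refl δ₀ y ⟩
      δ₀ ℚ.* (3/2 ℚ.* y)                  ∎
      where open ℚ.≤-Reasoning

    power≤ : ∀ ℓ → (∀ j → ℓ ≡ suc j → ¬ (fromℕℚ (suc n) ℚ.≤ δ₀ ℚ.* 2ℚ ^ℚ j)) → 2ℚ ^ℚ ℓ ℚ.≤ 3ℚ ℚ.* y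
    power≤ zero    _       = ℚ.≤-trans (ℚ.≤ᵇ⇒≤ tt) (*-monoʳ 3ℚ (ℚ.nonNegative⁻¹ 3ℚ) 4/3≤y)
    power≤ (suc j) minimal = ℚ.≤-trans
      (*-monoʳ 2ℚ (ℚ.nonNegative⁻¹ 2ℚ) (ℚ.*-cancelˡ-≤-pos δ₀ {{ℚ.positive 0<δ₀}}
        (ℚ.≤-trans (ℚ.<⇒≤ (ℚ.≰⇒> (minimal j refl))) n≤)))
      (ℚ.≤-reflexive (solve 1 (λ y → con 2ℚ :* (con 3/2 :* y) := con 3ℚ :* y) refl y))

    3y≤y^6 : 3ℚ ℚ.* y ℚ.≤ y ^ℚ 6
    3y≤y^6 = ℚ.≤-trans (ℚ.≤-reflexive (ℚ.*-comm 3ℚ y))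
      (*-monoʳ y 0≤y (ℚ.≤-trans (ℚ.≤ᵇ⇒≤ tt) (^-mono-≤ {4/3} {y} 5 (ℚ.nonNegative⁻¹ 4/3) 4/3≤y)))

-- Parity trees for the real distribution

error-constants : ∀ {n} (f : Vec Bool n → Bool) (r : Vec ℚ n) →
  errorℚ ([_] ∘ f) (pmf r) (leaf [ false ]) ℚ.+ errorℚ ([_] ∘ f) (pmf r) (leaf [ true ]) ≡ 1ℚ
error-constants f r = trans (sym (∑-+ (λ x → if wrong false x then pmf r x else 0ℚ)
                                      (λ x → if wrong true x then pmf r x else 0ℚ)))
  (trans (∑-cong λ x → cases (f x) (pmf r x)) (pmf-total r))
  where
  wrong : Bool → Vec Bool _ → Bool
  wrong v x = does (¬? (Vec.≡-dec Bool._≟_ [ v ] [ f x ]))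
  cases : ∀ b p → (if does (¬? (Vec.≡-dec Bool._≟_ [ false ] [ b ])) then p else 0ℚ) ℚ.+
                  (if does (¬? (Vec.≡-dec Bool._≟_ [ true ] [ b ])) then p else 0ℚ) ≡ p
  cases true  p = ℚ.+-identityʳ p
  cases false p = ℚ.+-identityˡ p

-- The case of large δ, which `budget-suffices` and `log-bound` exclude: one of the two constants
-- errs with probability at most ½ ≤ δ₀.
constant-tree : ∀ {n} (f : Vec Bool n → Bool) μ → IsProduct μ → ∀ ε δ {δ₀} → 0ℝ ≤ ε →
  0ℚ ℚ.< δ₀ → ½ ℚ.≤ δ₀ → Bracket δ δ₀ → ∃ λ v → error ([_] ∘ f) μ (leaf [ v ]) ≤ ε + δ
constant-tree {n} f μ isProduct ε δ {δ₀} 0≤ε 0<δ₀ ½≤δ₀ δ-bracket =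
  from-approximation (approximate-product μ isProduct (*-pos (^-pos n (ℚ.positive⁻¹ ½)) 0<τ))
  where
  open +-*-Solver
  1/16 τ : ℚ
  1/16 = ℤ.+ 1 ℚ./ 16
  τ = 1/16 ℚ.* δ₀
  0<τ : 0ℚ ℚ.< τ
  0<τ = *-pos (ℚ.positive⁻¹ 1/16) 0<δ₀

  room : Eventually (λ m → δ₀ ℚ.+ τ ℚ.≤ seq (ε + δ) m)
  room = eventually-map combine (eventually-× (≤⇒eventually {0ℝ} {ε} 0≤ε 0<τ) δ-bracket)
    where
    combine : ∀ m → seq 0ℝ m ℚ.≤ seq ε m ℚ.+ τ ×
      (δ₀ ℚ.+ ⅛ ℚ.* δ₀ ℚ.≤ seq δ m × seq δ m ℚ.≤ 3/2 ℚ.* δ₀) → δ₀ ℚ.+ τ ℚ.≤ seq ε m ℚ.+ seq δ m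
    combine m (ε≥ , δ≥ , _) = ≤-by ((seq ε m ℚ.+ τ) ℚ.+ (seq δ m ℚ.- (δ₀ ℚ.+ ⅛ ℚ.* δ₀)))
      (+-nonNeg (subst (ℚ._≤ seq ε m ℚ.+ τ) (seq-0ℝ m) ε≥) (≤⇒0≤- δ≥))
      (solve 3 (λ e d z → (z :+ con 1/16 :* z) :+ ((e :+ con 1/16 :* z) :+ (d :- (z :+ con ⅛ :* z))) := e :+ d)
        refl (seq ε m) (seq δ m) δ₀)

  from-approximation : (∃ λ (r : Vec ℚ n) → All UnitInterval r ×
      Eventually (λ m → ∀ x → Near (½ ^ℚ n ℚ.* τ) (seq (μ x) m) (pmf r x))) →
    ∃ λ v → error ([_] ∘ f) μ (leaf [ v ]) ≤ ε + δ
  from-approximation (r , us , μ≈pmf) = choose (ℚ.≤-total e₀ e₁)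
    where
    e₀ e₁ : ℚ
    e₀ = errorℚ ([_] ∘ f) (pmf r) (leaf [ false ])
    e₁ = errorℚ ([_] ∘ f) (pmf r) (leaf [ true ])
    half : ∀ {a b} → a ℚ.+ b ≡ 1ℚ → a ℚ.≤ b → a ℚ.≤ δ₀
    half {a} {b} eq a≤b = ℚ.≤-trans (≤-by (½ ℚ.* (b ℚ.- a)) (*-nonNeg (ℚ.nonNegative⁻¹ ½) (≤⇒0≤- a≤b))
      (trans (solve 2 (λ a b → a :+ con ½ :* (b :- a) := con ½ :* (a :+ b)) refl a b) (cong (½ ℚ.*_) eq))) ½≤δ₀
    choose : e₀ ℚ.≤ e₁ ⊎ e₁ ℚ.≤ e₀ → ∃ λ v → error ([_] ∘ f) μ (leaf [ v ]) ≤ ε + δ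
    choose (inj₁ e₀≤e₁) = false , errorℚ⇒error ([_] ∘ f) μ {pmf r} {ε + δ} (leaf [ false ]) 0<τ μ≈pmf room
      (half {e₀} {e₁} (error-constants f r) e₀≤e₁)
    choose (inj₂ e₁≤e₀) = true , errorℚ⇒error ([_] ∘ f) μ {pmf r} {ε + δ} (leaf [ true ]) 0<τ μ≈pmf room
      (half {e₁} {e₀} (trans (ℚ.+-comm e₁ e₀) (error-constants f r)) e₁≤e₀)

-- `directSumℚ` with η = ¼ δ₀ adds ½ δ₀ to the error. The approximations of the two distributions
-- and of ε cost five sixteenths at most, so everything fits below δ.
shallow-tree : ∀ {n} k (f : Vec Bool n → Bool) μ → IsProduct μ → ∀ ε δ {δ₀} q M → 0ℚ ℚ.< δ₀ → Bracket δ δ₀ →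
  ∀ T → error (directSum (suc k) f) (power (suc k) μ) T ≤ ε →
  fromℕℚ (depth T) ℚ.≤ fromℕℚ (suc q) ℚ.* (fromℕℚ (suc k) ℚ.* (¼ ℚ.* δ₀)) →
  11/12 ^ℚ M ℚ.* fromℕℚ (suc n) ^ℚ q ℚ.≤ ¼ ℚ.* δ₀ →
  ∃ λ T′ → depth T′ ℕ.≤ M × error ([_] ∘ f) μ T′ ≤ ε + δ
shallow-tree {n} k f μ isProduct ε δ {δ₀} q M 0<δ₀ δ-bracket T error≤ε depth≤ small =
  from-modulus (power-near {n} K (*-pos (^-pos (K ℕ.* n) (ℚ.positive⁻¹ ½)) 0<τ))
  where
  open +-*-Solver
  K : ℕ
  K = suc k
  1/16 τ : ℚ
  1/16 = ℤ.+ 1 ℚ./ 16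
  τ = 1/16 ℚ.* δ₀
  0<τ : 0ℚ ℚ.< τ
  0<τ = *-pos (ℚ.positive⁻¹ 1/16) 0<δ₀

  Goal : Set
  Goal = ∃ λ T′ → depth T′ ℕ.≤ M × error ([_] ∘ f) μ T′ ≤ ε + δ

  from-modulus : (∃ λ θ → 0ℚ ℚ.< θ × (∀ (μ : Vec Bool n → ℝ) {r} m → All UnitInterval r →
      (∀ x → Near θ (seq (μ x) m) (pmf r x)) →
      ∀ x → Near (½ ^ℚ (K ℕ.* n) ℚ.* τ) (seq (power K μ x) m) (pmf (powerℚ K r) x))) → Goal
  from-modulus (θ , 0<θ , power≈) =
    from-approximation (approximate-product μ isProduct (⊓-pos 0<θ (*-pos (^-pos n (ℚ.positive⁻¹ ½)) 0<τ)))
    where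
    κ : ℚ
    κ = ½ ^ℚ n ℚ.* τ
    from-approximation : (∃ λ (r : Vec ℚ n) → All UnitInterval r ×
      Eventually (λ m → ∀ x → Near (θ ℚ.⊓ κ) (seq (μ x) m) (pmf r x))) → Goal
    from-approximation (r , us , μ≈pmf) = from-index
      (eventually-× μ≈pmf (≤⇒eventually {error (directSum K f) (power K μ) T} {ε} error≤ε 0<τ)) (cauchy ε τ 0<τ)
      where
      μ≈pmf′ : Eventually (λ m → ∀ x → Near κ (seq (μ x) m) (pmf r x))
      μ≈pmf′ = eventually-map (λ m close x → ℚ.≤-trans (close x) (ℚ.p⊓q≤q θ κ)) μ≈pmf

      from-index : Eventually (λ m → (∀ x → Near (θ ℚ.⊓ κ) (seq (μ x) m) (pmf r x)) ×
          seq (error (directSum K f) (power K μ) T) m ℚ.≤ seq ε m ℚ.+ τ) →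
        EventuallyWithin τ (seq ε) → Goal
      from-index (N₁ , good) (N₂ , ε-close) =
        from-tree (directSumℚ k f us T q M {e} {¼ ℚ.* δ₀} error≤e depth≤ small)
        where
        m₀ : ℕ
        m₀ = N₁ ℕ.⊔ N₂
        -- One τ is for the hypothesis on the real error, which bounds its terms only approximately,
        -- the other for passing to the rational distribution.
        e : ℚ
        e = (seq ε m₀ ℚ.+ τ) ℚ.+ τ
        close₀ : ∀ x → Near (θ ℚ.⊓ κ) (seq (μ x) m₀) (pmf r x)
        close₀ = proj₁ (good m₀ (ℕ.m≤m⊔n N₁ N₂))

        error≤e : errorℚ (directSum K f) (pmf (powerℚ K r)) T ℚ.≤ e
        error≤e = begin
          errorℚ (directSum K f) (pmf (powerℚ K r)) T
            ≤⟨ errorℚ-near (directSum K f) T 0<τ (λ x → near-sym {seq (power K μ x) m₀} {pmf (powerℚ K r) x}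
                 (power≈ μ m₀ us (λ y → ℚ.≤-trans (close₀ y) (ℚ.p⊓q≤p θ κ)) x)) ⟩
          errorℚ (directSum K f) (λ x → seq (power K μ x) m₀) T ℚ.+ τ
            ≡⟨ cong (ℚ._+ τ) (sym (seq-error (directSum K f) (power K μ) T m₀)) ⟩
          seq (error (directSum K f) (power K μ) T) m₀ ℚ.+ τ
            ≤⟨ ℚ.+-monoˡ-≤ τ (proj₂ (good m₀ (ℕ.m≤m⊔n N₁ N₂))) ⟩
          e ∎
          where open ℚ.≤-Reasoning

        B : ℚ
        B = (e ℚ.+ ¼ ℚ.* δ₀) ℚ.+ ¼ ℚ.* δ₀

        room : Eventually (λ m → B ℚ.+ τ ℚ.≤ seq (ε + δ) m)
        room = eventually-map combine (eventually-× (N₂ , λ m m≥ → ∣-∣≤⇒≤+ (seq ε m₀) (seq ε m)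
          (ε-close m₀ m (ℕ.m≤n⊔m N₁ N₂) m≥)) δ-bracket)
          where
          combine : ∀ m → seq ε m₀ ℚ.≤ seq ε m ℚ.+ τ ×
            (δ₀ ℚ.+ ⅛ ℚ.* δ₀ ℚ.≤ seq δ m × seq δ m ℚ.≤ 3/2 ℚ.* δ₀) → B ℚ.+ τ ℚ.≤ seq ε m ℚ.+ seq δ m
          combine m (ε≥ , δ≥ , _) = ≤-by
            ((((seq ε m ℚ.+ τ) ℚ.- seq ε m₀) ℚ.+ (seq δ m ℚ.- (δ₀ ℚ.+ ⅛ ℚ.* δ₀))) ℚ.+ (⅛ ℚ.+ ¼) ℚ.* δ₀)
            (+-nonNeg (+-nonNeg (≤⇒0≤- ε≥) (≤⇒0≤- δ≥)) (*-nonNeg (ℚ.nonNegative⁻¹ (⅛ ℚ.+ ¼)) (ℚ.<⇒≤ 0<δ₀)))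
            (solve 4 (λ e₀ e d z →
                ((((e₀ :+ con 1/16 :* z) :+ con 1/16 :* z) :+ con ¼ :* z) :+ con ¼ :* z) :+ con 1/16 :* z :+
                ((((e :+ con 1/16 :* z) :- e₀) :+ (d :- (z :+ con ⅛ :* z))) :+ con (⅛ ℚ.+ ¼) :* z) := e :+ d)
              refl (seq ε m₀) (seq ε m) (seq δ m) δ₀)

        from-tree : (∃ λ (T′ : ParityTree n (Vec Bool 1)) →
          depth T′ ℕ.≤ M × errorℚ ([_] ∘ f) (pmf r) T′ ℚ.≤ B) → Goal
        from-tree (T′ , shallow , accurate) = T′ , shallow ,
          errorℚ⇒error ([_] ∘ f) μ {pmf r} {ε + δ} T′ 0<τ μ≈pmf′ room accurate

-- The final estimate

-- The constants of the theorem: e ≤ 8 (q + 3) ℓ ≤ 56 (q + 3) l, hence C = 3 · 56, and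
-- b ≤ 3/2 δ₀ with q K δ₀ ≤ 4 d, hence c = 1 / (56 · 3/2 · 4).

contradictory-bound : ∀ (q ℓ e d : ℕ) {K δ₀ b l η} → 0ℚ ℚ.< l → 0ℚ ℚ.≤ K → 0ℚ ℚ.≤ b → 0ℚ ℚ.< η →
  fromℕℚ ℓ ℚ.≤ fromℕℚ 7 ℚ.* l → e ℕ.≤ budget q ℓ → b ℚ.≤ 3/2 ℚ.* δ₀ →
  fromℕℚ q ℚ.* (K ℚ.* (¼ ℚ.* δ₀)) ℚ.≤ fromℕℚ d →
  ¬ (fromℕℚ d ℚ.+ η ℚ.≤
    ((ℤ.+ 1 ℚ./ 336) ℚ.* ((K ℚ.* b) ℚ.* recip l)) ℚ.* (fromℕℚ e ℚ.+ ℚ.- (fromℕℚ 168 ℚ.* l)))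
contradictory-bound q ℓ e d {K} {δ₀} {b} {l} {η} 0<l 0≤K 0≤b 0<η ℓ≤ e≤ b≤ q≤ bound =
  ℚ.<-irrefl refl (ℚ.<-≤-trans (x<x+ (fromℕℚ d) 0<η) (ℚ.≤-trans bound (begin
    F ℚ.* (fromℕℚ e ℚ.+ ℚ.- (fromℕℚ 168 ℚ.* l))
      ≤⟨ *-monoʳ F 0≤F e-Cl≤ ⟩
    F ℚ.* (fromℕℚ 56 ℚ.* (fromℕℚ q ℚ.* l))
      ≡⟨ solve 5 (λ K b r q l → (con c :* ((K :* b) :* r)) :* (con (fromℕℚ 56) :* (q :* l)) :=
           con (c ℚ.* fromℕℚ 56) :* ((q :* (K :* b)) :* (l :* r))) refl K b (recip l) (fromℕℚ q) l ⟩
    (c ℚ.* fromℕℚ 56) ℚ.* ((fromℕℚ q ℚ.* (K ℚ.* b)) ℚ.* (l ℚ.* recip l))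
      ≡⟨ cong (λ u → (c ℚ.* fromℕℚ 56) ℚ.* ((fromℕℚ q ℚ.* (K ℚ.* b)) ℚ.* u)) (recip-inverseʳ 0<l) ⟩
    (c ℚ.* fromℕℚ 56) ℚ.* ((fromℕℚ q ℚ.* (K ℚ.* b)) ℚ.* 1ℚ)
      ≡⟨ cong ((c ℚ.* fromℕℚ 56) ℚ.*_) (ℚ.*-identityʳ (fromℕℚ q ℚ.* (K ℚ.* b))) ⟩
    (c ℚ.* fromℕℚ 56) ℚ.* (fromℕℚ q ℚ.* (K ℚ.* b))
      ≤⟨ *-monoʳ (c ℚ.* fromℕℚ 56) (ℚ.nonNegative⁻¹ (c ℚ.* fromℕℚ 56))
           (*-monoʳ (fromℕℚ q) (fromℕℚ-nonNeg q) (*-monoʳ K 0≤K b≤)) ⟩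
    (c ℚ.* fromℕℚ 56) ℚ.* (fromℕℚ q ℚ.* (K ℚ.* (3/2 ℚ.* δ₀)))
      ≡⟨ solve 3 (λ q K z → con (c ℚ.* fromℕℚ 56) :* (q :* (K :* (con 3/2 :* z))) := q :* (K :* (con ¼ :* z)))
           refl (fromℕℚ q) K δ₀ ⟩
    fromℕℚ q ℚ.* (K ℚ.* (¼ ℚ.* δ₀))
      ≤⟨ q≤ ⟩
    fromℕℚ d ∎)))
  where
  open ℚ.≤-Reasoning
  open +-*-Solver
  c F : ℚ
  c = ℤ.+ 1 ℚ./ 336
  F = c ℚ.* ((K ℚ.* b) ℚ.* recip l)
  0≤F : 0ℚ ℚ.≤ F
  0≤F = *-nonNeg (ℚ.nonNegative⁻¹ c) (*-nonNeg (*-nonNeg 0≤K 0≤b) (ℚ.<⇒≤ (recip-pos 0<l)))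

  e≤ℚ : fromℕℚ e ℚ.≤ ((3ℚ ℚ.+ fromℕℚ q) ℚ.* (fromℕℚ 7 ℚ.* l)) ℚ.* fromℕℚ 8
  e≤ℚ = begin
    fromℕℚ e                                                  ≤⟨ fromℕℚ-mono e≤ ⟩
    fromℕℚ (((3 ℕ.+ q) ℕ.* ℓ) ℕ.* 8)                          ≡⟨ fromℕℚ-* ((3 ℕ.+ q) ℕ.* ℓ) 8 ⟩
    fromℕℚ ((3 ℕ.+ q) ℕ.* ℓ) ℚ.* fromℕℚ 8                     ≡⟨ cong (ℚ._* fromℕℚ 8) (fromℕℚ-* (3 ℕ.+ q) ℓ) ⟩
    (fromℕℚ (3 ℕ.+ q) ℚ.* fromℕℚ ℓ) ℚ.* fromℕℚ 8              ≡⟨ cong (λ u → (u ℚ.* fromℕℚ ℓ) ℚ.* fromℕℚ 8) (fromℕℚ-+ 3 q) ⟩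
    ((3ℚ ℚ.+ fromℕℚ q) ℚ.* fromℕℚ ℓ) ℚ.* fromℕℚ 8             ≤⟨ *-monoˡ (fromℕℚ 8) (fromℕℚ-nonNeg 8)
      (*-monoʳ (3ℚ ℚ.+ fromℕℚ q) (+-nonNeg (ℚ.nonNegative⁻¹ 3ℚ) (fromℕℚ-nonNeg q)) ℓ≤) ⟩
    ((3ℚ ℚ.+ fromℕℚ q) ℚ.* (fromℕℚ 7 ℚ.* l)) ℚ.* fromℕℚ 8     ∎

  e-Cl≤ : fromℕℚ e ℚ.+ ℚ.- (fromℕℚ 168 ℚ.* l) ℚ.≤ fromℕℚ 56 ℚ.* (fromℕℚ q ℚ.* l)
  e-Cl≤ = ℚ.≤-trans (ℚ.+-monoˡ-≤ (ℚ.- (fromℕℚ 168 ℚ.* l)) e≤ℚ)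
    (ℚ.≤-reflexive (solve 2 (λ q l → ((con 3ℚ :+ q) :* (con (fromℕℚ 7) :* l)) :* con (fromℕℚ 8) :- con (fromℕℚ 168) :* l
      := con (fromℕℚ 56) :* (q :* l)) refl (fromℕℚ q) l))

-- The conclusion is the negation of a strict gap. With a rational δ₀ in place of δ the case
-- distinction at ½ is decidable, and either case ends in `contradictory-bound` at an index late
-- enough for the gap and all approximations.
lower-bound : ∀ n k (f : Vec Bool (suc n) → Bool) μ → IsProduct μ → ∀ ε δ → 0ℝ ≤ ε →
  (0<δ : 0ℝ < δ) → ∀ L → IsLog₂ (fromℕ (suc n) / δ [ 0<δ ]) L → (0<L : 0ℝ < L) → ∀ d e →
  (∃ λ T → error (directSum (suc k) f) (power (suc k) μ) T ≤ ε × depth T ≡ d) →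
  (∀ T → error ([_] ∘ f) μ T ≤ ε + δ → e ℕ.≤ depth T) →
  fromℚ (ℤ.+ 1 ℚ./ 336) * (fromℕ (suc k) * δ / L [ 0<L ]) * (fromℕ e - fromℕ 168 * L) ≤ fromℕ d
lower-bound n k f μ isProduct ε δ 0≤ε 0<δ L isLog 0<L@(s , 0<s , N , s≤L) d e (T , error≤ε , depth≡d) e-least
  (η , 0<η , M , gap) = from-bracket (bracket δ 0<δ)
  where
  K : ℚ
  K = fromℕℚ (suc k)

  L-pos : Eventually (λ m → 0ℚ ℚ.< seq L m)
  L-pos = N , λ m m≥ → ℚ.<-≤-trans 0<s (ℚ.≤-trans (ℚ.≤-reflexive (sym (ℚ.+-identityˡ s))) (s≤L m m≥))

  from-bracket : (∃ λ δ₀ → 0ℚ ℚ.< δ₀ × Bracket δ δ₀) → ⊥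
  from-bracket (δ₀ , 0<δ₀ , δ-bracket) = choose (½ ℚ.≤? δ₀)
    where
    conclude : ∀ q ℓ → Eventually (λ m → fromℕℚ ℓ ℚ.≤ fromℕℚ 7 ℚ.* seq L m) → e ℕ.≤ budget q ℓ →
               fromℕℚ q ℚ.* (K ℚ.* (¼ ℚ.* δ₀)) ℚ.≤ fromℕℚ d → ⊥
    conclude q ℓ ℓ≤7L e≤ q≤ = at-index (eventually-× ℓ≤7L (eventually-× L-pos δ-bracket))
      where
      at-index : Eventually (λ m → fromℕℚ ℓ ℚ.≤ fromℕℚ 7 ℚ.* seq L m ×
        (0ℚ ℚ.< seq L m × (δ₀ ℚ.+ ⅛ ℚ.* δ₀ ℚ.≤ seq δ m × seq δ m ℚ.≤ 3/2 ℚ.* δ₀))) → ⊥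
      at-index (N′ , facts) = contradictory-bound q ℓ e d {K} {δ₀} {seq δ m} {seq L m} {η}
        (proj₁ (proj₂ (facts m m≥))) (fromℕℚ-nonNeg (suc k))
        (ℚ.≤-trans (ℚ.≤-trans (ℚ.<⇒≤ 0<δ₀) (x≤x+ δ₀ (*-nonNeg (ℚ.nonNegative⁻¹ ⅛) (ℚ.<⇒≤ 0<δ₀))))
          (proj₁ (proj₂ (proj₂ (facts m m≥)))))
        0<η (proj₁ (facts m m≥)) e≤ (proj₂ (proj₂ (proj₂ (facts m m≥)))) q≤ (gap m (ℕ.m≤m⊔n M N′))
        where
        m : ℕ
        m = M ℕ.⊔ N′
        m≥ : N′ ℕ.≤ m
        m≥ = ℕ.m≤n⊔m M N′

    few-queries : δ₀ ℚ.≤ ½ →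
      (∃ λ q → fromℕℚ d ℚ.≤ fromℕℚ (suc q) ℚ.* (K ℚ.* (¼ ℚ.* δ₀)) ×
        (∀ j → q ≡ suc j → ¬ (fromℕℚ d ℚ.≤ fromℕℚ (suc j) ℚ.* (K ℚ.* (¼ ℚ.* δ₀))))) →
      (∃ λ ℓ → fromℕℚ (suc n) ℚ.≤ δ₀ ℚ.* 2ℚ ^ℚ ℓ ×
        (∀ j → ℓ ≡ suc j → ¬ (fromℕℚ (suc n) ℚ.≤ δ₀ ℚ.* 2ℚ ^ℚ j))) → ⊥
    few-queries δ₀≤½ (q , d≤ , q-minimal) (ℓ , n≤ , ℓ-minimal) =
      conclude q ℓ (log-bound n δ ℓ 0<δ L 0<L isLog 0<δ₀ δ₀≤½ δ-bracket ℓ-minimal)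
        (from-tree (shallow-tree k f μ isProduct ε δ q (budget q ℓ) 0<δ₀ δ-bracket T error≤ε
          (subst (λ u → fromℕℚ u ℚ.≤ fromℕℚ (suc q) ℚ.* (K ℚ.* (¼ ℚ.* δ₀))) (sym depth≡d) d≤)
          (budget-suffices n ℓ q 0<δ₀ δ₀≤½ n≤)))
        (below q q-minimal)
      where
      from-tree : (∃ λ T′ → depth T′ ℕ.≤ budget q ℓ × error ([_] ∘ f) μ T′ ≤ ε + δ) → e ℕ.≤ budget q ℓ
      from-tree (T′ , shallow , accurate) = ℕ.≤-trans (e-least T′ accurate) shallow
      below : ∀ q → (∀ j → q ≡ suc j → ¬ (fromℕℚ d ℚ.≤ fromℕℚ (suc j) ℚ.* (K ℚ.* (¼ ℚ.* δ₀)))) →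
              fromℕℚ q ℚ.* (K ℚ.* (¼ ℚ.* δ₀)) ℚ.≤ fromℕℚ d
      below zero    _       = ℚ.≤-trans (ℚ.≤-reflexive (ℚ.*-zeroˡ (K ℚ.* (¼ ℚ.* δ₀)))) (fromℕℚ-nonNeg d)
      below (suc j) minimal = ℚ.<⇒≤ (ℚ.≰⇒> (minimal j refl))

    -- `suc q` is what Markov's inequality allows, while failure at the predecessor bounds the
    -- q-fold multiple by `d`; so the loss of one unit does not reach the constant.
    least-q : ∃ λ q → fromℕℚ d ℚ.≤ fromℕℚ (suc q) ℚ.* (K ℚ.* (¼ ℚ.* δ₀)) ×
        (∀ j → q ≡ suc j → ¬ (fromℕℚ d ℚ.≤ fromℕℚ (suc j) ℚ.* (K ℚ.* (¼ ℚ.* δ₀))))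
    least-q = from-multiple (archimedean 0<ρ)
      where
      ρ : ℚ
      ρ = K ℚ.* (¼ ℚ.* δ₀)
      0<ρ : 0ℚ ℚ.< ρ
      0<ρ = *-pos (fromℕℚ-pos k) (*-pos (ℚ.positive⁻¹ ¼) 0<δ₀)
      from-multiple : (∃ λ N → 1ℚ ℚ.≤ fromℕℚ N ℚ.* ρ) → _
      from-multiple (N , 1≤Nρ) = threshold (λ q → fromℕℚ d ℚ.≤? fromℕℚ (suc q) ℚ.* ρ) (d ℕ.* N) (begin
        fromℕℚ d                          ≡⟨ sym (ℚ.*-identityʳ (fromℕℚ d)) ⟩
        fromℕℚ d ℚ.* 1ℚ                   ≤⟨ *-monoʳ (fromℕℚ d) (fromℕℚ-nonNeg d) 1≤Nρ ⟩
        fromℕℚ d ℚ.* (fromℕℚ N ℚ.* ρ)     ≡⟨ sym (ℚ.*-assoc (fromℕℚ d) (fromℕℚ N) ρ) ⟩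
        (fromℕℚ d ℚ.* fromℕℚ N) ℚ.* ρ     ≡⟨ cong (ℚ._* ρ) (sym (fromℕℚ-* d N)) ⟩
        fromℕℚ (d ℕ.* N) ℚ.* ρ            ≤⟨ *-monoˡ ρ (ℚ.<⇒≤ 0<ρ) (fromℕℚ-mono (ℕ.n≤1+n (d ℕ.* N))) ⟩
        fromℕℚ (suc (d ℕ.* N)) ℚ.* ρ      ∎)
        where open ℚ.≤-Reasoning

    least-ℓ : ∃ λ ℓ → fromℕℚ (suc n) ℚ.≤ δ₀ ℚ.* 2ℚ ^ℚ ℓ ×
        (∀ j → ℓ ≡ suc j → ¬ (fromℕℚ (suc n) ℚ.≤ δ₀ ℚ.* 2ℚ ^ℚ j))
    least-ℓ = from-multiple (archimedean 0<δ₀)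
      where
      a : ℚ
      a = fromℕℚ (suc n)
      from-multiple : (∃ λ N → 1ℚ ℚ.≤ fromℕℚ N ℚ.* δ₀) → _
      from-multiple (N , 1≤Nδ₀) = threshold (λ ℓ → a ℚ.≤? δ₀ ℚ.* 2ℚ ^ℚ ℓ) (suc n ℕ.* N) (begin
        a                                  ≡⟨ sym (ℚ.*-identityʳ a) ⟩
        a ℚ.* 1ℚ                           ≤⟨ *-monoʳ a (fromℕℚ-nonNeg (suc n)) 1≤Nδ₀ ⟩
        a ℚ.* (fromℕℚ N ℚ.* δ₀)            ≡⟨ sym (ℚ.*-assoc a (fromℕℚ N) δ₀) ⟩
        (a ℚ.* fromℕℚ N) ℚ.* δ₀            ≡⟨ cong (ℚ._* δ₀) (sym (fromℕℚ-* (suc n) N)) ⟩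
        fromℕℚ (suc n ℕ.* N) ℚ.* δ₀        ≡⟨ ℚ.*-comm (fromℕℚ (suc n ℕ.* N)) δ₀ ⟩
        δ₀ ℚ.* fromℕℚ (suc n ℕ.* N)        ≤⟨ *-monoʳ δ₀ (ℚ.<⇒≤ 0<δ₀) (fromℕℚ≤2^ (suc n ℕ.* N)) ⟩
        δ₀ ℚ.* 2ℚ ^ℚ (suc n ℕ.* N)         ∎)
        where open ℚ.≤-Reasoning

    no-queries : (∃ λ v → error ([_] ∘ f) μ (leaf [ v ]) ≤ ε + δ) → ⊥
    -- A constant tree has depth 0, which is also `budget 0 0`, so `e` is 0 and the remaining bounds
    -- hold trivially.
    no-queries (v , accurate) = conclude 0 0
      (eventually-map (λ m 0<Lm → *-nonNeg (fromℕℚ-nonNeg 7) (ℚ.<⇒≤ 0<Lm)) L-pos)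
      (e-least (leaf [ v ]) accurate)
      (ℚ.≤-trans (ℚ.≤-reflexive (ℚ.*-zeroˡ (K ℚ.* (¼ ℚ.* δ₀)))) (fromℕℚ-nonNeg d))

    choose : Dec (½ ℚ.≤ δ₀) → ⊥
    choose (yes ½≤δ₀) = no-queries (constant-tree f μ isProduct ε δ 0≤ε 0<δ₀ ½≤δ₀ δ-bracket)
    choose (no ½≰δ₀)  = few-queries (ℚ.<⇒≤ (ℚ.≰⇒> ½≰δ₀)) least-q least-ℓ

theorem5 : ∃ λ (C : ℝ) → ∃ λ (c : ℝ) → 0ℝ < C × 0ℝ < c ×
    (∀ (n k : ℕ) → 1 ℕ.≤ n → 1 ℕ.≤ k →
    ∀ (f : Vec Bool n → Bool) (μ : Vec Bool n → ℝ) → IsProduct μ →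
    ∀ (ε δ : ℝ) → 0ℝ ≤ ε → (0<δ : 0ℝ < δ) (δ<n : δ < fromℕ n) →
    ∀ (L : ℝ) (isLog : IsLog₂ (fromℕ n / δ [ 0<δ ]) L) →
    let 0<L = log₂-pos (fromℕ n / δ [ 0<δ ]) L isLog (1<n/δ n δ 0<δ δ<n) in
    ∀ (d e : ℕ) → D[ directSum k f , power k μ , ε ]≡ d → D[ [_] ∘ f , μ , ε + δ ]≡ e →
    c * (fromℕ k * δ / L [ 0<L ]) * (fromℕ e - C * L) ≤ fromℕ d)
theorem5 = fromℕ 168 , fromℚ (ℤ.+ 1 ℚ./ 336) ,
  (1ℚ , 0<1 , 0 , λ _ _ → ℚ.≤ᵇ⇒≤ tt) , (ℤ.+ 1 ℚ./ 336 , ℚ.positive⁻¹ (ℤ.+ 1 ℚ./ 336) , 0 , λ _ _ → ℚ.≤ᵇ⇒≤ tt) ,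
  λ { (suc n) (suc k) _ _ f μ isProduct ε δ 0≤ε 0<δ δ<n L isLog d e (solver , _) (_ , e-least) →
      lower-bound n k f μ isProduct ε δ 0≤ε 0<δ L isLog
        (log₂-pos (fromℕ (suc n) / δ [ 0<δ ]) L isLog (1<n/δ (suc n) δ 0<δ δ<n)) d e solver e-least }
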